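{- Fix integers $q\ge 0$, $n>0$ and $g\ge 0$ with $2g-q+n\ge 3$. For $\beta=(\beta_1,\ldots,\beta_n)$ a tuple of positive integers let $|\beta|=\beta_1+\cdots+\beta_n$ and $t=2g+n-1-q$. Then the scaled Hurwitz number $\mathsf{H}^g_{|\beta|,|\beta|-q}(\beta)/(t!\,|\beta|)$ is a polynomial in $\beta_1,\ldots,\beta_n$ whose lowest degree is at least $2g+n-2-\delta_{0,q}-q$ and whose highest degree is exactly $4g+n-3$.
   Context: For a partition $\beta=[1^{a_1},\ldots,d^{a_d}]\vdash d$ with $n$ parts (a tuple of positive integers is identified with the partition obtained by sorting it), $\mathrm{Aut}(\beta)=\prod_i a_i!$. For $g\ge 0$, $m>0$ with $t=2g-1+n+m-d\ge 0$, $\mathsf{H}^g_{d,m}(\beta)=\frac{\mathrm{Aut}(\beta)}{d!}N$, where $N$ is the number of tuples $(\sigma_0,\tau_1,\ldots,\tau_t,\sigma_{t+1})$ in $\mathfrak{S}_d$ with $\sigma_0$ a $d$-cycle, each $\tau_i$ a transposition, $\sigma_{t+1}$ of cycle type $\beta$, and $\sigma_0\tau_1\cdots\tau_t\sigma_{t+1}$ having exactly $m$ cycles. Here $d=|\beta|$ and $m=|\beta|-q$. $\delta_{0,q}$ is the Kronecker delta. The lowest (highest) degree of a polynomial is the minimal (maximal) total degree of a monomial with nonzero coefficient. -}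

module Defs where

open import Algebra.Definitions.RawSemiring using () renaming (_^_ to pow)
open import Data.Bool using (if_then_else_)
open import Data.Fin as Fin using (Fin; zero; suc; toℕ)
import Data.Fin.Properties as Fin
open import Data.Fin.Permutation
  using (Permutation′; _⟨$⟩ʳ_; _∘ₚ_; transpose; insert; remove; insert-remove; insert-punchIn)
  renaming (_≈_ to _≈ₚ_; id to idₚ)
import Data.Integer as ℤ
open import Data.List as List using (List; []; _∷_; [_])
import Data.List.Properties as List
open import Data.List.Membership.Propositional.Properties using (∈-allFin)
open import Data.List.Relation.Unary.All as All using (All)
import Data.List.Relation.Unary.All.Properties as All
open import Data.List.Relation.Unary.AllPairs as AllPairs using (AllPairs; []; _∷_)
import Data.List.Relation.Unary.AllPairs.Properties as AllPairs
open import Data.List.Relation.Unary.Any using (Any; here)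
import Data.List.Relation.Unary.Any.Properties as Any
import Data.List.Relation.Unary.Unique.Propositional.Properties as Unique
open import Data.List.Relation.Unary.Unique.Propositional using (Unique)
open import Data.Nat as ℕ using (ℕ; zero; suc; _!; _≤_)
open import Data.Nat.GeneralisedArithmetic using (iterate)
import Data.Nat.ListAction as ℕ
import Data.Nat.Properties as ℕ
open import Data.List.Sort.InsertionSort.Base ℕ.≤-decTotalOrder using (sort)
open import Data.Product using (_×_; _,_; ∃; ∃₂; proj₁; proj₂)
open import Data.Rational as ℚ using (ℚ; 0ℚ; 1ℚ; _/_)
open import Data.Vec as Vec using (Vec; []; _∷_)
import Data.Vec.Properties as Vec
import Data.Vec.Relation.Unary.All as VecAll
open import Function using (_∘_)
open import Relation.Binary.PropositionalEquality
  using (_≡_; _≢_; refl; sym; trans; cong)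
open import Relation.Nullary using (¬_; Dec; does)
open import Relation.Nullary.Decidable using (_×-dec_; _→-dec_; ¬?)
open import Relation.Unary using (Decidable)

private
  variable
    A : Set
    d n t : ℕ

allPermutations : ∀ d → List (Permutation′ d)
allPermutations zero    = [ idₚ ]
allPermutations (suc d) =
  List.cartesianProductWith (insert zero) (List.allFin (suc d)) (allPermutations d)

-- Permutation′ d has no useful propositional equality; up to pointwise
-- equality, allPermutations lists every permutation exactly once.

allPermutations-complete : (π : Permutation′ d) → Any (π ≈ₚ_) (allPermutations d)
allPermutations-complete {zero}  π = here λ ()
allPermutations-complete {suc d} π =
  Any.cartesianProductWith⁺ (insert zero)
    (λ { refl eq → insert-cong eq })
    (∈-allFin (π ⟨$⟩ʳ zero))
    (allPermutations-complete (remove zero π))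
  where
  insert-cong : ∀ {ρ} → remove zero π ≈ₚ ρ → π ≈ₚ insert zero (π ⟨$⟩ʳ zero) ρ
  insert-cong eq zero    = refl
  insert-cong {ρ} eq (suc i) =
    trans (sym (insert-remove zero π (suc i)))
    (trans (insert-punchIn zero (π ⟨$⟩ʳ zero) (remove zero π) i)
    (trans (cong (Fin.punchIn (π ⟨$⟩ʳ zero)) (eq i))
    (sym (insert-punchIn zero (π ⟨$⟩ʳ zero) ρ i))))

allPermutations-distinct : ∀ d → AllPairs (λ π ρ → ¬ π ≈ₚ ρ) (allPermutations d)
allPermutations-distinct zero    = All.[] ∷ []
allPermutations-distinct (suc d) =
  go (List.allFin (suc d)) (Unique.allFin⁺ (suc d))
  where
  sameHead : ∀ j {π ρ : Permutation′ d} →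
             ¬ π ≈ₚ ρ → ¬ insert zero j π ≈ₚ insert zero j ρ
  sameHead j {π} {ρ} π≉ρ eq = π≉ρ λ i → Fin.punchIn-injective j _ _
    (trans (sym (insert-punchIn zero j π i))
    (trans (eq (suc i)) (insert-punchIn zero j ρ i)))

  otherHeads : ∀ j (π : Permutation′ d) js → All (j ≢_) js →
    All (λ ρ → ¬ insert zero j π ≈ₚ ρ)
        (List.cartesianProductWith (insert zero) js (allPermutations d))
  otherHeads j π []       All.[]           = All.[]
  otherHeads j π (k ∷ js) (j≢k All.∷ j∉js) =
    All.++⁺ (All.map⁺ (All.universal (λ ρ eq → j≢k (eq zero)) _))
            (otherHeads j π js j∉js)

  go : ∀ js → Unique js → AllPairs (λ π ρ → ¬ π ≈ₚ ρ)
         (List.cartesianProductWith (insert zero) js (allPermutations d))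
  go []       []           = []
  go (j ∷ js) (j∉js ∷ js!) = AllPairs.++⁺
    (AllPairs.map⁺ (AllPairs.map (sameHead j) (allPermutations-distinct d)))
    (go js js!)
    (All.map⁺ (All.universal (λ π → otherHeads j π js j∉js) _))

allVecs : List A → ∀ t → List (Vec A t)
allVecs xs zero    = [ [] ]
allVecs xs (suc t) = List.cartesianProductWith _∷_ xs (allVecs xs t)

-- A partition is represented by the weakly increasing list of its parts.

partition : Vec ℕ n → List ℕ
partition = sort ∘ Vec.toList

-- A cycle of a permutation of Fin d has at most d elements, so exponents
-- below d suffice.

SameCycle : Permutation′ d → Fin d → Fin d → Set
SameCycle {d} π i j = ∃ λ (k : Fin d) → iterate (π ⟨$⟩ʳ_) i (toℕ k) ≡ j

sameCycle? : (π : Permutation′ d) (i j : Fin d) → Dec (SameCycle π i j)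
sameCycle? π i j = Fin.any? λ k → iterate (π ⟨$⟩ʳ_) i (toℕ k) Fin.≟ j

cycleLength : Permutation′ d → Fin d → ℕ
cycleLength {d} π i = List.length (List.filter (sameCycle? π i) (List.allFin d))

IsCycleMinimum : Permutation′ d → Fin d → Set
IsCycleMinimum π i = ∀ j → SameCycle π i j → i Fin.≤ j

isCycleMinimum? : (π : Permutation′ d) → Decidable (IsCycleMinimum π)
isCycleMinimum? π i = Fin.all? λ j → sameCycle? π i j →-dec i Fin.≤? j

-- Each cycle, fixed points included, contributes its length once, through
-- its least element.

cycleType : Permutation′ d → List ℕ
cycleType {d} π =
  sort (List.map (cycleLength π) (List.filter (isCycleMinimum? π) (List.allFin d)))

numCycles : Permutation′ d → ℕ
numCycles = List.length ∘ cycleType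

IsTransposition : Permutation′ d → Set
IsTransposition τ = ∃₂ λ i j → i ≢ j × τ ≈ₚ transpose i j

isTransposition? : Decidable (IsTransposition {d})
isTransposition? τ = Fin.any? λ i → Fin.any? λ j →
  ¬? (i Fin.≟ j) ×-dec Fin.all? λ k → (τ ⟨$⟩ʳ k) Fin.≟ (transpose i j ⟨$⟩ʳ k)

Tuple : ℕ → ℕ → Set
Tuple d t = Permutation′ d × Vec (Permutation′ d) t × Permutation′ d

allTuples : ∀ d t → List (Tuple d t)
allTuples d t = List.cartesianProduct Sd (List.cartesianProduct (allVecs Sd t) Sd)
  where Sd = allPermutations d

-- _∘ₚ_ composes from left to right.

tupleProduct : Tuple d t → Permutation′ d
tupleProduct (σ₀ , τs , σ₁) = σ₀ ∘ₚ Vec.foldr′ _∘ₚ_ σ₁ τs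

IsHurwitzTuple : (m : ℕ) (β : Vec ℕ n) → Tuple d t → Set
IsHurwitzTuple {d = d} m β x@(σ₀ , τs , σ₁) =
  cycleType σ₀ ≡ [ d ] ×
  VecAll.All IsTransposition τs ×
  cycleType σ₁ ≡ partition β ×
  numCycles (tupleProduct x) ≡ m

isHurwitzTuple? : (m : ℕ) (β : Vec ℕ n) → Decidable (IsHurwitzTuple {d = d} {t = t} m β)
isHurwitzTuple? {d = d} m β x@(σ₀ , τs , σ₁) =
  List.≡-dec ℕ._≟_ (cycleType σ₀) [ d ] ×-dec
  VecAll.all? isTransposition? τs ×-dec
  List.≡-dec ℕ._≟_ (cycleType σ₁) (partition β) ×-dec
  numCycles (tupleProduct x) ℕ.≟ m

numHurwitzTuples : (t m : ℕ) → Vec ℕ n → ℕ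
numHurwitzTuples t m β =
  List.length (List.filter (isHurwitzTuple? m β) (allTuples (Vec.sum β) t))

-- For β = [1^a₁, …, d^a_d] this is a₁! ⋯ a_d!.

aut : Vec ℕ n → ℕ
aut β = ℕ.product (List.map (λ i → Vec.count (ℕ._≟ suc i) β !) (List.upTo (Vec.sum β)))

-- Meaningful for positive parts, m > 0 and 2g - 1 + n + m - d ≥ 0, where
-- d = |β|; then the truncated subtraction below is exact.

hurwitz : (g m : ℕ) → Vec ℕ n → ℚ
hurwitz {n} g m β =
  let d = Vec.sum β
      t = (2 ℕ.* g ℕ.+ n ℕ.+ m) ℕ.∸ (1 ℕ.+ d)
  in  _/_ (ℤ.+ aut β) (d !) {{d ℕ.!≢0}} ℚ.* (ℤ.+ numHurwitzTuples t m β / 1)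

-- A formal sum of terms c · x^e, in which an exponent vector may be repeated
-- and coefficients may vanish; hence the degrees below refer to coeff.

Polynomial : ℕ → Set
Polynomial n = List (ℚ × Vec ℕ n)

sumℚ : List ℚ → ℚ
sumℚ = List.foldr ℚ._+_ 0ℚ

coeff : Polynomial n → Vec ℕ n → ℚ
coeff P e = sumℚ (List.map proj₁ (List.filter (λ term → Vec.≡-dec ℕ._≟_ (proj₂ term) e) P))

monomial : Vec ℕ n → Vec ℚ n → ℚ
monomial e x = Vec.foldr′ ℚ._*_ 1ℚ (Vec.zipWith (pow ℚ.+-*-rawSemiring) x e)

eval : Polynomial n → Vec ℚ n → ℚ
eval P x = sumℚ (List.map (λ (c , e) → c ℚ.* monomial e x) P)

IsLowestDegree : Polynomial n → ℕ → Set
IsLowestDegree P k =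
  (∃ λ e → coeff P e ≢ 0ℚ × Vec.sum e ≡ k) ×
  (∀ e → coeff P e ≢ 0ℚ → k ≤ Vec.sum e)

IsHighestDegree : Polynomial n → ℕ → Set
IsHighestDegree P k =
  (∃ λ e → coeff P e ≢ 0ℚ × Vec.sum e ≡ k) ×
  (∀ e → coeff P e ≢ 0ℚ → Vec.sum e ≤ k)

fromℕ : ℕ → ℚ
fromℕ k = ℤ.+ k / 1

δ : ℕ → ℕ → ℕ
δ i j = if does (i ℕ.≟ j) then 1 else 0

-- 1 / (t! · d), for positive d.

1/[_!*_] : (t d : ℕ) → .{{ℕ.NonZero d}} → ℚ
1/[ t !* d ] = _/_ (ℤ.+ 1) (t ! ℕ.* d) {{ℕ.m*n≢0 (t !) d {{t ℕ.!≢0}}}}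

{-# OPTIONS --safe #-}

-- Only the hook characters of the symmetric group survive on a full cycle, so
-- the count is a sum over hooks.  Here this is obtained without characters.
-- For a cycle type β let D β h be the iterated central difference of h with
-- steps β₁, …, βₙ at 0.
--
-- Let Q(σ) be the number of full cycles c for which c σ has a given number of
-- cycles.  Deleting the point 0 from c and σ gives a recursion for Q that is
-- solved by D β of an elementary symmetric polynomial of the d + 1 numbers
-- y - d, y - d + 2, …, y + d.  Cut-and-join shows that multiplication by the sum
-- of all transpositions acts on D β h by multiplying the unit differences of h
-- by d y / 2.  With the class size d! / (Aut β ∏ βᵢ), the scaled Hurwitz number
-- is d^(t-2) D β h / ∏ βᵢ up to a constant, where h is an antidifference in y of
-- y^t e_q(y - d + 1, y - d + 3, …, y + d - 1).
--
-- This e_q is a polynomial in d and y, divisible by d if q > 0, with leading part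
-- d^q y^q / q!.  Finally D β (y ↦ y^M) is ∏ βᵢ times a homogeneous polynomial
-- with nonnegative coefficients, which gives both degree statements.

module Submission where

open import Data.Bool using (if_then_else_; true; false)
open import Data.Empty using (⊥; ⊥-elim)
open import Data.Fin as Fin using (Fin; zero; suc; toℕ; fromℕ<)
open import Data.Fin.Permutation using (Permutation′; _⟨$⟩ʳ_; _⟨$⟩ˡ_; _∘ₚ_; transpose; lift₀; remove; inverseʳ; inverseˡ; lift₀-remove) renaming (_≈_ to _≈ₚ_)
import Data.Fin.Properties as Fin
import Data.Integer as ℤ
import Data.Integer.Properties as ℤ
open import Data.List as List using (List; []; _∷_; [_]; _++_; allFin; applyUpTo; cartesianProduct; cartesianProductWith; concat; filter; length; tabulate)
open import Data.List.Membership.Propositional using (_∈_; _∉_; find)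
open import Data.List.Membership.Propositional.Properties using (∈-++⁺ʳ; ∈-++⁺ˡ; ∈-allFin; ∈-concat⁺′; ∈-concat⁻′; ∈-map⁺; ∈-map⁻; ∈-∃++)
import Data.List.Properties as List
open import Data.List.Relation.Binary.Permutation.Propositional as Perm using (_↭_; ↭-refl; ↭-reflexive; ↭-sym; ↭-trans; ↭⇒↭ₛ)
open import Data.List.Relation.Binary.Permutation.Propositional.Properties using (++-comm; ++⁺; All-resp-↭; drop-∷; filter-↭; map⁺; shift; shifts; ↭-length; ∈-resp-↭)
import Data.List.Relation.Binary.Permutation.Setoid.Properties as PermSetoid
open import Data.List.Relation.Binary.Pointwise using (Pointwise-≡⇒≡)
open import Data.List.Relation.Unary.All as All using ([]; _∷_)
import Data.List.Relation.Unary.All.Properties as All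
open import Data.List.Relation.Unary.AllPairs using (AllPairs; []; _∷_)
open import Data.List.Relation.Unary.Any as Any using (Any; here; there)
open import Data.List.Relation.Unary.Unique.Propositional using (Unique)
import Data.List.Relation.Unary.Unique.Propositional.Properties as Unique
open import Data.Maybe using (Maybe; just; nothing)
open import Data.Nat as ℕ using (ℕ; zero; suc; _∸_; _≤_; _<_; _!)
open import Data.Nat.GeneralisedArithmetic using (iterate)
open import Data.Nat.ListAction using (product)
open import Data.Nat.ListAction.Properties using (sum-↭; product-↭)
import Data.Nat.Properties as ℕ
import Data.Nat.Tactic.RingSolver as ℕ-Solver
open import Data.Product using (_×_; _,_; ∃; ∃₂; proj₁; proj₂; map₁; map₂)
open import Data.Rational as ℚ using (ℚ; 0ℚ; 1ℚ; _/_; toℚᵘ)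
open import Data.Rational.Unnormalised as ℚᵘ using (mkℚᵘ; *≡*; _≃_)
import Data.Rational.Unnormalised.Properties as ℚᵘ
open import Data.Sum using (_⊎_; inj₁; inj₂)
open import Data.Vec as Vec using (Vec; []; _∷_; lookup; toList; updateAt)
import Data.Vec.Properties as Vec
import Data.Vec.Relation.Unary.All as VecAll
open import Defs
open import Function using (_∘_; id; it)
open import Level using (0ℓ)
open import Relation.Binary.PropositionalEquality hiding ([_])
open import Relation.Nullary using (¬_; Dec; yes; no; does; contradiction)
open import Relation.Nullary.Decidable using (_×-dec_; ¬?; dec-true; dec-false)
open import Relation.Unary using (Pred; Decidable)
open import Tactic.RingSolver using (solve-∀)
open import Tactic.RingSolver.Core.AlmostCommutativeRing using (AlmostCommutativeRing; fromCommutativeRing)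
open import Algebra.Definitions.RawSemiring ℚ.+-*-rawSemiring using (_^_)
open import Data.List.Sort.InsertionSort.Base ℕ.≤-decTotalOrder using (sort; insert)
open import Data.List.Sort.InsertionSort.Properties ℕ.≤-decTotalOrder using (sort-↭; insert-swap)

-- Hooks enter as follows. Put `y = d - 1 - 2k`. Dividing the product of the differences with steps
-- βᵢ by one unit difference writes D β h as a combination of the values `h (y + 1) - h (y - 1)`, 0
-- ≤ k < d, and up to the sign (-1)^k the coefficient is the character of the hook of leg length k
-- at β. The content sum of this hook is d y / 2, the eigenvalue of the sum of all transpositions.
-- The numbers y - d + 1, y - d + 3, ..., y + d - 1 are its contents doubled, so their elementary
-- symmetric polynomials count cycles, and the doubling is the source of the powers of 2. In the
-- proof these facts appear as identities for an arbitrary function h. The recursion works with d +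
-- 1 numbers because its polynomial has to be an antidifference: its unit difference is 2 (d + 1)
-- times the symmetric polynomial, one degree lower, of the d doubled contents. As D β h depends on
-- unit differences only, this antidifference can later be exchanged for one whose leading term is
-- explicit. No coefficient of the final polynomial is computed; its leading part has positive
-- coefficients, which cannot cancel.

-- Finite sums of rationals and indicator functions.

module Sums where

  open import Data.List using (map)
  open import Data.Rational using (_+_; _*_)
  open import Data.Rational.Properties

  ℚ-ring : AlmostCommutativeRing 0ℓ 0ℓ
  ℚ-ring = fromCommutativeRing +-*-commutativeRing 0≟
    where
    0≟ : ∀ x → Maybe (0ℚ ≡ x)
    0≟ x with 0ℚ ≟ x
    ... | yes p = just p
    ... | no  _ = nothing

  2ℚ : ℚ
  2ℚ = 1ℚ + 1ℚ

  toℚᵘ-/ : ∀ a n → toℚᵘ (a / suc n) ≃ mkℚᵘ a n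
  toℚᵘ-/ a n = toℚᵘ-fromℚᵘ (mkℚᵘ a n)

  fromℕ-+ : ∀ m n → fromℕ (m ℕ.+ n) ≡ fromℕ m + fromℕ n
  fromℕ-+ m n = toℚᵘ-injective (begin
    toℚᵘ (fromℕ (m ℕ.+ n))                ≈⟨ toℚᵘ-/ _ 0 ⟩
    mkℚᵘ (ℤ.+ (m ℕ.+ n)) 0                ≈⟨ *≡* (cong (λ k → k ℤ.* ℤ.1ℤ) (cong₂ ℤ._+_ (sym (ℤ.*-identityʳ (ℤ.+ m))) (sym (ℤ.*-identityʳ (ℤ.+ n))))) ⟩
    mkℚᵘ (ℤ.+ m) 0 ℚᵘ.+ mkℚᵘ (ℤ.+ n) 0    ≈⟨ ℚᵘ.+-cong (toℚᵘ-/ (ℤ.+ m) 0) (toℚᵘ-/ (ℤ.+ n) 0) ⟨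
    toℚᵘ (fromℕ m) ℚᵘ.+ toℚᵘ (fromℕ n)    ≈⟨ toℚᵘ-homo-+ (fromℕ m) (fromℕ n) ⟨
    toℚᵘ (fromℕ m + fromℕ n)              ∎)
    where open ℚᵘ.≃-Reasoning

  fromℕ-* : ∀ m n → fromℕ (m ℕ.* n) ≡ fromℕ m * fromℕ n
  fromℕ-* m n = toℚᵘ-injective (begin
    toℚᵘ (fromℕ (m ℕ.* n))                ≈⟨ toℚᵘ-/ _ 0 ⟩
    mkℚᵘ (ℤ.+ (m ℕ.* n)) 0                ≈⟨ *≡* (cong (λ k → k ℤ.* ℤ.1ℤ) (ℤ.pos-* m n)) ⟩
    mkℚᵘ (ℤ.+ m) 0 ℚᵘ.* mkℚᵘ (ℤ.+ n) 0    ≈⟨ ℚᵘ.*-cong (toℚᵘ-/ (ℤ.+ m) 0) (toℚᵘ-/ (ℤ.+ n) 0) ⟨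
    toℚᵘ (fromℕ m) ℚᵘ.* toℚᵘ (fromℕ n)    ≈⟨ toℚᵘ-homo-* (fromℕ m) (fromℕ n) ⟨
    toℚᵘ (fromℕ m * fromℕ n)              ∎)
    where open ℚᵘ.≃-Reasoning

  fromℕ-suc : ∀ n → fromℕ (suc n) ≡ 1ℚ + fromℕ n
  fromℕ-suc n = fromℕ-+ 1 n

  /-*-fromℕ : ∀ a n .{{_ : ℕ.NonZero n}} → (ℤ.+ a / n) * fromℕ n ≡ fromℕ a
  /-*-fromℕ a n@(suc k) = toℚᵘ-injective (begin
    toℚᵘ ((ℤ.+ a / n) * fromℕ n)           ≈⟨ toℚᵘ-homo-* (ℤ.+ a / n) (fromℕ n) ⟩
    toℚᵘ (ℤ.+ a / n) ℚᵘ.* toℚᵘ (fromℕ n)   ≈⟨ ℚᵘ.*-cong (toℚᵘ-/ (ℤ.+ a) k) (toℚᵘ-/ (ℤ.+ n) 0) ⟩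
    mkℚᵘ (ℤ.+ a) k ℚᵘ.* mkℚᵘ (ℤ.+ n) 0     ≈⟨ *≡* (trans (ℤ.*-identityʳ (ℤ.+ a ℤ.* ℤ.+ n)) (cong (λ m → ℤ.+ a ℤ.* ℤ.+ m) (sym (ℕ.*-identityʳ n)))) ⟩
    mkℚᵘ (ℤ.+ a) 0                         ≈⟨ toℚᵘ-/ _ 0 ⟨
    toℚᵘ (fromℕ a)                         ∎)
    where open ℚᵘ.≃-Reasoning

  cancel-fromℕ : ∀ n .{{_ : ℕ.NonZero n}} {x y} → fromℕ n * x ≡ fromℕ n * y → x ≡ y
  cancel-fromℕ n {x} {y} eq = begin
    x                              ≡⟨ unit x ⟨
    (ℤ.+ 1 / n) * (fromℕ n * x)    ≡⟨ cong ((ℤ.+ 1 / n) *_) eq ⟩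
    (ℤ.+ 1 / n) * (fromℕ n * y)    ≡⟨ unit y ⟩
    y                              ∎
    where
    open ≡-Reasoning
    unit : ∀ z → (ℤ.+ 1 / n) * (fromℕ n * z) ≡ z
    unit z = trans (sym (*-assoc (ℤ.+ 1 / n) (fromℕ n) z))
                   (trans (cong (_* z) (/-*-fromℕ 1 n)) (*-identityˡ z))

  private
    variable
      A B C : Set
      xs ys : List A
      f g : A → ℚ

  ∑ : List A → (A → ℚ) → ℚ
  ∑ []       f = 0ℚ
  ∑ (x ∷ xs) f = f x + ∑ xs f

  ∑-cong∈ : ∀ xs → (∀ {x : A} → x ∈ xs → f x ≡ g x) → ∑ xs f ≡ ∑ xs g
  ∑-cong∈ []       eq = refl
  ∑-cong∈ (x ∷ xs) eq = cong₂ _+_ (eq (here refl)) (∑-cong∈ xs (eq ∘ there))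

  ∑-cong : ∀ (xs : List A) → (∀ x → f x ≡ g x) → ∑ xs f ≡ ∑ xs g
  ∑-cong xs eq = ∑-cong∈ xs (λ {x} _ → eq x)

  ∑-++ : ∀ xs ys (f : A → ℚ) → ∑ (xs ++ ys) f ≡ ∑ xs f + ∑ ys f
  ∑-++ []       ys f = sym (+-identityˡ _)
  ∑-++ (x ∷ xs) ys f = trans (cong (f x +_) (∑-++ xs ys f)) (sym (+-assoc (f x) _ _))

  ∑-map : ∀ (h : A → B) xs (f : B → ℚ) → ∑ (map h xs) f ≡ ∑ xs (f ∘ h)
  ∑-map h []       f = refl
  ∑-map h (x ∷ xs) f = cong (f (h x) +_) (∑-map h xs f)

  ∑-concat : ∀ xss (f : A → ℚ) → ∑ (concat xss) f ≡ ∑ xss (λ xs → ∑ xs f)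
  ∑-concat []         f = refl
  ∑-concat (xs ∷ xss) f = trans (∑-++ xs (concat xss) f) (cong (∑ xs f +_) (∑-concat xss f))

  ∑-0 : ∀ (xs : List A) → ∑ xs (λ _ → 0ℚ) ≡ 0ℚ
  ∑-0 []       = refl
  ∑-0 (x ∷ xs) = trans (+-identityˡ _) (∑-0 xs)

  ∑-const : ∀ (xs : List A) c → ∑ xs (λ _ → c) ≡ fromℕ (length xs) * c
  ∑-const []       c = sym (*-zeroˡ c)
  ∑-const (x ∷ xs) c = trans (cong (c +_) (∑-const xs c))
    (trans (distrib c (fromℕ (length xs))) (cong (_* c) (sym (fromℕ-suc (length xs)))))
    where
    distrib : ∀ c n → c + n * c ≡ (1ℚ + n) * c
    distrib = solve-∀ ℚ-ring

  ∑-+ : ∀ xs (f g : A → ℚ) → ∑ xs (λ x → f x + g x) ≡ ∑ xs f + ∑ xs g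
  ∑-+ []       f g = refl
  ∑-+ (x ∷ xs) f g = trans (cong (f x + g x +_) (∑-+ xs f g)) (interchange (f x) (g x) _ _)
    where
    interchange : ∀ a b c d → a + b + (c + d) ≡ a + c + (b + d)
    interchange = solve-∀ ℚ-ring

  *-∑ : ∀ c xs (f : A → ℚ) → c * ∑ xs f ≡ ∑ xs (λ x → c * f x)
  *-∑ c []       f = *-zeroʳ c
  *-∑ c (x ∷ xs) f = trans (*-distribˡ-+ c (f x) _) (cong (c * f x +_) (*-∑ c xs f))

  ∑-* : ∀ xs (f : A → ℚ) c → ∑ xs f * c ≡ ∑ xs (λ x → f x * c)
  ∑-* xs f c = trans (*-comm _ c) (trans (*-∑ c xs f) (∑-cong xs (λ x → *-comm c (f x))))

  ∑-swap : ∀ (xs : List A) (ys : List B) (f : A → B → ℚ) →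
           ∑ xs (λ x → ∑ ys (f x)) ≡ ∑ ys (λ y → ∑ xs (λ x → f x y))
  ∑-swap []       ys f = sym (∑-0 ys)
  ∑-swap (x ∷ xs) ys f = trans (cong (∑ ys (f x) +_) (∑-swap xs ys f)) (sym (∑-+ ys (f x) _))

  ∑-cartesianProductWith : ∀ (h : A → B → C) xs ys (f : C → ℚ) →
    ∑ (cartesianProductWith h xs ys) f ≡ ∑ xs (λ x → ∑ ys (λ y → f (h x y)))
  ∑-cartesianProductWith h []       ys f = refl
  ∑-cartesianProductWith h (x ∷ xs) ys f =
    trans (∑-++ (map (h x) ys) _ f)
          (cong₂ _+_ (∑-map (h x) ys f) (∑-cartesianProductWith h xs ys f))

  ∑-↭ : xs ↭ ys → (f : A → ℚ) → ∑ xs f ≡ ∑ ys f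
  ∑-↭ Perm.refl                       f = refl
  ∑-↭ (Perm.prep x p)                 f = cong (f x +_) (∑-↭ p f)
  ∑-↭ (Perm.swap {xs} {ys} x y p)     f =
    trans (cong (λ s → f x + (f y + s)) (∑-↭ p f)) (swap (f x) (f y) (∑ ys f))
    where
    swap : ∀ a b c → a + (b + c) ≡ b + (a + c)
    swap = solve-∀ ℚ-ring
  ∑-↭ (Perm.trans p q)                f = trans (∑-↭ p f) (∑-↭ q f)

  ind : ∀ {P : Set} → Dec P → ℚ
  ind P? = if does P? then 1ℚ else 0ℚ

  private
    variable
      P Q : Set

  ind-yes : (P? : Dec P) → P → ind P? ≡ 1ℚ
  ind-yes (yes _) p = refl
  ind-yes (no ¬p) p = contradiction p ¬p

  ind-no : (P? : Dec P) → ¬ P → ind P? ≡ 0ℚ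
  ind-no (yes p) ¬p = contradiction p ¬p
  ind-no (no _)  ¬p = refl

  ind-cong : (P? : Dec P) (Q? : Dec Q) → (P → Q) → (Q → P) → ind P? ≡ ind Q?
  ind-cong (yes p) Q? to from = sym (ind-yes Q? (to p))
  ind-cong (no ¬p) Q? to from = sym (ind-no Q? (¬p ∘ from))

  ind-× : (P? : Dec P) (Q? : Dec Q) → ind (P? ×-dec Q?) ≡ ind P? * ind Q?
  ind-× P? Q? with does P? | does Q?
  ... | true  | true  = refl
  ... | true  | false = refl
  ... | false | true  = refl
  ... | false | false = refl

  -- Lets a summand be rewritten under the condition that its indicator tests.
  ind-guard : (P? : Dec P) {x y : ℚ} → (P → x ≡ y) → ind P? * x ≡ ind P? * y
  ind-guard (yes p) eq = cong (1ℚ *_) (eq p)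
  ind-guard (no _) {x} {y} eq = trans (*-zeroˡ x) (sym (*-zeroˡ y))

  ∑-filter : ∀ {P : Pred A 0ℓ} (P? : Decidable P) xs (f : A → ℚ) →
             ∑ (filter P? xs) f ≡ ∑ xs (λ x → ind (P? x) * f x)
  ∑-filter P? []       f = refl
  ∑-filter P? (x ∷ xs) f with does (P? x)
  ... | true  = cong₂ _+_ (sym (*-identityˡ (f x))) (∑-filter P? xs f)
  ... | false = trans (∑-filter P? xs f)
    (sym (trans (cong (_+ ∑ xs _) (*-zeroˡ (f x))) (+-identityˡ _)))

  length-filter-∑ : ∀ {P : Pred A 0ℓ} (P? : Decidable P) xs →
                    fromℕ (length (filter P? xs)) ≡ ∑ xs (ind ∘ P?)
  length-filter-∑ P? xs = begin
    fromℕ (length (filter P? xs))           ≡⟨ *-identityʳ _ ⟨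
    fromℕ (length (filter P? xs)) * 1ℚ      ≡⟨ ∑-const (filter P? xs) 1ℚ ⟨
    ∑ (filter P? xs) (λ _ → 1ℚ)             ≡⟨ ∑-filter P? xs _ ⟩
    ∑ xs (λ x → ind (P? x) * 1ℚ)            ≡⟨ ∑-cong xs (λ x → *-identityʳ _) ⟩
    ∑ xs (ind ∘ P?)                         ∎
    where open ≡-Reasoning

  -- The selected entry is described by an indicator of total 1 and `f` need only be constant on
  -- `P`, since permutations can be singled out only up to pointwise equality.
  ∑-pick : ∀ {P : Pred A 0ℓ} (P? : Decidable P) xs → ∑ xs (ind ∘ P?) ≡ 1ℚ →
           ∀ {c} → (∀ {x} → P x → f x ≡ c) → ∑ xs (λ x → ind (P? x) * f x) ≡ c
  ∑-pick {f = f} P? xs one {c} eq = begin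
    ∑ xs (λ x → ind (P? x) * f x)   ≡⟨ ∑-cong xs (λ x → ind-guard (P? x) eq) ⟩
    ∑ xs (λ x → ind (P? x) * c)     ≡⟨ ∑-* xs _ c ⟨
    ∑ xs (ind ∘ P?) * c             ≡⟨ cong (_* c) one ⟩
    1ℚ * c                          ≡⟨ *-identityˡ c ⟩
    c                               ∎
    where open ≡-Reasoning

  ∑-tabulate : ∀ {n} (h : Fin n → A) (f : A → ℚ) →
               ∑ (tabulate h) f ≡ ∑ (allFin n) (f ∘ h)
  ∑-tabulate {n = n} h f = trans (cong (λ l → ∑ l f) (sym (List.map-tabulate (λ i → i) h))) (∑-map h (allFin n) f)

  ∑-allFin-suc : ∀ {n} (f : Fin (suc n) → ℚ) →
                 ∑ (allFin (suc n)) f ≡ f zero + ∑ (allFin n) (f ∘ suc)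
  ∑-allFin-suc f = cong (f zero +_) (∑-tabulate suc f)

  ∑-allFin-≟ : ∀ {n} (i : Fin n) → ∑ (allFin n) (λ j → ind (i Fin.≟ j)) ≡ 1ℚ
  ∑-allFin-≟ {suc n} zero = trans (∑-allFin-suc {n} (λ j → ind (zero {n} Fin.≟ j)))
    (trans (cong (1ℚ +_) (∑-0 (allFin n))) (+-identityʳ 1ℚ))
  ∑-allFin-≟ {suc n} (suc i) = trans (∑-allFin-suc {n} (λ j → ind (suc i Fin.≟ j)))
    (trans (+-identityˡ _)
    (trans (∑-cong (allFin n) (λ j → ind-cong (suc i Fin.≟ suc j) (i Fin.≟ j) Fin.suc-injective (cong suc)))
    (∑-allFin-≟ i)))

-- Iterated central differences and their behaviour when parts are cut or joined.

module Differences where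

  open import Data.List using (map)
  open import Data.Nat.ListAction using (sum)
  open import Data.Rational using (_+_; _*_; _-_; -_)
  open import Data.Rational.Properties
  open Sums

  open ≡-Reasoning

  private
    variable
      A : Set
      h h′ : ℚ → ℚ
      x : A
      R xs : List A

  -- Each occurrence is picked on its own, so equal entries, like different cycles of equal length,
  -- are counted separately.
  picks : List A → List (A × List A)
  picks []       = []
  picks (x ∷ xs) = (x , xs) ∷ map (map₂ (x ∷_)) (picks xs)

  ∑-picks-∷ : ∀ (x : A) xs (f : A × List A → ℚ) →
              ∑ (picks (x ∷ xs)) f ≡ f (x , xs) + ∑ (picks xs) (f ∘ map₂ (x ∷_))
  ∑-picks-∷ x xs f = cong (f (x , xs) +_) (∑-map (map₂ (x ∷_)) (picks xs) f)

  picks-↭ : (x , R) ∈ picks xs → x ∷ R ↭ xs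
  picks-↭ {xs = x ∷ xs} (here refl) = ↭-refl
  picks-↭ {xs = x ∷ xs} (there p) with ∈-map⁻ (map₂ (x ∷_)) p
  ... | (y , R) , q , refl = ↭-trans (Perm.swap y x ↭-refl) (Perm.prep x (picks-↭ q))

  ∑-picks-sum : ∀ L → ∑ (picks L) (fromℕ ∘ proj₁) ≡ fromℕ (sum L)
  ∑-picks-sum []      = refl
  ∑-picks-sum (b ∷ L) = trans (∑-picks-∷ b L (fromℕ ∘ proj₁))
    (trans (cong (fromℕ b +_) (∑-picks-sum L)) (sym (fromℕ-+ b (sum L))))

  ∇ : ℚ → (ℚ → ℚ) → ℚ → ℚ
  ∇ b h y = h (y + b) - h (y - b)

  Δ : ℕ → (ℚ → ℚ) → ℚ → ℚ
  Δ b = ∇ (fromℕ b)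

  D : List ℕ → (ℚ → ℚ) → ℚ
  D []      h = h 0ℚ
  D (b ∷ L) h = D L (Δ b h)

  D-cong : ∀ L → (∀ y → h y ≡ h′ y) → D L h ≡ D L h′
  D-cong []      eq = eq 0ℚ
  D-cong (b ∷ L) eq = D-cong L (λ y → cong₂ _-_ (eq (y + fromℕ b)) (eq (y - fromℕ b)))

  D-+ : ∀ L h k → D L (λ y → h y + k y) ≡ D L h + D L k
  D-+ []      h k = refl
  D-+ (b ∷ L) h k =
    trans (D-cong L (λ y → lemma (h (y + fromℕ b)) (h (y - fromℕ b)) (k (y + fromℕ b)) (k (y - fromℕ b))))
          (D-+ L (Δ b h) (Δ b k))
    where
    lemma : ∀ h₊ h₋ k₊ k₋ → h₊ + k₊ - (h₋ + k₋) ≡ h₊ - h₋ + (k₊ - k₋)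
    lemma = solve-∀ ℚ-ring

  D-* : ∀ L c h → D L (λ y → c * h y) ≡ c * D L h
  D-* []      c h = refl
  D-* (b ∷ L) c h =
    trans (D-cong L (λ y → lemma c (h (y + fromℕ b)) (h (y - fromℕ b)))) (D-* L c (Δ b h))
    where
    lemma : ∀ c h₊ h₋ → c * h₊ - c * h₋ ≡ c * (h₊ - h₋)
    lemma = solve-∀ ℚ-ring

  D-− : ∀ L h k → D L (λ y → h y - k y) ≡ D L h - D L k
  D-− L h k = begin
    D L (λ y → h y - k y)              ≡⟨ D-cong L (λ y → lemma (h y) (k y)) ⟩
    D L (λ y → h y + - 1ℚ * k y)       ≡⟨ D-+ L h _ ⟩
    D L h + D L (λ y → - 1ℚ * k y)     ≡⟨ cong (D L h +_) (D-* L (- 1ℚ) k) ⟩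
    D L h + - 1ℚ * D L k               ≡⟨ lemma (D L h) (D L k) ⟨
    D L h - D L k                      ∎
    where
    lemma : ∀ a b → a - b ≡ a + - 1ℚ * b
    lemma = solve-∀ ℚ-ring

  D-0 : ∀ L → D L (λ _ → 0ℚ) ≡ 0ℚ
  D-0 []      = refl
  D-0 (b ∷ L) = D-0 L

  Δ-cong : ∀ b → (∀ y → h y ≡ h′ y) → ∀ y → Δ b h y ≡ Δ b h′ y
  Δ-cong b eq y = cong₂ _-_ (eq (y + fromℕ b)) (eq (y - fromℕ b))

  private
    +-+ : ∀ y a b → y + a + b ≡ y + b + a
    +-+ = solve-∀ ℚ-ring
    +− : ∀ y a b → y + a - b ≡ y - b + a
    +− = solve-∀ ℚ-ring
    −− : ∀ y a b → y - a - b ≡ y - b - a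
    −− = solve-∀ ℚ-ring

  ∇-comm : ∀ a b h y → ∇ a (∇ b h) y ≡ ∇ b (∇ a h) y
  ∇-comm a b h y = trans
    (lemma (h (y + a + b)) (h (y + a - b)) (h (y - a + b)) (h (y - a - b)))
    (cong₂ _-_ (cong₂ _-_ (cong h (+-+ y a b)) (cong h (sym (+− y b a))))
               (cong₂ _-_ (cong h (+− y a b)) (cong h (−− y a b))))
    where
    lemma : ∀ p q r s → p - q - (r - s) ≡ p - r - (q - s)
    lemma = solve-∀ ℚ-ring

  Δ-comm : ∀ a b h y → Δ a (Δ b h) y ≡ Δ b (Δ a h) y
  Δ-comm a b = ∇-comm (fromℕ a) (fromℕ b)

  D-↭ : ∀ {L L′} → L ↭ L′ → ∀ h → D L h ≡ D L′ h
  D-↭ Perm.refl          h = refl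
  D-↭ (Perm.prep b p)    h = D-↭ p (Δ b h)
  D-↭ (Perm.swap {L} {L′} a b p) h = trans (D-↭ p _) (D-cong L′ (Δ-comm b a h))
  D-↭ (Perm.trans p q)   h = trans (D-↭ p h) (D-↭ q h)

  -- Expand `D L h` over sign vectors, the term of ε being the value of `h` at `y = Σ ε b` with sign
  -- `∏ ε`. Shifting by `+ b` keeps the terms with ε = + at `b`, and the sum of `2 b` over the
  -- positive entries is `sum L + y`. In `∑-picks-shift⁻` the negative entries give `sum L - y`,
  -- with an extra sign from `∏ ε`.
  ∑-picks-shift⁺ : ∀ L h →
    ∑ (picks L) (λ (b , R) → 2ℚ * fromℕ b * D R (λ y → h (y + fromℕ b)))
    ≡ D L (λ y → (fromℕ (sum L) + y) * h y)
  ∑-picks-shift⁺ []      h = sym (*-zeroˡ (h 0ℚ))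
  ∑-picks-shift⁺ (c ∷ L) h = begin
    ∑ (picks (c ∷ L)) (λ (b , R) → 2ℚ * fromℕ b * D R (λ y → h (y + fromℕ b)))
      ≡⟨ ∑-picks-∷ c L (λ (b , R) → 2ℚ * fromℕ b * D R (λ y → h (y + fromℕ b))) ⟩
    2ℚ * fromℕ c * D L (λ y → h (y + fromℕ c))
      + ∑ (picks L) (λ (b , R) → 2ℚ * fromℕ b * D R (Δ c (λ y → h (y + fromℕ b))))
      ≡⟨ cong₂ _+_ (sym (D-* L (2ℚ * fromℕ c) _)) (∑-cong (picks L) (λ (b , R) →
           cong (2ℚ * fromℕ b *_) (D-cong R (λ y → cong₂ _-_ (cong h (+-+ y (fromℕ c) (fromℕ b))) (cong h (sym (+− y (fromℕ b) (fromℕ c)))))))) ⟩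
    D L (λ y → 2ℚ * fromℕ c * h (y + fromℕ c))
      + ∑ (picks L) (λ (b , R) → 2ℚ * fromℕ b * D R (λ y → Δ c h (y + fromℕ b)))
      ≡⟨ cong (D L (λ y → 2ℚ * fromℕ c * h (y + fromℕ c)) +_) (∑-picks-shift⁺ L (Δ c h)) ⟩
    D L (λ y → 2ℚ * fromℕ c * h (y + fromℕ c)) + D L (λ y → (fromℕ (sum L) + y) * Δ c h y)
      ≡⟨ D-+ L _ _ ⟨
    D L (λ y → 2ℚ * fromℕ c * h (y + fromℕ c) + (fromℕ (sum L) + y) * Δ c h y)
      ≡⟨ D-cong L (λ y → lemma (fromℕ c) (fromℕ (sum L)) y (h (y + fromℕ c)) (h (y - fromℕ c))) ⟩
    D L (Δ c (λ y → (fromℕ c + fromℕ (sum L) + y) * h y))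
      ≡⟨ D-cong (c ∷ L) (λ y → cong (λ s → (s + y) * h y) (fromℕ-+ c (sum L))) ⟨
    D (c ∷ L) (λ y → (fromℕ (sum (c ∷ L)) + y) * h y) ∎
    where
    lemma : ∀ c s y h₊ h₋ → (1ℚ + 1ℚ) * c * h₊ + (s + y) * (h₊ - h₋)
                          ≡ (c + s + (y + c)) * h₊ - (c + s + (y - c)) * h₋
    lemma = solve-∀ ℚ-ring

  ∑-picks-shift⁻ : ∀ L h →
    ∑ (picks L) (λ (b , R) → 2ℚ * fromℕ b * D R (λ y → h (y - fromℕ b)))
    ≡ D L (λ y → (y - fromℕ (sum L)) * h y)
  ∑-picks-shift⁻ []      h = sym (*-zeroˡ (h 0ℚ))
  ∑-picks-shift⁻ (c ∷ L) h = begin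
    ∑ (picks (c ∷ L)) (λ (b , R) → 2ℚ * fromℕ b * D R (λ y → h (y - fromℕ b)))
      ≡⟨ ∑-picks-∷ c L (λ (b , R) → 2ℚ * fromℕ b * D R (λ y → h (y - fromℕ b))) ⟩
    2ℚ * fromℕ c * D L (λ y → h (y - fromℕ c))
      + ∑ (picks L) (λ (b , R) → 2ℚ * fromℕ b * D R (Δ c (λ y → h (y - fromℕ b))))
      ≡⟨ cong₂ _+_ (sym (D-* L (2ℚ * fromℕ c) _)) (∑-cong (picks L) (λ (b , R) →
           cong (2ℚ * fromℕ b *_) (D-cong R (λ y → cong₂ _-_ (cong h (+− y (fromℕ c) (fromℕ b))) (cong h (−− y (fromℕ c) (fromℕ b))))))) ⟩
    D L (λ y → 2ℚ * fromℕ c * h (y - fromℕ c))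
      + ∑ (picks L) (λ (b , R) → 2ℚ * fromℕ b * D R (λ y → Δ c h (y - fromℕ b)))
      ≡⟨ cong (D L (λ y → 2ℚ * fromℕ c * h (y - fromℕ c)) +_) (∑-picks-shift⁻ L (Δ c h)) ⟩
    D L (λ y → 2ℚ * fromℕ c * h (y - fromℕ c)) + D L (λ y → (y - fromℕ (sum L)) * Δ c h y)
      ≡⟨ D-+ L _ _ ⟨
    D L (λ y → 2ℚ * fromℕ c * h (y - fromℕ c) + (y - fromℕ (sum L)) * Δ c h y)
      ≡⟨ D-cong L (λ y → lemma (fromℕ c) (fromℕ (sum L)) y (h (y + fromℕ c)) (h (y - fromℕ c))) ⟩
    D L (Δ c (λ y → (y - (fromℕ c + fromℕ (sum L))) * h y))
      ≡⟨ D-cong (c ∷ L) (λ y → cong (λ s → (y - s) * h y) (fromℕ-+ c (sum L))) ⟨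
    D (c ∷ L) (λ y → (y - fromℕ (sum (c ∷ L))) * h y) ∎
    where
    lemma : ∀ c s y h₊ h₋ → (1ℚ + 1ℚ) * c * h₋ + (y - s) * (h₊ - h₋)
                          ≡ (y + c - (c + s)) * h₊ - (y - c - (c + s)) * h₋
    lemma = solve-∀ ℚ-ring

  -- A difference with step `b + c` is the shift by `+ c` of `h (_ + b)` minus the shift by `- c` of
  -- `h (_ - b)`; summed over `c`, these are the two shift identities.
  ∑-picks-join : ∀ b L h →
    ∑ (picks L) (λ (c , R) → 2ℚ * fromℕ c * D ((b ℕ.+ c) ∷ R) h)
    ≡ D L (λ y → (fromℕ (sum L) + y) * h (y + fromℕ b) + (fromℕ (sum L) - y) * h (y - fromℕ b))
  ∑-picks-join b L h = begin
    ∑ (picks L) (λ (c , R) → 2ℚ * fromℕ c * D ((b ℕ.+ c) ∷ R) h)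
      ≡⟨ ∑-cong (picks L) (λ (c , R) → trans (cong (2ℚ * fromℕ c *_) (split c R)) (distrib (2ℚ * fromℕ c) _ _)) ⟩
    ∑ (picks L) (λ (c , R) → 2ℚ * fromℕ c * D R (λ y → h₊ (y + fromℕ c)) + - 1ℚ * (2ℚ * fromℕ c * D R (λ y → h₋ (y - fromℕ c))))
      ≡⟨ ∑-+ (picks L) (λ (c , R) → 2ℚ * fromℕ c * D R (λ y → h₊ (y + fromℕ c))) (λ (c , R) → - 1ℚ * (2ℚ * fromℕ c * D R (λ y → h₋ (y - fromℕ c)))) ⟩
    ∑ (picks L) (λ (c , R) → 2ℚ * fromℕ c * D R (λ y → h₊ (y + fromℕ c)))
      + ∑ (picks L) (λ (c , R) → - 1ℚ * (2ℚ * fromℕ c * D R (λ y → h₋ (y - fromℕ c))))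
      ≡⟨ cong₂ _+_ (∑-picks-shift⁺ L h₊) (trans (sym (*-∑ (- 1ℚ) (picks L) _)) (cong (- 1ℚ *_) (∑-picks-shift⁻ L h₋))) ⟩
    D L (λ y → (fromℕ (sum L) + y) * h₊ y) + - 1ℚ * D L (λ y → (y - fromℕ (sum L)) * h₋ y)
      ≡⟨ cong (D L (λ y → (fromℕ (sum L) + y) * h₊ y) +_) (D-* L (- 1ℚ) (λ y → (y - fromℕ (sum L)) * h₋ y)) ⟨
    D L (λ y → (fromℕ (sum L) + y) * h₊ y) + D L (λ y → - 1ℚ * ((y - fromℕ (sum L)) * h₋ y))
      ≡⟨ D-+ L _ _ ⟨
    D L (λ y → (fromℕ (sum L) + y) * h₊ y + - 1ℚ * ((y - fromℕ (sum L)) * h₋ y))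
      ≡⟨ D-cong L (λ y → lemma (fromℕ (sum L)) y (h₊ y) (h₋ y)) ⟩
    D L (λ y → (fromℕ (sum L) + y) * h₊ y + (fromℕ (sum L) - y) * h₋ y) ∎
    where
    h₊ h₋ : ℚ → ℚ
    h₊ y = h (y + fromℕ b)
    h₋ y = h (y - fromℕ b)
    arg₊ : ∀ y b c → y + (b + c) ≡ y + c + b
    arg₊ = solve-∀ ℚ-ring
    arg₋ : ∀ y b c → y - (b + c) ≡ y - c - b
    arg₋ = solve-∀ ℚ-ring
    distrib : ∀ c a b → c * (a - b) ≡ c * a + - 1ℚ * (c * b)
    distrib = solve-∀ ℚ-ring
    lemma : ∀ s y u v → (s + y) * u + - 1ℚ * ((y - s) * v) ≡ (s + y) * u + (s - y) * v
    lemma = solve-∀ ℚ-ring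
    split : ∀ c R → D ((b ℕ.+ c) ∷ R) h ≡ D R (λ y → h₊ (y + fromℕ c)) - D R (λ y → h₋ (y - fromℕ c))
    split c R = trans
      (D-cong R (λ y → cong₂ _-_
        (cong h (trans (cong (y +_) (fromℕ-+ b c)) (arg₊ y (fromℕ b) (fromℕ c))))
        (cong h (trans (cong (λ k → y - k) (fromℕ-+ b c)) (arg₋ y (fromℕ b) (fromℕ c))))))
      (D-− R _ _)

  -- D L h is a sum over sign vectors ε; the term of a pair of entries is antisymmetric under exchanging their signs.

  ∑-picks-antisym : ∀ L h →
    ∑ (picks L) (λ (b , R) → 2ℚ * fromℕ b *
      D R (λ y → (fromℕ (sum R) - y) * h (y + fromℕ b) + (fromℕ (sum R) + y) * h (y - fromℕ b)))
    ≡ 0ℚ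
  ∑-picks-antisym []      h = refl
  ∑-picks-antisym (c ∷ L) h = begin
    ∑ (picks (c ∷ L)) (λ (b , R) → 2ℚ * fromℕ b * D R (ν b R h))
      ≡⟨ ∑-picks-∷ c L (λ (b , R) → 2ℚ * fromℕ b * D R (ν b R h)) ⟩
    2ℚ * fromℕ c * D L (ν c L h) + ∑ (picks L) (λ (b , R) → 2ℚ * fromℕ b * D R (Δ c (ν b (c ∷ R) h)))
      ≡⟨ cong (2ℚ * fromℕ c * D L (ν c L h) +_) (begin
        ∑ (picks L) (λ (b , R) → 2ℚ * fromℕ b * D R (Δ c (ν b (c ∷ R) h)))
          -- Applying `Δ c` to `ν b (c ∷ R) h` leaves `ν b R (Δ c h)`, where the induction applies,
          -- and two cross terms in which `b` and `c` carry opposite signs. Summed over `b`, the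
          -- cross terms are shift identities and cancel the term in which `c` itself is picked.
          ≡⟨ ∑-cong (picks L) (λ (b , R) → split b R) ⟩
        ∑ (picks L) (λ (b , R) → 2ℚ * fromℕ b * D R (ν b R (Δ c h)) + (2ℚ * fromℕ c * (2ℚ * fromℕ b * D R (λ y → h₊ (y - fromℕ b))) + - (2ℚ * fromℕ c) * (2ℚ * fromℕ b * D R (λ y → h₋ (y + fromℕ b)))))
          ≡⟨ trans (∑-+ (picks L) _ _) (cong₂ _+_ (∑-picks-antisym L (Δ c h)) (∑-+ (picks L) _ _)) ⟩
        0ℚ + (∑ (picks L) (λ (b , R) → 2ℚ * fromℕ c * (2ℚ * fromℕ b * D R (λ y → h₊ (y - fromℕ b)))) + ∑ (picks L) (λ (b , R) → - (2ℚ * fromℕ c) * (2ℚ * fromℕ b * D R (λ y → h₋ (y + fromℕ b)))))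
          ≡⟨ cong (0ℚ +_) (cong₂ _+_
               (trans (sym (*-∑ (2ℚ * fromℕ c) (picks L) _)) (cong (2ℚ * fromℕ c *_) (∑-picks-shift⁻ L h₊)))
               (trans (sym (*-∑ (- (2ℚ * fromℕ c)) (picks L) _)) (cong (- (2ℚ * fromℕ c) *_) (∑-picks-shift⁺ L h₋)))) ⟩
        0ℚ + (2ℚ * fromℕ c * D L f + - (2ℚ * fromℕ c) * D L g) ∎) ⟩
    2ℚ * fromℕ c * D L (ν c L h) + (0ℚ + (2ℚ * fromℕ c * D L f + - (2ℚ * fromℕ c) * D L g))
      ≡⟨ collect (2ℚ * fromℕ c) (D L (ν c L h)) (D L f) (D L g) ⟩
    2ℚ * fromℕ c * (D L (ν c L h) + D L f - D L g)
      ≡⟨ cong (2ℚ * fromℕ c *_) (trans (cong (_- D L g) (sym (D-+ L (ν c L h) f))) (sym (D-− L _ g))) ⟩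
    2ℚ * fromℕ c * D L (λ y → ν c L h y + f y - g y)
      ≡⟨ cong (2ℚ * fromℕ c *_) (trans (D-cong L (λ y → cancel (fromℕ (sum L)) y (h₊ y) (h₋ y))) (D-0 L)) ⟩
    2ℚ * fromℕ c * 0ℚ
      ≡⟨ *-zeroʳ (2ℚ * fromℕ c) ⟩
    0ℚ ∎
    where
    ν : ℕ → List ℕ → (ℚ → ℚ) → ℚ → ℚ
    ν b R h y = (fromℕ (sum R) - y) * h (y + fromℕ b) + (fromℕ (sum R) + y) * h (y - fromℕ b)
    h₊ h₋ f g : ℚ → ℚ
    h₊ y = h (y + fromℕ c)
    h₋ y = h (y - fromℕ c)
    f y = (y - fromℕ (sum L)) * h₊ y
    g y = (fromℕ (sum L) + y) * h₋ y
    collect : ∀ k a b c → k * a + (0ℚ + (k * b + - k * c)) ≡ k * (a + b - c)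
    collect = solve-∀ ℚ-ring
    cancel : ∀ s y u v → (s - y) * u + (s + y) * v + (y - s) * u - (s + y) * v ≡ 0ℚ
    cancel = solve-∀ ℚ-ring
    alg : ∀ c s y p q r t →
      (c + s - (y + c)) * p + (c + s + (y + c)) * q - ((c + s - (y - c)) * r + (c + s + (y - c)) * t)
      ≡ (s - y) * (p - r) + (s + y) * (q - t) + ((1ℚ + 1ℚ) * c * q + - ((1ℚ + 1ℚ) * c) * r)
    alg = solve-∀ ℚ-ring
    pointwiseℚ : ∀ c b s y → ∇ c (λ y → (c + s - y) * h (y + b) + (c + s + y) * h (y - b)) y
      ≡ (s - y) * ∇ c h (y + b) + (s + y) * ∇ c h (y - b)
        + (2ℚ * c * h (y - b + c) + - (2ℚ * c) * h (y + b - c))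
    pointwiseℚ c b s y = trans
      (alg c s y (h (y + c + b)) (h (y + c - b)) (h (y - c + b)) (h (y - c - b)))
      (cong₂ _+_ (cong₂ _+_ (cong ((s - y) *_) (cong₂ _-_ (cong h (+-+ y c b)) (cong h (sym (+− y b c)))))
                            (cong ((s + y) *_) (cong₂ _-_ (cong h (+− y c b)) (cong h (−− y c b)))))
                 (cong₂ _+_ (cong (λ z → 2ℚ * c * h z) (+− y c b))
                            (cong (λ z → - (2ℚ * c) * h z) (sym (+− y b c)))))
    pointwise : ∀ b R y → Δ c (ν b (c ∷ R) h) y
      ≡ ν b R (Δ c h) y + (2ℚ * fromℕ c * h₊ (y - fromℕ b) + - (2ℚ * fromℕ c) * h₋ (y + fromℕ b))
    pointwise b R y = trans
      (Δ-cong c (λ y → cong (λ s → (s - y) * h (y + fromℕ b) + (s + y) * h (y - fromℕ b)) (fromℕ-+ c (sum R))) y)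
      (pointwiseℚ (fromℕ c) (fromℕ b) (fromℕ (sum R)) y)
    distrib : ∀ b c u v w → b * (u + (c * v + - c * w)) ≡ b * u + (c * (b * v) + - c * (b * w))
    distrib = solve-∀ ℚ-ring
    split : ∀ b R → 2ℚ * fromℕ b * D R (Δ c (ν b (c ∷ R) h))
      ≡ 2ℚ * fromℕ b * D R (ν b R (Δ c h)) + (2ℚ * fromℕ c * (2ℚ * fromℕ b * D R (λ y → h₊ (y - fromℕ b))) + - (2ℚ * fromℕ c) * (2ℚ * fromℕ b * D R (λ y → h₋ (y + fromℕ b))))
    split b R = trans (cong (2ℚ * fromℕ b *_) (begin
      D R (Δ c (ν b (c ∷ R) h))
        ≡⟨ D-cong R (pointwise b R) ⟩
      D R (λ y → ν b R (Δ c h) y + (2ℚ * fromℕ c * h₊ (y - fromℕ b) + - (2ℚ * fromℕ c) * h₋ (y + fromℕ b)))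
        ≡⟨ trans (D-+ R _ _) (cong (D R (ν b R (Δ c h)) +_) (D-+ R _ _)) ⟩
      D R (ν b R (Δ c h)) + (D R (λ y → 2ℚ * fromℕ c * h₊ (y - fromℕ b)) + D R (λ y → - (2ℚ * fromℕ c) * h₋ (y + fromℕ b)))
        ≡⟨ cong (D R (ν b R (Δ c h)) +_) (cong₂ _+_ (D-* R (2ℚ * fromℕ c) _) (D-* R (- (2ℚ * fromℕ c)) _)) ⟩
      D R (ν b R (Δ c h)) + (2ℚ * fromℕ c * D R (λ y → h₊ (y - fromℕ b)) + - (2ℚ * fromℕ c) * D R (λ y → h₋ (y + fromℕ b))) ∎))
      (distrib (2ℚ * fromℕ b) (2ℚ * fromℕ c) _ _ _)

  -- Cutting a cycle: the parts range over (1 + p, q), (2 + p, q - 1), …, (p + q, 1).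

  cut : (ℕ → ℕ → ℚ) → ℕ → ℕ → ℚ
  cut f p zero    = 0ℚ
  cut f p (suc q) = f (suc p) (suc q) + cut f (suc p) q

  D-cut : ∀ L h p q → cut (λ a c → D (a ∷ c ∷ L) h) p q ≡ D L (λ y → cut (λ a c → Δ c (Δ a h) y) p q)
  D-cut L h p zero    = sym (D-0 L)
  D-cut L h p (suc q) = trans (cong (D (suc p ∷ suc q ∷ L) h +_) (D-cut L h (suc p) q))
    (sym (D-+ L (Δ (suc q) (Δ (suc p) h)) (λ y → cut (λ a c → Δ c (Δ a h) y) (suc p) q)))

  -- If e is an antidifference of k h, the inner terms of the cuts telescope.

  module _ (h e : ℚ → ℚ) (k : ℚ) (tele : ∀ z → e (z + 1ℚ) - e (z - 1ℚ) ≡ k * h z) where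

    private
      -- The closed form of `k` times a cut started at `p`. Each of the `q` cuts contributes the
      -- outer values `u` and `v`, which do not change because the total length is fixed. The inner
      -- arguments `y + c - a` and `y - c + a` move in steps of 2, so each family sums to one
      -- difference of `e`.
      shape : ℚ → ℚ → ℚ → ℚ → ℚ → ℚ
      shape p q y u v = k * q * (u + v) - (e (y + q - p) - e (y - q - p)) - (e (y + q + p) - e (y + p - q))

      shape-0 : ∀ p y u v → shape p 0ℚ y u v ≡ 0ℚ
      shape-0 p y u v = trans
        (cong₂ (λ s t → k * 0ℚ * (u + v) - (s - e (y - 0ℚ - p)) - (t - e (y + p - 0ℚ)))
               (cong e (arg₁ y p)) (cong e (arg₂ y p)))
        (lemma k (u + v) (e (y - 0ℚ - p)) (e (y + p - 0ℚ)))
        where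
        arg₁ : ∀ y p → y + 0ℚ - p ≡ y - 0ℚ - p
        arg₁ = solve-∀ ℚ-ring
        arg₂ : ∀ y p → y + 0ℚ + p ≡ y + p - 0ℚ
        arg₂ = solve-∀ ℚ-ring
        lemma : ∀ k u a b → k * 0ℚ * u - (a - a) - (b - b) ≡ 0ℚ
        lemma = solve-∀ ℚ-ring

      shape-suc : ∀ p q y u v →
        k * (u - h (y + q - p) - (h (y - q + p) - v)) + shape (1ℚ + p) q y u v ≡ shape p (1ℚ + q) y u v
      shape-suc p q y u v = begin
        k * (u - h (y + q - p) - (h (y - q + p) - v)) + shape (1ℚ + p) q y u v
          ≡⟨ expand k q u v (h (y + q - p)) (h (y - q + p)) (e (y + q - (1ℚ + p))) (e (y - q - (1ℚ + p))) (e (y + q + (1ℚ + p))) (e (y + (1ℚ + p) - q)) ⟩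
        k * (1ℚ + q) * (u + v) - k * h (y + q - p) - k * h (y - q + p)
          - (e (y + q - (1ℚ + p)) - e (y - q - (1ℚ + p))) - (e (y + q + (1ℚ + p)) - e (y + (1ℚ + p) - q))
          ≡⟨ cong₂ (λ s t → k * (1ℚ + q) * (u + v) - s - t
               - (e (y + q - (1ℚ + p)) - e (y - q - (1ℚ + p))) - (e (y + q + (1ℚ + p)) - e (y + (1ℚ + p) - q)))
               (trans (sym (tele (y + q - p))) (cong₂ _-_ (cong e (arg₁ y q p)) (cong e (arg₂ y q p))))
               (trans (sym (tele (y - q + p))) (cong₂ _-_ (cong e (arg₃ y q p)) (cong e (arg₄ y q p)))) ⟩
        k * (1ℚ + q) * (u + v) - (e (y + (1ℚ + q) - p) - e (y + q - (1ℚ + p))) - (e (y + (1ℚ + p) - q) - e (y + p - (1ℚ + q)))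
          - (e (y + q - (1ℚ + p)) - e (y - q - (1ℚ + p))) - (e (y + q + (1ℚ + p)) - e (y + (1ℚ + p) - q))
          ≡⟨ collapse (k * (1ℚ + q) * (u + v)) (e (y + (1ℚ + q) - p)) (e (y + q - (1ℚ + p))) (e (y + (1ℚ + p) - q)) (e (y + p - (1ℚ + q))) (e (y - q - (1ℚ + p))) (e (y + q + (1ℚ + p))) ⟩
        k * (1ℚ + q) * (u + v) - (e (y + (1ℚ + q) - p) - e (y - q - (1ℚ + p))) - (e (y + q + (1ℚ + p)) - e (y + p - (1ℚ + q)))
          ≡⟨ cong₂ (λ s t → k * (1ℚ + q) * (u + v) - (e (y + (1ℚ + q) - p) - s) - (t - e (y + p - (1ℚ + q))))
               (cong e (arg₅ y q p)) (cong e (arg₆ y q p)) ⟩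
        shape p (1ℚ + q) y u v ∎
        where
        expand : ∀ k q u v a b c d f g →
          k * (u - a - (b - v)) + (k * q * (u + v) - (c - d) - (f - g))
          ≡ k * (1ℚ + q) * (u + v) - k * a - k * b - (c - d) - (f - g)
        expand = solve-∀ ℚ-ring
        collapse : ∀ x a b c d f g → x - (a - b) - (c - d) - (b - f) - (g - c) ≡ x - (a - f) - (g - d)
        collapse = solve-∀ ℚ-ring
        arg₁ : ∀ y q p → y + q - p + 1ℚ ≡ y + (1ℚ + q) - p
        arg₁ = solve-∀ ℚ-ring
        arg₂ : ∀ y q p → y + q - p - 1ℚ ≡ y + q - (1ℚ + p)
        arg₂ = solve-∀ ℚ-ring
        arg₃ : ∀ y q p → y - q + p + 1ℚ ≡ y + (1ℚ + p) - q
        arg₃ = solve-∀ ℚ-ring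
        arg₄ : ∀ y q p → y - q + p - 1ℚ ≡ y + p - (1ℚ + q)
        arg₄ = solve-∀ ℚ-ring
        arg₅ : ∀ y q p → y - q - (1ℚ + p) ≡ y - (1ℚ + q) - p
        arg₅ = solve-∀ ℚ-ring
        arg₆ : ∀ y q p → y + q + (1ℚ + p) ≡ y + (1ℚ + q) + p
        arg₆ = solve-∀ ℚ-ring

      ∇∇ : ∀ a c y → ∇ c (∇ a h) y
           ≡ h (y + (c + a)) - h (y + c - a) - (h (y - c + a) - h (y - (c + a)))
      ∇∇ a c y = cong₂ (λ s t → s - h (y + c - a) - (h (y - c + a) - t)) (cong h (arg₁ y c a)) (cong h (arg₂ y c a))
        where
        arg₁ : ∀ y q p → y + q + p ≡ y + (q + p)
        arg₁ = solve-∀ ℚ-ring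
        arg₂ : ∀ y q p → y - q - p ≡ y - (q + p)
        arg₂ = solve-∀ ℚ-ring

      ΔΔ : ∀ p q y {u v} → h (y + fromℕ (suc (q ℕ.+ suc p))) ≡ u → h (y - fromℕ (suc (q ℕ.+ suc p))) ≡ v →
           Δ (suc q) (Δ (suc p) h) y
           ≡ u - h (y + fromℕ q - fromℕ p) - (h (y - fromℕ q + fromℕ p) - v)
      ΔΔ p q y {u} {v} eq₊ eq₋ = trans (∇∇ (fromℕ (suc p)) (fromℕ (suc q)) y) (begin
        h (y + (fromℕ (suc q) + fromℕ (suc p))) - h (y + fromℕ (suc q) - fromℕ (suc p)) - (h (y - fromℕ (suc q) + fromℕ (suc p)) - h (y - (fromℕ (suc q) + fromℕ (suc p))))
          ≡⟨ cong₂ (λ s t → s - h (y + fromℕ (suc q) - fromℕ (suc p)) - (h (y - fromℕ (suc q) + fromℕ (suc p)) - t))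
               (trans (cong (λ z → h (y + z)) (sym (fromℕ-+ (suc q) (suc p)))) eq₊)
               (trans (cong (λ z → h (y - z)) (sym (fromℕ-+ (suc q) (suc p)))) eq₋) ⟩
        u - h (y + fromℕ (suc q) - fromℕ (suc p)) - (h (y - fromℕ (suc q) + fromℕ (suc p)) - v)
          ≡⟨ cong₂ (λ s t → u - h s - (h t - v))
               (trans (cong₂ (λ s t → y + s - t) (fromℕ-suc q) (fromℕ-suc p)) (arg₁ y (fromℕ q) (fromℕ p)))
               (trans (cong₂ (λ s t → y - s + t) (fromℕ-suc q) (fromℕ-suc p)) (arg₂ y (fromℕ q) (fromℕ p))) ⟩
        u - h (y + fromℕ q - fromℕ p) - (h (y - fromℕ q + fromℕ p) - v) ∎)
        where
        arg₁ : ∀ y q p → y + (1ℚ + q) - (1ℚ + p) ≡ y + q - p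
        arg₁ = solve-∀ ℚ-ring
        arg₂ : ∀ y q p → y - (1ℚ + q) + (1ℚ + p) ≡ y - q + p
        arg₂ = solve-∀ ℚ-ring

      cut-shape : ∀ p q y {b} → suc (q ℕ.+ p) ≡ b →
        k * cut (λ a c → Δ c (Δ a h) y) p q
        ≡ shape (fromℕ p) (fromℕ q) y (h (y + fromℕ b)) (h (y - fromℕ b))
      cut-shape p zero    y {b} eq = trans (*-zeroʳ k) (sym (shape-0 (fromℕ p) y (h (y + fromℕ b)) (h (y - fromℕ b))))
      cut-shape p (suc q) y {b} refl = begin
        k * (Δ (suc q) (Δ (suc p) h) y + cut (λ a c → Δ c (Δ a h) y) (suc p) q)
          ≡⟨ *-distribˡ-+ k _ _ ⟩
        k * Δ (suc q) (Δ (suc p) h) y + k * cut (λ a c → Δ c (Δ a h) y) (suc p) q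
          ≡⟨ cong₂ _+_
               (cong (k *_) (ΔΔ p q y {h (y + fromℕ b)} {h (y - fromℕ b)}
                  (cong (λ n → h (y + fromℕ n)) (cong suc (ℕ.+-suc q p)))
                  (cong (λ n → h (y - fromℕ n)) (cong suc (ℕ.+-suc q p)))))
               (cut-shape (suc p) q y {b} (cong suc (ℕ.+-suc q p))) ⟩
        k * (h (y + fromℕ b) - h (y + fromℕ q - fromℕ p) - (h (y - fromℕ q + fromℕ p) - h (y - fromℕ b)))
          + shape (fromℕ (suc p)) (fromℕ q) y (h (y + fromℕ b)) (h (y - fromℕ b))
          ≡⟨ cong (λ z → k * (h (y + fromℕ b) - h (y + fromℕ q - fromℕ p) - (h (y - fromℕ q + fromℕ p) - h (y - fromℕ b))) + shape z (fromℕ q) y (h (y + fromℕ b)) (h (y - fromℕ b))) (fromℕ-suc p) ⟩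
        k * (h (y + fromℕ b) - h (y + fromℕ q - fromℕ p) - (h (y - fromℕ q + fromℕ p) - h (y - fromℕ b)))
          + shape (1ℚ + fromℕ p) (fromℕ q) y (h (y + fromℕ b)) (h (y - fromℕ b))
          ≡⟨ shape-suc (fromℕ p) (fromℕ q) y (h (y + fromℕ b)) (h (y - fromℕ b)) ⟩
        shape (fromℕ p) (1ℚ + fromℕ q) y (h (y + fromℕ b)) (h (y - fromℕ b))
          ≡⟨ cong (λ z → shape (fromℕ p) z y (h (y + fromℕ b)) (h (y - fromℕ b))) (fromℕ-suc q) ⟨
        shape (fromℕ p) (fromℕ (suc q)) y (h (y + fromℕ b)) (h (y - fromℕ b)) ∎

    -- With `p = 0` the two inner families run over the same arguments, hence a single difference of
    -- `e` with factor 2.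
    cut-telescope : ∀ q y → k * cut (λ a c → Δ c (Δ a h) y) 0 q
      ≡ k * fromℕ q * (h (y + fromℕ (suc q)) + h (y - fromℕ (suc q))) - 2ℚ * (e (y + fromℕ q) - e (y - fromℕ q))
    cut-telescope q y = trans (cut-shape 0 q y (cong suc (ℕ.+-identityʳ q)))
      (trans (cong₂ (λ s t → k * fromℕ q * (u + v) - s - t)
                (cong₂ _-_ (cong e (arg₁ y (fromℕ q))) (cong e (arg₂ y (fromℕ q))))
                (cong₂ _-_ (cong e (arg₃ y (fromℕ q))) (cong e (arg₄ y (fromℕ q)))))
             (lemma (k * fromℕ q * (u + v)) (e (y + fromℕ q)) (e (y - fromℕ q))))
      where
      u v : ℚ
      u = h (y + fromℕ (suc q))
      v = h (y - fromℕ (suc q))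
      arg₁ : ∀ y q → y + q - 0ℚ ≡ y + q
      arg₁ = solve-∀ ℚ-ring
      arg₂ : ∀ y q → y - q - 0ℚ ≡ y - q
      arg₂ = solve-∀ ℚ-ring
      arg₃ : ∀ y q → y + q + 0ℚ ≡ y + q
      arg₃ = solve-∀ ℚ-ring
      arg₄ : ∀ y q → y + 0ℚ - q ≡ y - q
      arg₄ = solve-∀ ℚ-ring
      lemma : ∀ x a b → x - (a - b) - (a - b) ≡ x - (1ℚ + 1ℚ) * (a - b)
      lemma = solve-∀ ℚ-ring

-- Cut-and-join on iterated differences; elementary symmetric polynomials of arithmetic
-- progressions.

module CutAndJoin where

  open import Data.Nat.ListAction using (sum)
  open import Data.Rational using (_+_; _*_; _-_; -_)
  open import Data.Rational.Properties
  open Sums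
  open Differences

  open ≡-Reasoning

  -- The change of a class function F under multiplication by the transpositions
  -- that move a point of a cycle of length b, where R lists the other cycles.

  cutJoin : (List ℕ → ℚ) → ℕ → List ℕ → ℚ
  cutJoin F b R = cut (λ a c → F (a ∷ c ∷ R)) 0 (ℕ.pred b)
                + ∑ (picks R) (λ (c , R′) → fromℕ c * F ((b ℕ.+ c) ∷ R′))

  4ℚ : ℚ
  4ℚ = 2ℚ * 2ℚ

  module _ (h e : ℚ → ℚ) (k : ℚ) (tele : ∀ z → e (z + 1ℚ) - e (z - 1ℚ) ≡ k * h z) where

    -- The factor `k` lets the cuts telescope through `e`, and the factor 2 turns the joins into
    -- shift identities; the multiplier `2 k` serves both at once.
    cutJoin-D : ∀ q R → 2ℚ * k * cutJoin (λ L → D L h) (suc q) R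
      ≡ D R (λ y → k * (fromℕ (sum R) + y + 2ℚ * fromℕ q) * h (y + fromℕ (suc q))
                 + k * (fromℕ (sum R) - y + 2ℚ * fromℕ q) * h (y - fromℕ (suc q))
                 - 4ℚ * (e (y + fromℕ q) - e (y - fromℕ q)))
    cutJoin-D q R = begin
      2ℚ * k * cutJoin (λ L → D L h) (suc q) R
        ≡⟨ split k (cut (λ a c → D (a ∷ c ∷ R) h) 0 q) _ ⟩
      2ℚ * (k * cut (λ a c → D (a ∷ c ∷ R) h) 0 q) + k * (2ℚ * ∑ (picks R) (λ (c , R′) → fromℕ c * D ((suc q ℕ.+ c) ∷ R′) h))
        ≡⟨ cong₂ _+_ (cong (2ℚ *_) (trans (cong (k *_) (D-cut R h 0 q)) (trans (sym (D-* R k (λ y → cut (λ a c → Δ c (Δ a h) y) 0 q))) (D-cong R (cut-telescope h e k tele q)))))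
                     (cong (k *_) (trans (trans (*-∑ 2ℚ (picks R) _) (∑-cong (picks R) (λ (c , R′) → sym (*-assoc 2ℚ (fromℕ c) (D ((suc q ℕ.+ c) ∷ R′) h)))))
                                         (∑-picks-join (suc q) R h))) ⟩
      2ℚ * D R (λ y → k * fromℕ q * (h₊ y + h₋ y) - 2ℚ * ε y) + k * D R (λ y → (s + y) * h₊ y + (s - y) * h₋ y)
        ≡⟨ cong₂ _+_ (D-* R 2ℚ (λ y → k * fromℕ q * (h₊ y + h₋ y) - 2ℚ * ε y)) (D-* R k (λ y → (s + y) * h₊ y + (s - y) * h₋ y)) ⟨
      D R (λ y → 2ℚ * (k * fromℕ q * (h₊ y + h₋ y) - 2ℚ * ε y)) + D R (λ y → k * ((s + y) * h₊ y + (s - y) * h₋ y))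
        ≡⟨ D-+ R _ _ ⟨
      D R (λ y → 2ℚ * (k * fromℕ q * (h₊ y + h₋ y) - 2ℚ * ε y) + k * ((s + y) * h₊ y + (s - y) * h₋ y))
        ≡⟨ D-cong R (λ y → combine k (fromℕ q) (h₊ y) (h₋ y) (ε y) s y) ⟩
      D R (λ y → k * (s + y + 2ℚ * fromℕ q) * h₊ y + k * (s - y + 2ℚ * fromℕ q) * h₋ y - 4ℚ * ε y) ∎
      where
      s : ℚ
      s = fromℕ (sum R)
      h₊ h₋ ε : ℚ → ℚ
      h₊ y = h (y + fromℕ (suc q))
      h₋ y = h (y - fromℕ (suc q))
      ε y = e (y + fromℕ q) - e (y - fromℕ q)
      split : ∀ k a b → (1ℚ + 1ℚ) * k * (a + b) ≡ (1ℚ + 1ℚ) * (k * a) + k * ((1ℚ + 1ℚ) * b)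
      split = solve-∀ ℚ-ring
      combine : ∀ k q u v w s y →
        (1ℚ + 1ℚ) * (k * q * (u + v) - (1ℚ + 1ℚ) * w) + k * ((s + y) * u + (s - y) * v)
        ≡ k * (s + y + (1ℚ + 1ℚ) * q) * u + k * (s - y + (1ℚ + 1ℚ) * q) * v - ((1ℚ + 1ℚ) * (1ℚ + 1ℚ)) * w
      combine = solve-∀ ℚ-ring

  -- Summing over all transpositions multiplies the differences of h by d y.

  module _ (h h′ : ℚ → ℚ) (L : List ℕ) .{{_ : ℕ.NonZero (sum L)}}
    (rel : ∀ z → h′ (z + 1ℚ) - h′ (z - 1ℚ) ≡ fromℕ (sum L) * z * (h (z + 1ℚ) - h (z - 1ℚ))) where

    private
      d : ℚ
      d = fromℕ (sum L)
      -- Found by summation by parts. By `rel` the same value is obtained from `h` and `h′` at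
      -- `z - 1` (`e′`), so in the difference of `e` around `z` both ends can be expressed at `z`
      -- itself, where `h′` drops out and `2 d h z` remains.
      e : ℚ → ℚ
      e z = d * z * h (z + 1ℚ) - h′ (z + 1ℚ)

      e′ : ∀ z → e z ≡ d * z * h (z - 1ℚ) - h′ (z - 1ℚ)
      e′ z = trans (lemma (d * z) (h (z + 1ℚ)) (h (z - 1ℚ)) (h′ (z + 1ℚ)) (h′ (z - 1ℚ)))
        (trans (cong (λ w → d * z * h (z - 1ℚ) - h′ (z - 1ℚ) + d * z * (h (z + 1ℚ) - h (z - 1ℚ)) - w) (rel z))
               (lemma′ (d * z * h (z - 1ℚ) - h′ (z - 1ℚ)) (d * z * (h (z + 1ℚ) - h (z - 1ℚ)))))
        where
        lemma : ∀ c u v u′ v′ → c * u - u′ ≡ c * v - v′ + c * (u - v) - (u′ - v′)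
        lemma = solve-∀ ℚ-ring
        lemma′ : ∀ a b → a + b - b ≡ a
        lemma′ = solve-∀ ℚ-ring

      +1-1 : ∀ z → z + 1ℚ - 1ℚ ≡ z
      +1-1 = solve-∀ ℚ-ring
      -1+1 : ∀ z → z - 1ℚ + 1ℚ ≡ z
      -1+1 = solve-∀ ℚ-ring

      tele : ∀ z → e (z + 1ℚ) - e (z - 1ℚ) ≡ 2ℚ * d * h z
      tele z = trans (cong₂ _-_
          (trans (e′ (z + 1ℚ)) (cong (λ w → d * (z + 1ℚ) * h w - h′ w) (+1-1 z)))
          (cong (λ w → d * (z - 1ℚ) * h w - h′ w) (-1+1 z)))
        (lemma d z (h z) (h′ z))
        where
        lemma : ∀ d z u v → d * (z + 1ℚ) * u - v - (d * (z - 1ℚ) * u - v) ≡ (1ℚ + 1ℚ) * d * u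
        lemma = solve-∀ ℚ-ring

      ν : ℕ → List ℕ → ℚ → ℚ
      ν b R y = (fromℕ (sum R) - y) * h (y + fromℕ b) + (fromℕ (sum R) + y) * h (y - fromℕ b)

      pointwise : ∀ q R y →
        2ℚ * d * (fromℕ (sum R) + y + 2ℚ * fromℕ q) * h (y + fromℕ (suc q))
        + 2ℚ * d * (fromℕ (sum R) - y + 2ℚ * fromℕ q) * h (y - fromℕ (suc q))
        - 4ℚ * (e (y + fromℕ q) - e (y - fromℕ q))
        ≡ 2ℚ * d * ν (suc q) R y + 4ℚ * Δ (suc q) h′ y
      pointwise q R y = trans
        (cong (λ w → 2ℚ * d * (fromℕ (sum R) + y + 2ℚ * fromℕ q) * h (y + fromℕ (suc q))
                   + 2ℚ * d * (fromℕ (sum R) - y + 2ℚ * fromℕ q) * h (y - fromℕ (suc q)) - 4ℚ * w)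
          (cong₂ _-_
            (cong (λ w → d * (y + fromℕ q) * h w - h′ w) (trans (arg₁ y (fromℕ q)) (cong (y +_) (sym (fromℕ-suc q)))))
            (trans (e′ (y - fromℕ q)) (cong (λ w → d * (y - fromℕ q) * h w - h′ w) (trans (arg₂ y (fromℕ q)) (cong (λ w → y - w) (sym (fromℕ-suc q))))))))
        (lemma d (fromℕ (sum R)) y (fromℕ q) (h (y + fromℕ (suc q))) (h (y - fromℕ (suc q))) (h′ (y + fromℕ (suc q))) (h′ (y - fromℕ (suc q))))
        where
        arg₁ : ∀ y q → y + q + 1ℚ ≡ y + (1ℚ + q)
        arg₁ = solve-∀ ℚ-ring
        arg₂ : ∀ y q → y - q - 1ℚ ≡ y - (1ℚ + q)
        arg₂ = solve-∀ ℚ-ring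
        lemma : ∀ d s y q u v u′ v′ →
          (1ℚ + 1ℚ) * d * (s + y + (1ℚ + 1ℚ) * q) * u + (1ℚ + 1ℚ) * d * (s - y + (1ℚ + 1ℚ) * q) * v
          - ((1ℚ + 1ℚ) * (1ℚ + 1ℚ)) * (d * (y + q) * u - u′ - (d * (y - q) * v - v′))
          ≡ (1ℚ + 1ℚ) * d * ((s - y) * u + (s + y) * v) + ((1ℚ + 1ℚ) * (1ℚ + 1ℚ)) * (u′ - v′)
        lemma = solve-∀ ℚ-ring

      term : ∀ b R → D (b ∷ R) h′ ≡ D L h′ → 4ℚ * d * (fromℕ b * cutJoin (λ L → D L h) b R)
        ≡ d * (2ℚ * fromℕ b * D R (ν b R)) + fromℕ b * (4ℚ * D L h′)
      term zero R eq = zeros (4ℚ * d) d 2ℚ (cutJoin (λ L → D L h) zero R) (D R (ν zero R)) (4ℚ * D L h′)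
        where
        zeros : ∀ a d t x y z → a * (0ℚ * x) ≡ d * (t * 0ℚ * y) + 0ℚ * z
        zeros = solve-∀ ℚ-ring
      term b@(suc q) R eq = begin
        4ℚ * d * (fromℕ b * cutJoin (λ L → D L h) b R)
          ≡⟨ shuffle d (fromℕ b) (cutJoin (λ L → D L h) b R) ⟩
        fromℕ b * (2ℚ * (2ℚ * d) * cutJoin (λ L → D L h) b R)
          ≡⟨ cong (fromℕ b *_) (trans (cutJoin-D h e (2ℚ * d) tele q R) (D-cong R (pointwise q R))) ⟩
        fromℕ b * D R (λ y → 2ℚ * d * ν b R y + 4ℚ * Δ b h′ y)
          ≡⟨ cong (fromℕ b *_) (trans (D-+ R _ _) (cong₂ _+_ (D-* R (2ℚ * d) (ν b R)) (trans (D-* R 4ℚ (Δ b h′)) (cong (4ℚ *_) eq)))) ⟩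
        fromℕ b * (2ℚ * d * D R (ν b R) + 4ℚ * D L h′)
          ≡⟨ shuffle′ d (fromℕ b) (D R (ν b R)) (4ℚ * D L h′) ⟩
        d * (2ℚ * fromℕ b * D R (ν b R)) + fromℕ b * (4ℚ * D L h′) ∎
        where
        shuffle : ∀ d b x → (1ℚ + 1ℚ) * (1ℚ + 1ℚ) * d * (b * x) ≡ b * ((1ℚ + 1ℚ) * ((1ℚ + 1ℚ) * d) * x)
        shuffle = solve-∀ ℚ-ring
        shuffle′ : ∀ d b x y → b * ((1ℚ + 1ℚ) * d * x + y) ≡ d * ((1ℚ + 1ℚ) * b * x) + b * y
        shuffle′ = solve-∀ ℚ-ring

    ∑-cutJoin : ∑ (picks L) (λ (b , R) → fromℕ b * cutJoin (λ L → D L h) b R) ≡ D L h′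
    ∑-cutJoin = cancel-fromℕ 4 (cancel-fromℕ (sum L) (begin
      d * (4ℚ * ∑ (picks L) (λ (b , R) → fromℕ b * cutJoin (λ L → D L h) b R))
        ≡⟨ trans (trans (sym (*-assoc d 4ℚ X)) (cong (_* X) (*-comm d 4ℚ))) (*-∑ (4ℚ * d) (picks L) _) ⟩
      ∑ (picks L) (λ (b , R) → 4ℚ * d * (fromℕ b * cutJoin (λ L → D L h) b R))
        ≡⟨ ∑-cong∈ (picks L) (λ {(b , R)} p → term b R (D-↭ (picks-↭ p) h′)) ⟩
      ∑ (picks L) (λ (b , R) → d * (2ℚ * fromℕ b * D R (ν b R)) + fromℕ b * (4ℚ * D L h′))
        ≡⟨ ∑-+ (picks L) (λ (b , R) → d * (2ℚ * fromℕ b * D R (ν b R))) (λ (b , R) → fromℕ b * (4ℚ * D L h′)) ⟩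
      ∑ (picks L) (λ (b , R) → d * (2ℚ * fromℕ b * D R (ν b R))) + ∑ (picks L) (λ (b , R) → fromℕ b * (4ℚ * D L h′))
        -- The `ν` terms vanish by antisymmetry. What is left is `4 D L h′` once for every point of
        -- every part, hence `d` times.
        ≡⟨ cong₂ _+_ (trans (sym (*-∑ d (picks L) (λ (b , R) → 2ℚ * fromℕ b * D R (ν b R)))) (trans (cong (d *_) (∑-picks-antisym L h)) (*-zeroʳ d)))
                     (trans (sym (∑-* (picks L) (fromℕ ∘ proj₁) (4ℚ * D L h′))) (cong (_* (4ℚ * D L h′)) (∑-picks-sum L))) ⟩
      0ℚ + d * (4ℚ * D L h′)
        ≡⟨ +-identityˡ _ ⟩
      d * (4ℚ * D L h′) ∎))
      where
      X : ℚ
      X = ∑ (picks L) (λ (b , R) → fromℕ b * cutJoin (λ L → D L h) b R)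

  -- G d r c is the elementary symmetric polynomial e_r of c, c + 2, …, c + 2 (d - 1).

  G : ℕ → ℕ → ℚ → ℚ
  G d       zero    c = 1ℚ
  G zero    (suc r) c = 0ℚ
  G (suc d) (suc r) c = G d (suc r) c + (c + 2ℚ * fromℕ d) * G d r c

  -- `G` is defined by splitting off the largest number of the progression; splitting off the
  -- smallest is what a shift in the opposite direction requires.
  G-bottom : ∀ d r c → G (suc d) (suc r) c ≡ G d (suc r) (c + 2ℚ) + c * G d r (c + 2ℚ)
  G-bottom zero    zero    c = lemma c
    where
    lemma : ∀ c → 0ℚ + (c + (1ℚ + 1ℚ) * 0ℚ) * 1ℚ ≡ 0ℚ + c * 1ℚ
    lemma = solve-∀ ℚ-ring
  G-bottom zero    (suc r) c = lemma c
    where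
    lemma : ∀ c → 0ℚ + (c + (1ℚ + 1ℚ) * 0ℚ) * 0ℚ ≡ 0ℚ + c * 0ℚ
    lemma = solve-∀ ℚ-ring
  G-bottom (suc d) zero    c = trans
    (cong₂ (λ u v → u + (c + 2ℚ * v) * 1ℚ) (G-bottom d zero c) (fromℕ-suc d))
    (lemma c (fromℕ d) (G d 1 (c + 2ℚ)))
    where
    lemma : ∀ c d g → g + c * 1ℚ + (c + (1ℚ + 1ℚ) * (1ℚ + d)) * 1ℚ ≡ g + (c + (1ℚ + 1ℚ) + (1ℚ + 1ℚ) * d) * 1ℚ + c * 1ℚ
    lemma = solve-∀ ℚ-ring
  G-bottom (suc d) (suc r) c = trans
    (cong₂ _+_ (G-bottom d (suc r) c) (cong₂ (λ u v → (c + 2ℚ * u) * v) (fromℕ-suc d) (G-bottom d r c)))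
    (lemma c (fromℕ d) (G d (suc (suc r)) (c + 2ℚ)) (G d (suc r) (c + 2ℚ)) (G d r (c + 2ℚ)))
    where
    lemma : ∀ c d u v w → u + c * v + (c + (1ℚ + 1ℚ) * (1ℚ + d)) * (v + c * w)
      ≡ u + (c + (1ℚ + 1ℚ) + (1ℚ + 1ℚ) * d) * v + c * (v + (c + (1ℚ + 1ℚ) + (1ℚ + 1ℚ) * d) * w)
    lemma = solve-∀ ℚ-ring

  -- E d r y is e_r of y - d, y - d + 2, …, y + d.

  E : ℕ → ℕ → ℚ → ℚ
  E d r y = G (suc d) r (y - fromℕ d)

  module _ (n r : ℕ) where

    -- The progressions of `E (suc n)` at `y + 1` and at `y - 1` both contain that of `E n` at `y`.
    -- The additional number is `y + n + 2` in one case and `y - n - 2` in the other, and their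
    -- difference is the constant of `E-tele`.
    E-top : ∀ y → E (suc n) (suc r) (y + 1ℚ) ≡ E n (suc r) y + (y + fromℕ n + 2ℚ) * E n r y
    E-top y = trans (cong (G (suc (suc n)) (suc r)) (trans (cong (λ w → y + 1ℚ - w) (fromℕ-suc n)) (arg y (fromℕ n))))
      (cong (λ w → E n (suc r) y + w * E n r y) (trans (cong (λ w → y - fromℕ n + 2ℚ * w) (fromℕ-suc n)) (coef y (fromℕ n))))
      where
      arg : ∀ y n → y + 1ℚ - (1ℚ + n) ≡ y - n
      arg = solve-∀ ℚ-ring
      coef : ∀ y n → y - n + (1ℚ + 1ℚ) * (1ℚ + n) ≡ y + n + (1ℚ + 1ℚ)
      coef = solve-∀ ℚ-ring

    E-bottom : ∀ y → E (suc n) (suc r) (y - 1ℚ) ≡ E n (suc r) y + (y - fromℕ n - 2ℚ) * E n r y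
    E-bottom y = trans (G-bottom (suc n) r (y - 1ℚ - fromℕ (suc n)))
      (cong₂ (λ u v → G (suc n) (suc r) u + v * G (suc n) r u)
        (trans (cong (λ w → y - 1ℚ - w + 2ℚ) (fromℕ-suc n)) (arg y (fromℕ n)))
        (trans (cong (λ w → y - 1ℚ - w) (fromℕ-suc n)) (coef y (fromℕ n))))
      where
      arg : ∀ y n → y - 1ℚ - (1ℚ + n) + (1ℚ + 1ℚ) ≡ y - n
      arg = solve-∀ ℚ-ring
      coef : ∀ y n → y - 1ℚ - (1ℚ + n) ≡ y - n - (1ℚ + 1ℚ)
      coef = solve-∀ ℚ-ring

    E-tele : ∀ y → E (suc n) (suc r) (y + 1ℚ) - E (suc n) (suc r) (y - 1ℚ) ≡ 2ℚ * (fromℕ n + 2ℚ) * E n r y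
    E-tele y = trans (cong₂ _-_ (E-top y) (E-bottom y)) (lemma (E n (suc r) y) (E n r y) y (fromℕ n))
      where
      lemma : ∀ u v y n → u + (y + n + (1ℚ + 1ℚ)) * v - (u + (y - n - (1ℚ + 1ℚ)) * v) ≡ (1ℚ + 1ℚ) * (n + (1ℚ + 1ℚ)) * v
      lemma = solve-∀ ℚ-ring

    D-fixed : ∀ L → D (1 ∷ L) (E (suc n) (suc r)) ≡ 2ℚ * (fromℕ n + 2ℚ) * D L (E n r)
    D-fixed L = trans (D-cong L E-tele) (D-* L (2ℚ * (fromℕ n + 2ℚ)) (E n r))

  -- The analytic side of inserting a point into a cycle of length `suc q`. By `E-tele`,
  -- `E (suc n) (suc r)` is an antidifference of a multiple of `E n r`, so it can be the `e` of
  -- `cutJoin-D`; then `E-top` and `E-bottom` reduce everything to `E n` at `y ± suc q`, where the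
  -- identity is one of polynomials.
  D-insert : ∀ q R r → let n = suc q ℕ.+ sum R in
    2ℚ * (fromℕ n * D (suc (suc q) ∷ R) (E (suc n) (suc r)))
    ≡ 2ℚ * ((fromℕ n + 2ℚ) * D (suc q ∷ R) (E n (suc r)) + 2ℚ * (fromℕ n + 2ℚ) * cutJoin (λ L → D L (E n r)) (suc q) R)
  D-insert q R r = sym (begin
    2ℚ * (m * D (suc q ∷ R) (E n (suc r)) + 2ℚ * m * cutJoin (λ L → D L h) (suc q) R)
      ≡⟨ split m (D (suc q ∷ R) (E n (suc r))) (cutJoin (λ L → D L h) (suc q) R) ⟩
    2ℚ * m * D R (Δ (suc q) (E n (suc r))) + 2ℚ * (2ℚ * m) * cutJoin (λ L → D L h) (suc q) R
      ≡⟨ cong₂ _+_ (sym (D-* R (2ℚ * m) (Δ (suc q) (E n (suc r))))) (cutJoin-D h e (2ℚ * m) (E-tele n r) q R) ⟩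
    D R (λ y → 2ℚ * m * Δ (suc q) (E n (suc r)) y) + D R (λ y → 2ℚ * m * (s + y + 2ℚ * fromℕ q) * h (y + fromℕ (suc q))
                 + 2ℚ * m * (s - y + 2ℚ * fromℕ q) * h (y - fromℕ (suc q))
                 - 4ℚ * (e (y + fromℕ q) - e (y - fromℕ q)))
      ≡⟨ D-+ R _ _ ⟨
    D R (λ y → 2ℚ * m * Δ (suc q) (E n (suc r)) y + (2ℚ * m * (s + y + 2ℚ * fromℕ q) * h (y + fromℕ (suc q))
                 + 2ℚ * m * (s - y + 2ℚ * fromℕ q) * h (y - fromℕ (suc q))
                 - 4ℚ * (e (y + fromℕ q) - e (y - fromℕ q))))
      ≡⟨ D-cong R pointwise ⟩
    D R (λ y → 2ℚ * fromℕ n * Δ (suc (suc q)) e y)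
      ≡⟨ D-* R (2ℚ * fromℕ n) (Δ (suc (suc q)) e) ⟩
    2ℚ * fromℕ n * D (suc (suc q) ∷ R) e
      ≡⟨ *-assoc 2ℚ (fromℕ n) _ ⟩
    2ℚ * (fromℕ n * D (suc (suc q) ∷ R) e) ∎)
    where
    n : ℕ
    n = suc q ℕ.+ sum R
    m s : ℚ
    m = fromℕ n + 2ℚ
    s = fromℕ (sum R)
    h e : ℚ → ℚ
    h = E n r
    e = E (suc n) (suc r)
    split : ∀ m a b → (1ℚ + 1ℚ) * (m * a + (1ℚ + 1ℚ) * m * b) ≡ (1ℚ + 1ℚ) * m * a + (1ℚ + 1ℚ) * ((1ℚ + 1ℚ) * m) * b
    split = solve-∀ ℚ-ring
    n-eq : fromℕ n ≡ 1ℚ + fromℕ q + s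
    n-eq = trans (fromℕ-+ (suc q) (sum R)) (cong (_+ s) (fromℕ-suc q))
    arg₁ : ∀ y q → y + q ≡ y + (1ℚ + q) - 1ℚ
    arg₁ = solve-∀ ℚ-ring
    arg₂ : ∀ y q → y - q ≡ y - (1ℚ + q) + 1ℚ
    arg₂ = solve-∀ ℚ-ring
    arg₃ : ∀ y q → y + (1ℚ + q) ≡ y + q + 1ℚ
    arg₃ = solve-∀ ℚ-ring
    arg₄ : ∀ y q → y - (1ℚ + q) ≡ y - q - 1ℚ
    arg₄ = solve-∀ ℚ-ring
    alg : ∀ {n q s} → n ≡ 1ℚ + q + s → ∀ {b} → b ≡ 1ℚ + q → ∀ y u v u′ v′ →
      (1ℚ + 1ℚ) * (n + (1ℚ + 1ℚ)) * (u′ - v′) + ((1ℚ + 1ℚ) * (n + (1ℚ + 1ℚ)) * (s + y + (1ℚ + 1ℚ) * q) * u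
        + (1ℚ + 1ℚ) * (n + (1ℚ + 1ℚ)) * (s - y + (1ℚ + 1ℚ) * q) * v
        - ((1ℚ + 1ℚ) * (1ℚ + 1ℚ)) * (u′ + (y + b - n - (1ℚ + 1ℚ)) * u - (v′ + (y - b + n + (1ℚ + 1ℚ)) * v)))
      ≡ (1ℚ + 1ℚ) * n * (u′ + (y + b + n + (1ℚ + 1ℚ)) * u - (v′ + (y - b - n - (1ℚ + 1ℚ)) * v))
    alg {q = q} {s = s} refl refl = alg′ q s
      where
      alg′ : ∀ q s y u v u′ v′ →
        (1ℚ + 1ℚ) * (1ℚ + q + s + (1ℚ + 1ℚ)) * (u′ - v′) + ((1ℚ + 1ℚ) * (1ℚ + q + s + (1ℚ + 1ℚ)) * (s + y + (1ℚ + 1ℚ) * q) * u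
          + (1ℚ + 1ℚ) * (1ℚ + q + s + (1ℚ + 1ℚ)) * (s - y + (1ℚ + 1ℚ) * q) * v
          - ((1ℚ + 1ℚ) * (1ℚ + 1ℚ)) * (u′ + (y + (1ℚ + q) - (1ℚ + q + s) - (1ℚ + 1ℚ)) * u - (v′ + (y - (1ℚ + q) + (1ℚ + q + s) + (1ℚ + 1ℚ)) * v)))
        ≡ (1ℚ + 1ℚ) * (1ℚ + q + s) * (u′ + (y + (1ℚ + q) + (1ℚ + q + s) + (1ℚ + 1ℚ)) * u - (v′ + (y - (1ℚ + q) - (1ℚ + q + s) - (1ℚ + 1ℚ)) * v))
      alg′ = solve-∀ ℚ-ring
    pointwise : ∀ y → 2ℚ * m * Δ (suc q) (E n (suc r)) y + (2ℚ * m * (s + y + 2ℚ * fromℕ q) * h (y + fromℕ (suc q))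
                 + 2ℚ * m * (s - y + 2ℚ * fromℕ q) * h (y - fromℕ (suc q))
                 - 4ℚ * (e (y + fromℕ q) - e (y - fromℕ q)))
                ≡ 2ℚ * fromℕ n * Δ (suc (suc q)) e y
    pointwise y = trans
      (cong (λ w → 2ℚ * m * Δ (suc q) (E n (suc r)) y + (2ℚ * m * (s + y + 2ℚ * fromℕ q) * h (y + fromℕ (suc q))
                 + 2ℚ * m * (s - y + 2ℚ * fromℕ q) * h (y - fromℕ (suc q)) - 4ℚ * w))
        (cong₂ _-_
          (trans (cong e (trans (arg₁ y (fromℕ q)) (cong (λ w → y + w - 1ℚ) (sym (fromℕ-suc q))))) (E-bottom n r (y + fromℕ (suc q))))
          (trans (cong e (trans (arg₂ y (fromℕ q)) (cong (λ w → y - w + 1ℚ) (sym (fromℕ-suc q))))) (E-top n r (y - fromℕ (suc q))))))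
      (trans (alg {fromℕ n} {fromℕ q} {s} n-eq {fromℕ (suc q)} (fromℕ-suc q) y (h (y + fromℕ (suc q))) (h (y - fromℕ (suc q))) (E n (suc r) (y + fromℕ (suc q))) (E n (suc r) (y - fromℕ (suc q))))
      (cong (2ℚ * fromℕ n *_) (sym (cong₂ _-_
          (trans (cong e (trans (cong (y +_) (fromℕ-suc (suc q))) (arg₃ y (fromℕ (suc q))))) (E-top n r (y + fromℕ (suc q))))
          (trans (cong e (trans (cong (λ w → y - w) (fromℕ-suc (suc q))) (arg₄ y (fromℕ (suc q))))) (E-bottom n r (y - fromℕ (suc q))))))))

  module _ {h h′ : ℚ → ℚ} {c : ℚ} (eq : ∀ z → h (z + 1ℚ) - h (z - 1ℚ) ≡ c * (h′ (z + 1ℚ) - h′ (z - 1ℚ))) where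

    private
      k : ℚ → ℚ
      k z = h z - c * h′ z

      k-step : ∀ z → k (z + 1ℚ) ≡ k (z - 1ℚ)
      k-step z = trans (lemma (h (z + 1ℚ)) (h (z - 1ℚ)) c (h′ (z + 1ℚ)) (h′ (z - 1ℚ)))
        (trans (cong (λ w → k (z - 1ℚ) + (w - c * (h′ (z + 1ℚ) - h′ (z - 1ℚ)))) (eq z))
               (lemma′ (k (z - 1ℚ)) (c * (h′ (z + 1ℚ) - h′ (z - 1ℚ)))))
        where
        lemma : ∀ u v c u′ v′ → u - c * u′ ≡ v - c * v′ + (u - v - c * (u′ - v′))
        lemma = solve-∀ ℚ-ring
        lemma′ : ∀ a b → a + (b - b) ≡ a
        lemma′ = solve-∀ ℚ-ring

      k-Δ : ∀ b y → k (y + fromℕ b) ≡ k (y - fromℕ b)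
      k-Δ zero    y = refl
      k-Δ (suc b) y = begin
        k (y + fromℕ (suc b))           ≡⟨ cong k (trans (cong (y +_) (fromℕ-suc b)) (arg₁ y (fromℕ b))) ⟩
        k (y + 1ℚ + fromℕ b)            ≡⟨ k-Δ b (y + 1ℚ) ⟩
        k (y + 1ℚ - fromℕ b)            ≡⟨ cong k (arg₂ y (fromℕ b)) ⟩
        k (y - fromℕ b + 1ℚ)            ≡⟨ k-step (y - fromℕ b) ⟩
        k (y - fromℕ b - 1ℚ)            ≡⟨ cong k (trans (arg₃ y (fromℕ b)) (cong (λ w → y - w) (sym (fromℕ-suc b)))) ⟩
        k (y - fromℕ (suc b))           ∎
        where
        arg₁ : ∀ y b → y + (1ℚ + b) ≡ y + 1ℚ + b
        arg₁ = solve-∀ ℚ-ring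
        arg₂ : ∀ y b → y + 1ℚ - b ≡ y - b + 1ℚ
        arg₂ = solve-∀ ℚ-ring
        arg₃ : ∀ y b → y - b - 1ℚ ≡ y - (1ℚ + b)
        arg₃ = solve-∀ ℚ-ring

    -- `h - c h′` has vanishing unit differences, hence period 2, and is annihilated by every `Δ b`.
    -- At least one part is required for this.
    D-unit : ∀ b L → D (b ∷ L) h ≡ c * D (b ∷ L) h′
    D-unit b L = trans (D-cong L pointwise) (D-* L c (Δ b h′))
      where
      lemma : ∀ u v c u′ v′ → u - v ≡ c * (u′ - v′) + (u - c * u′ - (v - c * v′))
      lemma = solve-∀ ℚ-ring
      lemma′ : ∀ a b → a + (b - b) ≡ a
      lemma′ = solve-∀ ℚ-ring
      pointwise : ∀ y → Δ b h y ≡ c * Δ b h′ y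
      pointwise y = trans (lemma (h (y + fromℕ b)) (h (y - fromℕ b)) c (h′ (y + fromℕ b)) (h′ (y - fromℕ b)))
        (trans (cong (λ w → c * Δ b h′ y + (w - k (y - fromℕ b))) (k-Δ b y)) (lemma′ (c * Δ b h′ y) (k (y - fromℕ b))))

-- Cycle decompositions as lists of lists, and how transpositions change them.

module CycleLists where

  open import Data.List using (map)
  open import Data.List.Relation.Unary.All using (All)
  open Sums
  open Differences
  open CutAndJoin

  private
    variable
      A B : Set
      d : ℕ
      xs ys zs : List A

  sort-≡ : ∀ {xs ys} → xs ↭ ys → sort xs ≡ sort ys
  sort-≡ Perm.refl         = refl
  sort-≡ (Perm.prep x p)   = cong (insert x) (sort-≡ p)
  sort-≡ (Perm.swap {xs} x y p) = trans (Pointwise-≡⇒≡ (insert-swap x y (sort xs)))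
                                        (cong (insert y ∘ insert x) (sort-≡ p))
  sort-≡ (Perm.trans p q)  = trans (sort-≡ p) (sort-≡ q)

  sort-≡⁻ : ∀ {xs ys} → sort xs ≡ sort ys → xs ↭ ys
  sort-≡⁻ {xs} {ys} eq = ↭-trans (↭-sym (sort-↭ xs)) (↭-trans (↭-reflexive eq) (sort-↭ ys))

  Unique-resp-↭ : xs ↭ ys → Unique xs → Unique ys
  Unique-resp-↭ = PermSetoid.Unique-resp-↭ (setoid _) ∘ ↭⇒↭ₛ

  Unique-++-disjoint : ∀ {x : A} xs {ys} → Unique (xs ++ ys) → x ∈ xs → x ∉ ys
  Unique-++-disjoint (x ∷ xs) (x∉ ∷ u) (here refl) y∈ = All.lookup (All.++⁻ʳ xs x∉) y∈ refl
  Unique-++-disjoint (x ∷ xs) (x∉ ∷ u) (there x∈) y∈ = Unique-++-disjoint xs u x∈ y∈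

  Unique-++ˡ : ∀ (xs : List A) {ys} → Unique (xs ++ ys) → Unique xs
  Unique-++ˡ []       u        = []
  Unique-++ˡ (x ∷ xs) (x∉ ∷ u) = All.++⁻ˡ xs x∉ ∷ Unique-++ˡ xs u

  concat-↭ : {xss yss : List (List A)} → xss ↭ yss → concat xss ↭ concat yss
  concat-↭ Perm.refl            = ↭-refl
  concat-↭ (Perm.prep xs p)     = ++⁺ ↭-refl (concat-↭ p)
  concat-↭ (Perm.swap xs ys p) =
    ↭-trans (shifts xs ys) (++⁺ (↭-refl {x = ys}) (++⁺ (↭-refl {x = xs}) (concat-↭ p)))
  concat-↭ (Perm.trans p q)     = ↭-trans (concat-↭ p) (concat-↭ q)

  ∈-↭ : ∀ {x : A} {xs} → x ∈ xs → ∃ λ ys → xs ↭ x ∷ ys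
  ∈-↭ {x = x} x∈ with ∈-∃++ x∈
  ... | ys , zs , refl = ys ++ zs , shift x ys zs

  filter-singleton : ∀ {P : Pred A 0ℓ} (P? : Decidable P) {xs m} → Unique xs →
    m ∈ xs → P m → (∀ {x} → x ∈ xs → P x → x ≡ m) → filter P? xs ≡ [ m ]
  filter-singleton P? {x ∷ xs} (x∉ ∷ u) (here refl) Pm only =
    trans (List.filter-accept P? Pm) (cong (x ∷_) (List.filter-none P?
      (All.tabulate λ y∈ Py → All.lookup x∉ y∈ (sym (only (there y∈) Py)))))
  filter-singleton P? {x ∷ xs} (x∉ ∷ u) (there m∈) Pm only =
    trans (List.filter-reject P? (λ Px → All.lookup x∉ m∈ (only (here refl) Px)))
          (filter-singleton P? u m∈ Pm (only ∘ there))

  minimum : ∀ (x : Fin d) xs → ∃ λ m → m ∈ x ∷ xs × ∀ {y} → y ∈ x ∷ xs → m Fin.≤ y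
  minimum x [] = x , here refl , λ { (here refl) → Fin.≤-refl }
  minimum x (y ∷ ys) with minimum y ys
  ... | m , m∈ , m≤ with Fin.≤-total x m
  ...   | inj₁ x≤m = x , here refl , λ { (here refl) → Fin.≤-refl ; (there z∈) → Fin.≤-trans x≤m (m≤ z∈) }
  ...   | inj₂ m≤x = m , there m∈ , λ { (here refl) → m≤x ; (there z∈) → m≤ z∈ }

  -- Cycles as lists: f sends each entry to the next one and the last to the first.

  Path : (A → A) → A → List A → A → Set
  Path f x []       z = f x ≡ z
  Path f x (y ∷ ys) z = f x ≡ y × Path f y ys z

  IsCycle : (A → A) → List A → Set
  IsCycle f []       = ⊥
  IsCycle f (x ∷ xs) = Path f x xs x

  -- A decomposition up to the order of the cycles and their starting points, so that cutting and
  -- joining become operations on lists. `covers` expresses disjointness and exhaustion together; as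
  -- `IsCycle` excludes empty cycles, the lengths are determined up to order.
  record Cycles {d} (π : Permutation′ d) (L : List (List (Fin d))) : Set where
    constructor mk
    field
      covers : concat L ↭ allFin d
      cycles : All (IsCycle (π ⟨$⟩ʳ_)) L

  open Cycles

  private
    variable
      f f′ : A → A

  Path-cong : ∀ {x x′ z} ys → f′ x′ ≡ f x → (∀ {y} → y ∈ ys → f′ y ≡ f y) →
              Path f x ys z → Path {A} f′ x′ ys z
  Path-cong []       eq eqs p       = trans eq p
  Path-cong (y ∷ ys) eq eqs (p , q) = trans eq p , Path-cong ys (eqs (here refl)) (eqs ∘ there) q

  Path-++ : ∀ {x y z} ys {zs} → Path f x ys y → Path f y zs z → Path {A} f x (ys ++ y ∷ zs) z
  Path-++ []       p       q = p , q
  Path-++ (_ ∷ ys) (p , r) q = p , Path-++ ys r q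

  Path-split : ∀ {x y z} ys {zs} → Path {A} f x (ys ++ y ∷ zs) z → Path f x ys y × Path f y zs z
  Path-split []       (p , q) = p , q
  Path-split (_ ∷ ys) (p , q) = let r , s = Path-split ys q in (p , r) , s

  Path-map : ∀ {g : B → B} (h : A → B) → (∀ x → g (h x) ≡ h (f x)) →
             ∀ {x z} ys → Path f x ys z → Path g (h x) (map h ys) (h z)
  Path-map h eq {x} []       p       = trans (eq x) (cong h p)
  Path-map h eq {x} (y ∷ ys) (p , q) = trans (eq x) (cong h p) , Path-map h eq ys q

  rotate : ∀ {i : A} {C} → i ∈ C → IsCycle f C → ∃ λ xs → IsCycle f (i ∷ xs) × i ∷ xs ↭ C
  rotate {C = x ∷ xs} (here refl) c = xs , c , ↭-refl
  rotate {i = i} {C = x ∷ xs} (there i∈) c with ∈-∃++ i∈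
  ... | ys , zs , refl = zs ++ x ∷ ys , Path-++ zs (proj₂ (Path-split ys c)) (proj₁ (Path-split ys c))
                       , ++-comm (i ∷ zs) (x ∷ ys)

  IsCycle-closed : ∀ {C} {i : A} → IsCycle f C → i ∈ C → f i ∈ C
  IsCycle-closed c i∈ with rotate i∈ c
  ... | []     , p     , perm = ∈-resp-↭ perm (here p)
  ... | x ∷ xs , (p , _) , perm = ∈-resp-↭ perm (there (here p))

  -- The bound on `k` is there because `SameCycle` admits only exponents below `d`.
  Path-reach : ∀ {x z j} ys → Path {A} f x ys z → j ∈ x ∷ ys →
               ∃ λ k → k ℕ.≤ length ys × iterate f x k ≡ j
  Path-reach ys       p          (here refl) = 0 , ℕ.z≤n , refl
  Path-reach (y ∷ ys) (refl , p) (there j∈)  = let k , k≤ , eq = Path-reach ys p j∈ in suc k , ℕ.s≤s k≤ , eq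

  module _ {π : Permutation′ d} where

    Cycles-resp-↭ : ∀ {L L′} → L ↭ L′ → Cycles π L → Cycles π L′
    Cycles-resp-↭ p c = mk (↭-trans (concat-↭ (↭-sym p)) (covers c)) (All-resp-↭ p (cycles c))

    Cycles-unique : ∀ {L} → Cycles π L → Unique (concat L)
    Cycles-unique c = Unique-resp-↭ (↭-sym (covers c)) (Unique.allFin⁺ d)

    Cycles-rotate : ∀ {C R i} → Cycles π (C ∷ R) → i ∈ C →
                    ∃ λ xs → Cycles π ((i ∷ xs) ∷ R) × i ∷ xs ↭ C
    Cycles-rotate c i∈ with cycles c
    ... | p ∷ ps with rotate i∈ p
    ...   | xs , q , perm = xs , mk (↭-trans (++⁺ perm ↭-refl) (covers c)) (q ∷ ps) , perm

    Cycles-focus : ∀ {L} → Cycles π L → ∀ i → ∃₂ λ xs R → Cycles π ((i ∷ xs) ∷ R)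
    Cycles-focus {L} c i with ∈-concat⁻′ L (∈-resp-↭ (↭-sym (covers c)) (∈-allFin i))
    ... | C , i∈ , C∈ with ∈-↭ C∈
    ...   | R , perm with Cycles-rotate (Cycles-resp-↭ perm c) i∈
    ...     | xs , c′ , _ = xs , R , c′

    module _ {C R} (c : Cycles π (C ∷ R)) where

      private
        C-cycle : IsCycle (π ⟨$⟩ʳ_) C
        C-cycle = All.head (cycles c)

      SameCycle⇒∈ : ∀ {i j} → i ∈ C → SameCycle π i j → j ∈ C
      SameCycle⇒∈ {i} i∈ (k , eq) = subst (_∈ C) eq (iterate-∈ (toℕ k) i∈)
        where
        iterate-∈ : ∀ k {i} → i ∈ C → iterate (π ⟨$⟩ʳ_) i k ∈ C
        iterate-∈ zero    i∈ = i∈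
        iterate-∈ (suc k) i∈ = iterate-∈ k (IsCycle-closed C-cycle i∈)

      ∈⇒SameCycle : ∀ {i j} → i ∈ C → j ∈ C → SameCycle π i j
      ∈⇒SameCycle {i} i∈ j∈ with Cycles-rotate c i∈
      ... | xs , c′ , perm with Path-reach xs (All.head (cycles c′)) (∈-resp-↭ (↭-sym perm) j∈)
      ...   | k , k≤ , eq = fromℕ< k<d , trans (cong (iterate (π ⟨$⟩ʳ_) i) (Fin.toℕ-fromℕ< k<d)) eq
        where
        k<d : k ℕ.< d
        k<d = ℕ.≤-trans (ℕ.s≤s k≤) (ℕ.≤-trans (ℕ.m≤m+n _ _)
          (ℕ.≤-reflexive (trans (sym (List.length-++ (i ∷ xs))) (trans (↭-length (covers c′)) (List.length-tabulate {n = d} id)))))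

      cycleLength-≡ : ∀ {i} → i ∈ C → cycleLength π i ≡ length C
      cycleLength-≡ {i} i∈ = trans
        (↭-length (filter-↭ (sameCycle? π i) (↭-sym (covers c))))
        (cong length (trans (List.filter-++ (sameCycle? π i) C (concat R))
          (trans (cong₂ _++_
            (List.filter-all (sameCycle? π i) (All.tabulate (∈⇒SameCycle i∈)))
            (List.filter-none (sameCycle? π i) (All.tabulate λ j∈ same →
              Unique-++-disjoint C (Cycles-unique c) (SameCycle⇒∈ i∈ same) j∈)))
          (List.++-identityʳ C))))

    -- For points of `C`, lying on the same cycle means membership in `C`, so the test singles out
    -- the least entry of `C`.
    minima-≡ : ∀ {C R} → Cycles π (C ∷ R) →
               map (cycleLength π) (filter (isCycleMinimum? π) C) ≡ [ length C ]
    minima-≡ {[]} c = ⊥-elim (All.head (cycles c))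
    minima-≡ {C@(x ∷ xs)} c with minimum x xs
    ... | m , m∈ , m≤ = trans
      (cong (map (cycleLength π)) (filter-singleton (isCycleMinimum? π)
        (Unique-++ˡ C (Cycles-unique c)) m∈
        (λ j same → m≤ (SameCycle⇒∈ c m∈ same))
        (λ {y} y∈ min → Fin.≤-antisym (min m (∈⇒SameCycle c y∈ m∈)) (m≤ y∈))))
      (cong [_] (cycleLength-≡ c m∈))

    cycleType-≡ : ∀ {L} → Cycles π L → cycleType π ≡ sort (map length L)
    cycleType-≡ {L} c = sort-≡ (↭-trans
      (map⁺ (cycleLength π) (filter-↭ (isCycleMinimum? π) (↭-sym (covers c))))
      (↭-reflexive (go L (All.tabulate λ C∈ → minima-≡ (Cycles-resp-↭ (proj₂ (∈-↭ C∈)) c)))))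
      where
      go : ∀ Ls → All (λ C → map (cycleLength π) (filter (isCycleMinimum? π) C) ≡ [ length C ]) Ls →
           map (cycleLength π) (filter (isCycleMinimum? π) (concat Ls)) ≡ map length Ls
      go []       []         = refl
      go (C ∷ Ls) (eq ∷ eqs) = trans
        (cong (map (cycleLength π)) (List.filter-++ (isCycleMinimum? π) C (concat Ls)))
        (trans (List.map-++ (cycleLength π) (filter (isCycleMinimum? π) C) _)
        (cong₂ _++_ eq (go Ls eqs)))

    cycleType-↭ : ∀ {L} → Cycles π L → cycleType π ↭ map length L
    cycleType-↭ {L} c = ↭-trans (↭-reflexive (cycleType-≡ c)) (sort-↭ (map length L))

  Cycles-resp-≈ : ∀ {π ρ : Permutation′ d} {L} → π ≈ₚ ρ → Cycles π L → Cycles ρ L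
  Cycles-resp-≈ {L = L} eq c = mk (covers c) (All.map (λ {C} → conv C) (cycles c))
    where
    conv : ∀ C → IsCycle _ C → IsCycle _ C
    conv (x ∷ xs) = Path-cong xs (sym (eq x)) (λ _ → sym (eq _))

  transpose-fst : ∀ (i j : Fin d) → transpose i j ⟨$⟩ʳ i ≡ j
  transpose-fst i j with i Fin.≟ i
  ... | yes _  = refl
  ... | no i≢i = contradiction refl i≢i

  transpose-snd : ∀ (i j : Fin d) → transpose i j ⟨$⟩ʳ j ≡ i
  transpose-snd i j with j Fin.≟ i
  ... | yes j≡i = j≡i
  ... | no _ with j Fin.≟ j
  ...   | yes _  = refl
  ...   | no j≢j = contradiction refl j≢j

  transpose-other : ∀ {i j k : Fin d} → k ≢ i → k ≢ j → transpose i j ⟨$⟩ʳ k ≡ k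
  transpose-other {i = i} {j} {k} k≢i k≢j with k Fin.≟ i
  ... | yes k≡i = contradiction k≡i k≢i
  ... | no _ with k Fin.≟ j
  ...   | yes k≡j = contradiction k≡j k≢j
  ...   | no _    = refl

  transpose-involutive : ∀ (i j k : Fin d) → transpose i j ⟨$⟩ʳ (transpose i j ⟨$⟩ʳ k) ≡ k
  transpose-involutive i j k = go (k Fin.≟ i) (k Fin.≟ j)
    where
    go : Dec (k ≡ i) → Dec (k ≡ j) → transpose i j ⟨$⟩ʳ (transpose i j ⟨$⟩ʳ k) ≡ k
    go (yes refl) _          = trans (cong (transpose i j ⟨$⟩ʳ_) (transpose-fst i j)) (transpose-snd i j)
    go (no _)     (yes refl) = trans (cong (transpose i j ⟨$⟩ʳ_) (transpose-snd i j)) (transpose-fst i j)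
    go (no k≢i)   (no k≢j)   = trans (cong (transpose i j ⟨$⟩ʳ_) (transpose-other k≢i k≢j)) (transpose-other k≢i k≢j)

  transpose-id : ∀ (i k : Fin d) → transpose i i ⟨$⟩ʳ k ≡ k
  transpose-id i k with k Fin.≟ i
  ... | yes refl = refl
  ... | no k≢i with k Fin.≟ i
  ...   | yes k≡i = contradiction k≡i k≢i
  ...   | no _    = refl

  private
    ↭-cut : ∀ (i j : A) ys zs K → (i ∷ ys ++ j ∷ zs) ++ K ↭ i ∷ j ∷ ys ++ zs ++ K
    ↭-cut i j ys zs K = Perm.prep i (↭-trans (↭-reflexive (List.++-assoc ys (j ∷ zs) K)) (shift j ys (zs ++ K)))

    ↭-join : ∀ (i j : A) ys zs K → (i ∷ zs) ++ (j ∷ ys) ++ K ↭ i ∷ j ∷ ys ++ zs ++ K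
    ↭-join i j ys zs K = Perm.prep i (↭-trans (shift j zs (ys ++ K)) (Perm.prep j (shifts zs ys)))

    avoid : ∀ {i j : A} {M} → Unique (i ∷ j ∷ M) → ∀ {k} → k ∈ M → k ≢ i × k ≢ j
    avoid ((_ ∷ i∉) ∷ (j∉ ∷ _)) k∈ = All.lookup i∉ k∈ ∘ sym , All.lookup j∉ k∈ ∘ sym

    -- Precomposing with the transposition only exchanges the images of `i` and `j`. The arcs `ys`
    -- and `zs` survive and merely change their starting points, which covers cutting and joining
    -- alike.
    module Swap (π : Permutation′ d) {i j : Fin d} {ys zs R} (u : Unique (i ∷ j ∷ ys ++ zs ++ concat R)) where

      π′ : Permutation′ d
      π′ = transpose i j ∘ₚ π

      other : ∀ {k} → k ∈ ys ++ zs ++ concat R → π′ ⟨$⟩ʳ k ≡ π ⟨$⟩ʳ k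
      other k∈ = cong (π ⟨$⟩ʳ_) (transpose-other (proj₁ (avoid u k∈)) (proj₂ (avoid u k∈)))

      from-i : ∀ {y} → Path (π ⟨$⟩ʳ_) i ys y → Path (π′ ⟨$⟩ʳ_) j ys y
      from-i = Path-cong ys (cong (π ⟨$⟩ʳ_) (transpose-snd i j)) (other ∘ ∈-++⁺ˡ)

      from-j : ∀ {y} → Path (π ⟨$⟩ʳ_) j ys y → Path (π′ ⟨$⟩ʳ_) i ys y
      from-j = Path-cong ys (cong (π ⟨$⟩ʳ_) (transpose-fst i j)) (other ∘ ∈-++⁺ˡ)

      from-i′ : ∀ {y} → Path (π ⟨$⟩ʳ_) i zs y → Path (π′ ⟨$⟩ʳ_) j zs y
      from-i′ = Path-cong zs (cong (π ⟨$⟩ʳ_) (transpose-snd i j)) (other ∘ ∈-++⁺ʳ ys ∘ ∈-++⁺ˡ)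

      from-j′ : ∀ {y} → Path (π ⟨$⟩ʳ_) j zs y → Path (π′ ⟨$⟩ʳ_) i zs y
      from-j′ = Path-cong zs (cong (π ⟨$⟩ʳ_) (transpose-fst i j)) (other ∘ ∈-++⁺ʳ ys ∘ ∈-++⁺ˡ)

      rest : All (IsCycle (π ⟨$⟩ʳ_)) R → All (IsCycle (π′ ⟨$⟩ʳ_)) R
      rest cs = go R cs (other ∘ ∈-++⁺ʳ ys ∘ ∈-++⁺ʳ zs)
        where
        go : ∀ Ls → All (IsCycle (π ⟨$⟩ʳ_)) Ls → (∀ {k} → k ∈ concat Ls → π′ ⟨$⟩ʳ k ≡ π ⟨$⟩ʳ k) →
             All (IsCycle (π′ ⟨$⟩ʳ_)) Ls
        go []               []       eq = []
        go ((x ∷ xs) ∷ Ls)  (c ∷ cs) eq = Path-cong xs (eq (here refl)) (eq ∘ there ∘ ∈-++⁺ˡ) c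
                                         ∷ go Ls cs (eq ∘ ∈-++⁺ʳ (x ∷ xs))

  module _ {π : Permutation′ d} {i j : Fin d} where

    Cycles-cut : ∀ {ys zs R} → Cycles π ((i ∷ ys ++ j ∷ zs) ∷ R) →
                 Cycles (transpose i j ∘ₚ π) ((i ∷ zs) ∷ (j ∷ ys) ∷ R)
    Cycles-cut {ys} {zs} {R} c with cycles c
    ... | p ∷ ps = mk
      (↭-trans (↭-join i j ys zs (concat R)) (↭-trans (↭-sym perm) (covers c)))
      (from-j′ (proj₂ (Path-split ys p)) ∷ from-i (proj₁ (Path-split ys p)) ∷ rest ps)
      where
      perm = ↭-cut i j ys zs (concat R)
      open Swap π {i} {j} {ys} {zs} {R} (Unique-resp-↭ perm (Cycles-unique c))

    Cycles-join : ∀ {ys zs R} → Cycles π ((i ∷ zs) ∷ (j ∷ ys) ∷ R) →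
                  Cycles (transpose i j ∘ₚ π) ((i ∷ ys ++ j ∷ zs) ∷ R)
    Cycles-join {ys} {zs} {R} c with cycles c
    ... | p ∷ q ∷ ps = mk
      (↭-trans (↭-cut i j ys zs (concat R)) (↭-trans (↭-sym perm) (covers c)))
      (Path-++ ys (from-j q) (from-i′ p) ∷ rest ps)
      where
      perm = ↭-join i j ys zs (concat R)
      open Swap π {i} {j} {ys} {zs} {R} (Unique-resp-↭ perm (Cycles-unique c))

  -- Every permutation arises from one of Fin d by adjoining a fixed point 0 and,
  -- possibly, inserting 0 before some point of a cycle.

  Cycles-lift : ∀ {π : Permutation′ d} {L} → Cycles π L → Cycles (lift₀ π) ([ zero ] ∷ map (map suc) L)
  Cycles-lift {d} {π} {L} c = mk
    (Perm.prep zero (↭-trans (↭-reflexive (List.concat-map L)) (↭-trans (map⁺ suc (covers c))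
      (↭-reflexive (List.map-tabulate id suc)))))
    (refl ∷ All.map⁺ (All.map (λ {C} → lift C) (cycles c)))
    where
    lift : ∀ C → IsCycle (π ⟨$⟩ʳ_) C → IsCycle (lift₀ π ⟨$⟩ʳ_) (map suc C)
    lift (x ∷ xs) = Path-map suc (λ _ → refl) xs

  map-length-suc : ∀ (L : List (List (Fin d))) → map length (map (map Fin.suc) L) ≡ map length L
  map-length-suc []      = refl
  map-length-suc (C ∷ L) = cong₂ _∷_ (List.length-map suc C) (map-length-suc L)

  Cycles-insert : ∀ {π : Permutation′ d} {i xs R} → Cycles π ((i ∷ xs) ∷ R) →
    Cycles (transpose zero (suc i) ∘ₚ lift₀ π) ((zero ∷ map suc xs ++ [ suc i ]) ∷ map (map suc) R)
  Cycles-insert c = Cycles-join (Cycles-lift c)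

  cycleType-lift : ∀ {π : Permutation′ d} {L} → Cycles π L → cycleType (lift₀ π) ↭ 1 ∷ map length L
  cycleType-lift {L = L} c = ↭-trans (cycleType-↭ (Cycles-lift c)) (↭-reflexive (cong (1 ∷_) (map-length-suc L)))

  cycleType-insert : ∀ {π : Permutation′ d} {i xs R} → Cycles π ((i ∷ xs) ∷ R) →
    cycleType (transpose zero (suc i) ∘ₚ lift₀ π) ↭ suc (suc (length xs)) ∷ map length R
  cycleType-insert {xs = xs} {R} c = ↭-trans (cycleType-↭ (Cycles-insert c)) (↭-reflexive (cong₂ _∷_
    (cong suc (trans (List.length-++ (map suc xs)) (trans (ℕ.+-comm _ 1) (cong suc (List.length-map suc xs)))))
    (map-length-suc R)))

  unlift : ∀ (π : Permutation′ (suc d)) → ∃₂ λ i ρ → transpose zero i ∘ₚ lift₀ ρ ≈ₚ π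
  unlift π = i , ρ , λ k → trans (lift₀-remove (transpose zero i ∘ₚ π) fix (transpose zero i ⟨$⟩ʳ k))
                                  (cong (π ⟨$⟩ʳ_) (transpose-involutive zero i k))
    where
    -- Composing with the transposition of `zero` and its preimage makes `zero` a fixed point, which
    -- can then be removed.
    i = π ⟨$⟩ˡ zero
    ρ = remove zero (transpose zero i ∘ₚ π)
    fix : transpose zero i ∘ₚ π ⟨$⟩ʳ zero ≡ zero
    fix = trans (cong (π ⟨$⟩ʳ_) (transpose-fst zero i)) (inverseʳ π)
  -- Induction on `d` through `unlift` builds the cycles by insertion, so no orbit has to be
  -- followed until it closes.
  cycles-exist : ∀ (π : Permutation′ d) → ∃ (Cycles π)
  cycles-exist {zero}  π = [] , mk ↭-refl []
  cycles-exist {suc d} π with unlift π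
  ... | zero , ρ , eq = let L , c = cycles-exist ρ in
    _ , Cycles-resp-≈ (λ k → trans (sym (cong (lift₀ ρ ⟨$⟩ʳ_) (transpose-id zero k))) (eq k)) (Cycles-lift c)
  ... | suc i , ρ , eq = let L , c = cycles-exist ρ ; xs , R , c′ = Cycles-focus c i in
    _ , Cycles-resp-≈ eq (Cycles-insert c′)

  cycleType-cong : ∀ {π ρ : Permutation′ d} → π ≈ₚ ρ → cycleType π ≡ cycleType ρ
  cycleType-cong {π = π} {ρ} eq = let L , c = cycles-exist π in
    trans (cycleType-≡ c) (sym (cycleType-≡ (Cycles-resp-≈ {ρ = ρ} eq c)))

-- Changes of variable in sums over permutations; the operator of all transpositions.

module PermutationSums where

  open import Data.List using (map)
  open import Data.Nat.ListAction using (sum)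
  open import Data.List.Relation.Unary.All using (All)
  open import Data.Rational using (_+_; _*_; _-_)
  open import Data.Rational.Properties
  open Sums
  open Differences
  open CutAndJoin
  open CycleLists

  open Cycles

  private
    variable
      A : Set
      d : ℕ

  ∑-picks-proj₁ : ∀ (xs : List A) (f : A → ℚ) → ∑ (picks xs) (f ∘ proj₁) ≡ ∑ xs f
  ∑-picks-proj₁ []       f = refl
  ∑-picks-proj₁ (x ∷ xs) f = trans (∑-picks-∷ x xs (f ∘ proj₁)) (cong (f x +_) (∑-picks-proj₁ xs f))

  ∑-picks-map : ∀ {B : Set} (h : A → B) xs (f : B × List B → ℚ) →
                ∑ (picks (map h xs)) f ≡ ∑ (picks xs) (λ (x , R) → f (h x , map h R))
  ∑-picks-map h []       f = refl
  ∑-picks-map h (x ∷ xs) f = trans (∑-picks-∷ (h x) (map h xs) f)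
    (trans (cong (f (h x , map h xs) +_) (∑-picks-map h xs _))
           (sym (∑-picks-∷ x xs (λ (x , R) → f (h x , map h R)))))

  -- A sum over points becomes a sum over cycles when the summand depends only on the cycle lengths;
  -- the weight `fromℕ b` is the number of points in the chosen cycle.
  ∑-blocks : ∀ (L : List (List A)) (g : A → ℚ) (φ : ℕ → List ℕ → ℚ) →
    (∀ {C R} → C ∷ R ↭ L → ∀ {j} → j ∈ C → g j ≡ φ (length C) (map length R)) →
    ∑ (concat L) g ≡ ∑ (picks (map length L)) (λ (b , R) → fromℕ b * φ b R)
  ∑-blocks L g φ eq = begin
    ∑ (concat L) g
      ≡⟨ trans (∑-concat L g) (sym (∑-picks-proj₁ L (λ C → ∑ C g))) ⟩
    ∑ (picks L) (λ (C , R) → ∑ C g)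
      ≡⟨ ∑-cong∈ (picks L) (λ {(C , R)} p → trans (∑-cong∈ C (eq (picks-↭ p))) (∑-const C (φ (length C) (map length R)))) ⟩
    ∑ (picks L) (λ (C , R) → fromℕ (length C) * φ (length C) (map length R))
      ≡⟨ ∑-picks-map length L (λ (b , R) → fromℕ b * φ b R) ⟨
    ∑ (picks (map length L)) (λ (b , R) → fromℕ b * φ b R) ∎
    where open ≡-Reasoning

  ∑-cycles : ∀ {π : Permutation′ d} {L} → Cycles π L → (g : Fin d → ℚ) (φ : ℕ → List ℕ → ℚ) →
    (∀ {i xs R} → Cycles π ((i ∷ xs) ∷ R) → g i ≡ φ (suc (length xs)) (map length R)) →
    ∑ (allFin d) g ≡ ∑ (picks (map length L)) (λ (b , R) → fromℕ b * φ b R)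
  ∑-cycles {L = L} c g φ eq = trans (sym (∑-↭ (covers c) g)) (∑-blocks L g φ λ {C} {R} perm i∈ →
    let xs , c′ , rot = Cycles-rotate (Cycles-resp-↭ (↭-sym perm) c) i∈
    in trans (eq c′) (cong (λ b → φ b (map length R)) (↭-length rot)))

  module _ (F : List ℕ → ℚ) (F-↭ : ∀ {L L′} → L ↭ L′ → F L ≡ F L′) where

    F-cycleType : ∀ {π : Permutation′ d} {L} → Cycles π L → F (cycleType π) ≡ F (map length L)
    F-cycleType c = F-↭ (cycleType-↭ c)

    -- `ys` accumulates the points already passed on the way round the cycle from `i`. Transposing
    -- `i` with the next point splits the cycle into lengths `suc (length ys)` and
    -- `suc (length zs)`, the next term of `cut`.
    ∑-cut : ∀ {π : Permutation′ d} {i} ys zs {R} → Cycles π ((i ∷ ys ++ zs) ∷ R) →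
      ∑ zs (λ j → F (cycleType (transpose i j ∘ₚ π)))
      ≡ cut (λ a c → F (a ∷ c ∷ map length R)) (length ys) (length zs)
    ∑-cut ys []       c = refl
    ∑-cut {d} {π} {i} ys (j ∷ zs) {R} c = cong₂ _+_
      (trans (F-cycleType (Cycles-cut c)) (F-↭ (Perm.swap (suc (length zs)) (suc (length ys)) ↭-refl)))
      (trans (∑-cut (ys ++ [ j ]) zs (subst (λ xs → Cycles π ((i ∷ xs) ∷ R)) (sym (List.++-assoc ys [ j ] zs)) c))
             (cong (λ p → cut (λ a c → F (a ∷ c ∷ map length R)) p (length zs))
                   (trans (List.length-++ ys) (ℕ.+-comm (length ys) 1))))

    -- A point `j` on the cycle of `i` cuts this cycle, and any other `j` joins its own cycle to it.
    -- The result depends on `π` only through its cycle lengths.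
    ∑-transpose : ∀ {π : Permutation′ d} {i xs R} → Cycles π ((i ∷ xs) ∷ R) →
      ∑ (allFin d) (λ j → ind (¬? (i Fin.≟ j)) * F (cycleType (transpose i j ∘ₚ π)))
      ≡ cutJoin F (suc (length xs)) (map length R)
    ∑-transpose {d} {π} {i} {xs} {R} c = begin
      ∑ (allFin d) term
        ≡⟨ ∑-↭ (covers c) term ⟨
      term i + ∑ (xs ++ concat R) term
        ≡⟨ trans (cong₂ _+_ term-i (∑-cong∈ (xs ++ concat R) term-j)) (+-identityˡ _) ⟩
      ∑ (xs ++ concat R) value
        ≡⟨ ∑-++ xs (concat R) value ⟩
      ∑ xs value + ∑ (concat R) value
        ≡⟨ cong₂ _+_ (∑-cut [] xs c) (∑-blocks R value (λ b R′ → F ((suc (length xs) ℕ.+ b) ∷ R′)) joined) ⟩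
      cutJoin F (suc (length xs)) (map length R) ∎
      where
      open ≡-Reasoning
      value term : Fin d → ℚ
      value j = F (cycleType (transpose i j ∘ₚ π))
      term j = ind (¬? (i Fin.≟ j)) * value j
      i∉ : All (i ≢_) (xs ++ concat R)
      i∉ with Cycles-unique c
      ... | i∉ ∷ _ = i∉
      term-i : term i ≡ 0ℚ
      term-i = trans (cong (_* value i) (ind-no (¬? (i Fin.≟ i)) (λ i≢i → i≢i refl))) (*-zeroˡ (value i))
      term-j : ∀ {j} → j ∈ xs ++ concat R → term j ≡ value j
      term-j {j} j∈ = trans (cong (_* value j) (ind-yes (¬? (i Fin.≟ j)) (All.lookup i∉ j∈))) (*-identityˡ (value j))
      joined : ∀ {C R′} → C ∷ R′ ↭ R → ∀ {j} → j ∈ C → value j ≡ F ((suc (length xs) ℕ.+ length C) ∷ map length R′)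
      joined {C} {R′} perm {j} j∈ with Cycles-rotate (Cycles-resp-↭ (↭-trans (Perm.prep (i ∷ xs) (↭-sym perm)) (Perm.swap (i ∷ xs) C ↭-refl)) c) j∈
      ... | ys , c′ , rot = trans
        (F-cycleType (Cycles-join (Cycles-resp-↭ (Perm.swap (j ∷ ys) (i ∷ xs) ↭-refl) c′)))
        (cong (λ b → F (b ∷ map length R′)) (trans (cong suc (List.length-++ ys))
          (trans (ℕ.+-comm (suc (length ys)) (suc (length xs))) (cong (suc (length xs) ℕ.+_) (↭-length rot)))))

  _≈?_ : (π ρ : Permutation′ d) → Dec (π ≈ₚ ρ)
  π ≈? ρ = Fin.all? λ i → (π ⟨$⟩ʳ i) Fin.≟ (ρ ⟨$⟩ʳ i)

  Respects≈ : (Permutation′ d → A) → Set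
  Respects≈ φ = ∀ {π ρ} → π ≈ₚ ρ → φ π ≡ φ ρ

  ∑-≈? : ∀ (π : Permutation′ d) → ∑ (allPermutations d) (λ ρ → ind (ρ ≈? π)) ≡ 1ℚ
  ∑-≈? {d} π = go (allPermutations d) (allPermutations-distinct d) (allPermutations-complete π)
    where
    vanish : ∀ ρs → All (λ ρ → ¬ ρ ≈ₚ π) ρs → ∑ ρs (λ ρ → ind (ρ ≈? π)) ≡ 0ℚ
    vanish []       []       = refl
    vanish (ρ ∷ ρs) (n ∷ ns) = trans (cong₂ _+_ (ind-no (ρ ≈? π) n) (vanish ρs ns)) (+-identityˡ 0ℚ)
    distinct : ∀ {ρ ρs} → All (λ ρ′ → ¬ ρ ≈ₚ ρ′) ρs → Any (π ≈ₚ_) ρs → ¬ ρ ≈ₚ π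
    distinct (n ∷ ns) (here eq)  eq′ = n (λ i → trans (eq′ i) (eq i))
    distinct {ρ} (n ∷ ns) (there an) eq′ = distinct {ρ} ns an eq′
    go : ∀ ρs → AllPairs (λ π ρ → ¬ π ≈ₚ ρ) ρs → Any (π ≈ₚ_) ρs → ∑ ρs (λ ρ → ind (ρ ≈? π)) ≡ 1ℚ
    go (ρ ∷ ρs) (n ∷ ns) (here eq)  = trans (cong₂ _+_ (ind-yes (ρ ≈? π) (sym ∘ eq))
      (vanish ρs (All.map (λ ¬eq eq′ → ¬eq (λ i → trans (sym (eq i)) (sym (eq′ i)))) n))) (+-identityʳ 1ℚ)
    go (ρ ∷ ρs) (n ∷ ns) (there an) = trans (cong₂ _+_ (ind-no (ρ ≈? π) (distinct {ρ} n an)) (go ρs ns an)) (+-identityˡ 1ℚ)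

  -- A change of variables that needs pointwise equality only: `m π` is the weighted number of
  -- indices whose image is `π`, and the proof inserts an indicator sum equal to 1 and exchanges the
  -- two summations.
  ∑-reindex : ∀ (I : List A) (w : A → ℚ) (f : A → Permutation′ d) (m : Permutation′ d → ℚ) →
    (∀ π → ∑ I (λ a → w a * ind (f a ≈? π)) ≡ m π) →
    ∀ {φ} → Respects≈ φ → ∑ I (λ a → w a * φ (f a)) ≡ ∑ (allPermutations d) (λ π → m π * φ π)
  ∑-reindex {d = d} I w f m count {φ} resp = begin
    ∑ I (λ a → w a * φ (f a))
      ≡⟨ ∑-cong I (λ a → cong (w a *_) (sym (∑-pick {f = φ} (λ π → π ≈? f a) (allPermutations d) (∑-≈? (f a)) resp))) ⟩
    ∑ I (λ a → w a * ∑ (allPermutations d) (λ π → ind (π ≈? f a) * φ π))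
      ≡⟨ ∑-cong I (λ a → *-∑ (w a) (allPermutations d) (λ π → ind (π ≈? f a) * φ π)) ⟩
    ∑ I (λ a → ∑ (allPermutations d) (λ π → w a * (ind (π ≈? f a) * φ π)))
      ≡⟨ ∑-swap I (allPermutations d) (λ a π → w a * (ind (π ≈? f a) * φ π)) ⟩
    ∑ (allPermutations d) (λ π → ∑ I (λ a → w a * (ind (π ≈? f a) * φ π)))
      ≡⟨ ∑-cong (allPermutations d) (λ π → trans (∑-cong I (λ a →
           trans (sym (*-assoc (w a) (ind (π ≈? f a)) (φ π))) (cong (λ z → w a * z * φ π) (ind-cong (π ≈? f a) (f a ≈? π) (sym ∘_) (sym ∘_)))))
           (trans (sym (∑-* I (λ a → w a * ind (f a ≈? π)) (φ π))) (cong (_* φ π) (count π)))) ⟩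
    ∑ (allPermutations d) (λ π → m π * φ π) ∎
    where open ≡-Reasoning

  -- The list of permutations follows one particular enumeration. A summand respecting `≈ₚ` does not
  -- see it, so the sum may run along left or right multiplication by the transpositions moving 0,
  -- whose effect on cycles is known.
  ∑-allPermutations-suc : ∀ (f : Fin (suc d) → Permutation′ d → Permutation′ (suc d)) →
    (∀ π → ∃₂ λ j ρ → f j ρ ≈ₚ π) →
    (∀ {j ρ} → ∀ {k} → ρ ≈ₚ k → f j ρ ≈ₚ f j k) →
    (∀ {j k ρ ρ′} → f j ρ ≈ₚ f k ρ′ → j ≡ k × ρ ≈ₚ ρ′) →
    ∀ {φ : Permutation′ (suc d) → ℚ} → Respects≈ φ →
    ∑ (allPermutations (suc d)) φ ≡ ∑ (allFin (suc d)) (λ j → ∑ (allPermutations d) (λ ρ → φ (f j ρ)))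
  ∑-allPermutations-suc {d} f surj cong-f inj {φ} resp = sym (begin
    ∑ (allFin (suc d)) (λ j → ∑ (allPermutations d) (λ ρ → φ (f j ρ)))
      ≡⟨ ∑-cartesianProductWith _,_ (allFin (suc d)) (allPermutations d) (λ (j , ρ) → φ (f j ρ)) ⟨
    ∑ I (λ (j , ρ) → φ (f j ρ))
      ≡⟨ ∑-cong I (λ (j , ρ) → sym (*-identityˡ (φ (f j ρ)))) ⟩
    ∑ I (λ (j , ρ) → 1ℚ * φ (f j ρ))
      ≡⟨ ∑-reindex I (λ _ → 1ℚ) (λ (j , ρ) → f j ρ) (λ _ → 1ℚ) count resp ⟩
    ∑ (allPermutations (suc d)) (λ π → 1ℚ * φ π)
      ≡⟨ ∑-cong (allPermutations (suc d)) (λ π → *-identityˡ (φ π)) ⟩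
    ∑ (allPermutations (suc d)) φ ∎)
    where
    open ≡-Reasoning
    I = cartesianProduct (allFin (suc d)) (allPermutations d)
    count : ∀ π → ∑ I (λ (j , ρ) → 1ℚ * ind (f j ρ ≈? π)) ≡ 1ℚ
    count π with surj π
    ... | j₀ , ρ₀ , eq₀ = begin
      ∑ I (λ (j , ρ) → 1ℚ * ind (f j ρ ≈? π))
        ≡⟨ ∑-cartesianProductWith _,_ (allFin (suc d)) (allPermutations d) _ ⟩
      ∑ (allFin (suc d)) (λ j → ∑ (allPermutations d) (λ ρ → 1ℚ * ind (f j ρ ≈? π)))
        ≡⟨ ∑-cong (allFin (suc d)) (λ j → ∑-cong (allPermutations d) (λ ρ → trans (*-identityˡ _)
             (trans (ind-cong (f j ρ ≈? π) ((j₀ Fin.≟ j) ×-dec (ρ ≈? ρ₀))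
                      (λ eq → let p , q = inj (λ i → trans (eq i) (sym (eq₀ i))) in sym p , q)
                      (λ { (refl , eq) i → trans (cong-f eq i) (eq₀ i) }))
                    (ind-× (j₀ Fin.≟ j) (ρ ≈? ρ₀))))) ⟩
      ∑ (allFin (suc d)) (λ j → ∑ (allPermutations d) (λ ρ → ind (j₀ Fin.≟ j) * ind (ρ ≈? ρ₀)))
        ≡⟨ ∑-cong (allFin (suc d)) (λ j → trans (sym (*-∑ (ind (j₀ Fin.≟ j)) (allPermutations d) (λ ρ → ind (ρ ≈? ρ₀))))
             (trans (cong (ind (j₀ Fin.≟ j) *_) (∑-≈? ρ₀)) (*-identityʳ (ind (j₀ Fin.≟ j))))) ⟩
      ∑ (allFin (suc d)) (λ j → ind (j₀ Fin.≟ j))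
        ≡⟨ ∑-allFin-≟ j₀ ⟩
      1ℚ ∎

  lift₀-injective : ∀ {π ρ : Permutation′ d} → lift₀ π ≈ₚ lift₀ ρ → π ≈ₚ ρ
  lift₀-injective eq i = Fin.suc-injective (eq (suc i))

  lift₀-resp : ∀ {π ρ : Permutation′ d} → π ≈ₚ ρ → lift₀ π ≈ₚ lift₀ ρ
  lift₀-resp eq zero    = refl
  lift₀-resp eq (suc i) = cong suc (eq i)

  ∑-insertˡ : ∀ {φ : Permutation′ (suc d) → ℚ} → Respects≈ φ → ∑ (allPermutations (suc d)) φ
    ≡ ∑ (allFin (suc d)) (λ j → ∑ (allPermutations d) (λ ρ → φ (transpose zero j ∘ₚ lift₀ ρ)))
  ∑-insertˡ = ∑-allPermutations-suc (λ j ρ → transpose zero j ∘ₚ lift₀ ρ) unlift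
    (λ {j} {ρ} {ρ′} eq i → lift₀-resp {π = ρ} {ρ′} eq (transpose zero j ⟨$⟩ʳ i))
    (λ {j} {k} {ρ} {ρ′} eq → same {j} {k} {ρ} {ρ′} eq (position {j} {k} {ρ} {ρ′} eq))
    where
    position : ∀ {j k ρ ρ′} → transpose zero j ∘ₚ lift₀ ρ ≈ₚ transpose zero k ∘ₚ lift₀ ρ′ → j ≡ k
    position {j} {k} {ρ} {ρ′} eq = begin
      j                                ≡⟨ transpose-fst zero j ⟨
      transpose zero j ⟨$⟩ʳ zero       ≡⟨ cong (transpose zero j ⟨$⟩ʳ_) jk≡0 ⟨
      transpose zero j ⟨$⟩ʳ (transpose zero j ⟨$⟩ʳ k) ≡⟨ transpose-involutive zero j k ⟩
      k                                ∎
      where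
      open ≡-Reasoning
      lift₀≡0 : ∀ {x} → lift₀ ρ ⟨$⟩ʳ x ≡ zero → x ≡ zero
      lift₀≡0 {zero} _ = refl
      jk≡0 : transpose zero j ⟨$⟩ʳ k ≡ zero
      jk≡0 = lift₀≡0 (trans (eq k) (cong (lift₀ ρ′ ⟨$⟩ʳ_) (transpose-snd zero k)))
    same : ∀ {j k ρ ρ′} → transpose zero j ∘ₚ lift₀ ρ ≈ₚ transpose zero k ∘ₚ lift₀ ρ′ → j ≡ k → j ≡ k × ρ ≈ₚ ρ′
    same {j} {ρ = ρ} {ρ′} eq refl = refl , lift₀-injective {π = ρ} {ρ′} (λ i →
      trans (cong (lift₀ ρ ⟨$⟩ʳ_) (sym (transpose-involutive zero j i)))
      (trans (eq (transpose zero j ⟨$⟩ʳ i)) (cong (lift₀ ρ′ ⟨$⟩ʳ_) (transpose-involutive zero j i))))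

  ∑-insertʳ : ∀ {φ : Permutation′ (suc d) → ℚ} → Respects≈ φ → ∑ (allPermutations (suc d)) φ
    ≡ ∑ (allFin (suc d)) (λ j → ∑ (allPermutations d) (λ ρ → φ (lift₀ ρ ∘ₚ transpose zero j)))
  ∑-insertʳ {d} = ∑-allPermutations-suc (λ j ρ → lift₀ ρ ∘ₚ transpose zero j) unliftʳ
    (λ {j} {ρ} {ρ′} eq i → cong (transpose zero j ⟨$⟩ʳ_) (lift₀-resp {π = ρ} {ρ′} eq i))
    (λ {j} {k} {ρ} {ρ′} eq → same {j} {k} {ρ} {ρ′} eq (trans (sym (transpose-fst zero j)) (trans (eq zero) (transpose-fst zero k))))
    where
    unliftʳ : ∀ (π : Permutation′ (suc d)) → ∃₂ λ j ρ → lift₀ ρ ∘ₚ transpose zero j ≈ₚ π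
    unliftʳ π = j , remove zero (π ∘ₚ transpose zero j) , λ i →
      trans (cong (transpose zero j ⟨$⟩ʳ_) (lift₀-remove (π ∘ₚ transpose zero j) (transpose-snd zero j) i))
            (transpose-involutive zero j (π ⟨$⟩ʳ i))
      where j = π ⟨$⟩ʳ zero
    same : ∀ {j k ρ ρ′} → lift₀ ρ ∘ₚ transpose zero j ≈ₚ lift₀ ρ′ ∘ₚ transpose zero k → j ≡ k → j ≡ k × ρ ≈ₚ ρ′
    same {j} {ρ = ρ} {ρ′} eq refl = refl , lift₀-injective {π = ρ} {ρ′} (λ i →
      trans (sym (transpose-involutive zero j (lift₀ ρ ⟨$⟩ʳ i)))
      (trans (cong (transpose zero j ⟨$⟩ʳ_) (eq i)) (transpose-involutive zero j (lift₀ ρ′ ⟨$⟩ʳ i))))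

  T : (Permutation′ d → ℚ) → Permutation′ d → ℚ
  T {d} φ σ = ∑ (allPermutations d) (λ τ → ind (isTransposition? τ) * φ (τ ∘ₚ σ))

  transpose-comm : ∀ (i j k : Fin d) → transpose i j ⟨$⟩ʳ k ≡ transpose j i ⟨$⟩ʳ k
  transpose-comm i j k = go (k Fin.≟ i) (k Fin.≟ j)
    where
    go : Dec (k ≡ i) → Dec (k ≡ j) → transpose i j ⟨$⟩ʳ k ≡ transpose j i ⟨$⟩ʳ k
    go (yes refl) _          = trans (transpose-fst i j) (sym (transpose-snd j i))
    go (no _)     (yes refl) = trans (transpose-snd i j) (sym (transpose-fst j i))
    go (no k≢i)   (no k≢j)   = trans (transpose-other k≢i k≢j) (sym (transpose-other k≢j k≢i))

  transpose-injective : ∀ {i j a b : Fin d} → i ≢ j → transpose i j ≈ₚ transpose a b →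
                        ¬ (a ≡ i × b ≡ j) → ¬ (b ≡ i × a ≡ j) → ∀ {ℓ} {X : Set ℓ} → X
  transpose-injective {i = i} {j} {a} {b} i≢j eq ¬ab ¬ba = ⊥-elim (go (i Fin.≟ a) (i Fin.≟ b))
    where
    j≡ : j ≡ transpose a b ⟨$⟩ʳ i
    j≡ = trans (sym (transpose-fst i j)) (eq i)
    go : Dec (i ≡ a) → Dec (i ≡ b) → _
    go (yes refl) _          = ¬ab (refl , sym (trans j≡ (transpose-fst a b)))
    go (no _)     (yes refl) = ¬ba (refl , sym (trans j≡ (transpose-snd a b)))
    go (no i≢a)   (no i≢b)   = i≢j (sym (trans j≡ (transpose-other i≢a i≢b)))

  -- A transposition comes from exactly two ordered pairs of distinct points.
  ∑-transpose-count : ∀ (π : Permutation′ d) →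
    ∑ (cartesianProduct (allFin d) (allFin d)) (λ (i , j) → ind (¬? (i Fin.≟ j)) * ind (transpose i j ≈? π))
    ≡ 2ℚ * ind (isTransposition? π)
  ∑-transpose-count {d} π = go (isTransposition? π) refl
    where
    open ≡-Reasoning
    I = cartesianProduct (allFin d) (allFin d)
    term : Fin d × Fin d → ℚ
    term (i , j) = ind (¬? (i Fin.≟ j)) * ind (transpose i j ≈? π)
    pair : ∀ (a b : Fin d) → ∑ I (λ (i , j) → ind ((a Fin.≟ i) ×-dec (b Fin.≟ j))) ≡ 1ℚ
    pair a b = begin
      ∑ I (λ (i , j) → ind ((a Fin.≟ i) ×-dec (b Fin.≟ j)))
        ≡⟨ ∑-cartesianProductWith _,_ (allFin d) (allFin d) _ ⟩
      ∑ (allFin d) (λ i → ∑ (allFin d) (λ j → ind ((a Fin.≟ i) ×-dec (b Fin.≟ j))))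
        ≡⟨ ∑-cong (allFin d) (λ i → trans (∑-cong (allFin d) (λ j → ind-× (a Fin.≟ i) (b Fin.≟ j)))
             (trans (sym (*-∑ (ind (a Fin.≟ i)) (allFin d) _)) (trans (cong (ind (a Fin.≟ i) *_) (∑-allFin-≟ b)) (*-identityʳ _)))) ⟩
      ∑ (allFin d) (λ i → ind (a Fin.≟ i))
        ≡⟨ ∑-allFin-≟ a ⟩
      1ℚ ∎
    go : (t? : Dec (IsTransposition π)) → isTransposition? π ≡ t? → ∑ I term ≡ 2ℚ * ind t?
    go (no ¬t) _ = trans (∑-cong I zeroes) (∑-0 I)
      where
      zeroes : ∀ ij → term ij ≡ 0ℚ
      zeroes (i , j) = cases (i Fin.≟ j)
        where
        cases : Dec (i ≡ j) → term (i , j) ≡ 0ℚ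
        cases (yes i≡j) = trans (cong (_* ind (transpose i j ≈? π)) (ind-no (¬? (i Fin.≟ j)) (λ i≢j → i≢j i≡j))) (*-zeroˡ (ind (transpose i j ≈? π)))
        cases (no i≢j)  = trans (cong (ind (¬? (i Fin.≟ j)) *_) (ind-no (transpose i j ≈? π) (λ eq → ¬t (i , j , i≢j , λ k → sym (eq k))))) (*-zeroʳ (ind (¬? (i Fin.≟ j))))
    go (yes (a , b , a≢b , eq)) _ = begin
      ∑ I term
        ≡⟨ ∑-cong I (λ (i , j) → split i j) ⟩
      ∑ I (λ (i , j) → ind ((a Fin.≟ i) ×-dec (b Fin.≟ j)) + ind ((b Fin.≟ i) ×-dec (a Fin.≟ j)))
        ≡⟨ ∑-+ I (λ (i , j) → ind ((a Fin.≟ i) ×-dec (b Fin.≟ j))) (λ (i , j) → ind ((b Fin.≟ i) ×-dec (a Fin.≟ j))) ⟩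
      ∑ I (λ (i , j) → ind ((a Fin.≟ i) ×-dec (b Fin.≟ j))) + ∑ I (λ (i , j) → ind ((b Fin.≟ i) ×-dec (a Fin.≟ j)))
        ≡⟨ cong₂ _+_ (pair a b) (pair b a) ⟩
      1ℚ + 1ℚ ∎
      where
      split : ∀ i j → term (i , j) ≡ ind ((a Fin.≟ i) ×-dec (b Fin.≟ j)) + ind ((b Fin.≟ i) ×-dec (a Fin.≟ j))
      split i j = cases ((a Fin.≟ i) ×-dec (b Fin.≟ j)) ((b Fin.≟ i) ×-dec (a Fin.≟ j)) (i Fin.≟ j)
        where
        cases : (p? : Dec (a ≡ i × b ≡ j)) (q? : Dec (b ≡ i × a ≡ j)) → Dec (i ≡ j) → term (i , j) ≡ ind p? + ind q?
        cases (yes (refl , refl)) (yes (b≡a , _)) _ = contradiction (sym b≡a) a≢b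
        cases (yes (refl , refl)) (no _) _ = cong₂ _*_ (ind-yes (¬? (a Fin.≟ b)) a≢b) (ind-yes (transpose a b ≈? π) (sym ∘ eq))
        cases (no _) (yes (refl , refl)) _ = cong₂ _*_ (ind-yes (¬? (b Fin.≟ a)) (a≢b ∘ sym))
          (ind-yes (transpose b a ≈? π) (λ k → trans (transpose-comm b a k) (sym (eq k))))
        cases (no _) (no _) (yes i≡j) = trans (cong (_* ind (transpose i j ≈? π)) (ind-no (¬? (i Fin.≟ j)) (λ i≢j → i≢j i≡j))) (*-zeroˡ (ind (transpose i j ≈? π)))
        cases (no ¬p) (no ¬q) (no i≢j) = trans (cong (ind (¬? (i Fin.≟ j)) *_) (ind-no (transpose i j ≈? π)
          (λ eq′ → transpose-injective i≢j (λ k → trans (eq′ k) (eq k)) ¬p ¬q))) (*-zeroʳ (ind (¬? (i Fin.≟ j))))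

  T-transpose : ∀ {φ : Permutation′ d → ℚ} → Respects≈ φ → ∀ σ →
    2ℚ * T φ σ ≡ ∑ (allFin d) (λ i → ∑ (allFin d) (λ j → ind (¬? (i Fin.≟ j)) * φ (transpose i j ∘ₚ σ)))
  T-transpose {d} {φ} resp σ = sym (begin
    ∑ (allFin d) (λ i → ∑ (allFin d) (λ j → ind (¬? (i Fin.≟ j)) * φ (transpose i j ∘ₚ σ)))
      ≡⟨ ∑-cartesianProductWith _,_ (allFin d) (allFin d) (λ (i , j) → ind (¬? (i Fin.≟ j)) * φ (transpose i j ∘ₚ σ)) ⟨
    ∑ (cartesianProduct (allFin d) (allFin d)) (λ (i , j) → ind (¬? (i Fin.≟ j)) * φ (transpose i j ∘ₚ σ))
      ≡⟨ ∑-reindex (cartesianProduct (allFin d) (allFin d)) (λ (i , j) → ind (¬? (i Fin.≟ j))) (λ (i , j) → transpose i j) (λ π → 2ℚ * ind (isTransposition? π)) ∑-transpose-count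
           {φ = λ τ → φ (τ ∘ₚ σ)} (λ {π} {ρ} eq → resp {π ∘ₚ σ} {ρ ∘ₚ σ} (λ k → cong (σ ⟨$⟩ʳ_) (eq k))) ⟩
    ∑ (allPermutations d) (λ τ → 2ℚ * ind (isTransposition? τ) * φ (τ ∘ₚ σ))
      ≡⟨ trans (∑-cong (allPermutations d) (λ τ → *-assoc 2ℚ (ind (isTransposition? τ)) (φ (τ ∘ₚ σ)))) (sym (*-∑ 2ℚ (allPermutations d) (λ τ → ind (isTransposition? τ) * φ (τ ∘ₚ σ)))) ⟩
    2ℚ * T φ σ ∎)
    where open ≡-Reasoning

  sum-cycleType : ∀ {π : Permutation′ d} {L} → Cycles π L → sum (map length L) ≡ d
  sum-cycleType {d} {L = L} c = trans (go L) (trans (↭-length (covers c)) (List.length-tabulate {n = d} id))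
    where
    go : ∀ (L : List (List A)) → sum (map length L) ≡ length (concat L)
    go []      = refl
    go (C ∷ L) = trans (cong (length C ℕ.+_) (go L)) (sym (List.length-++ C))

  -- Twice the operator is a sum over ordered pairs. Sorting them by the cycle of the first point
  -- yields `cutJoin`, so on unit differences the operator acts as multiplication by `d z / 2`.
  T-D : ∀ .{{_ : ℕ.NonZero d}} (h h′ : ℚ → ℚ) →
    (∀ z → h′ (z + 1ℚ) - h′ (z - 1ℚ) ≡ fromℕ d * z * (h (z + 1ℚ) - h (z - 1ℚ))) →
    ∀ {φ : Permutation′ d → ℚ} → (∀ π → φ π ≡ D (cycleType π) h) → ∀ σ → 2ℚ * T φ σ ≡ D (cycleType σ) h′
  T-D {d} h h′ rel {φ} eq σ = begin
    2ℚ * T φ σ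
      ≡⟨ T-transpose (λ {π} {ρ} π≈ρ → trans (eq π) (trans (cong (λ L → D L h) (cycleType-cong {π = π} {ρ} π≈ρ)) (sym (eq ρ)))) σ ⟩
    ∑ (allFin d) (λ i → ∑ (allFin d) (λ j → ind (¬? (i Fin.≟ j)) * φ (transpose i j ∘ₚ σ)))
      ≡⟨ ∑-cycles c _ (cutJoin (λ L → D L h)) (λ {i} c′ → trans
           (∑-cong (allFin d) (λ j → cong (ind (¬? (i Fin.≟ j)) *_) (eq (transpose i j ∘ₚ σ))))
           (∑-transpose (λ L → D L h) (λ p → D-↭ p h) c′)) ⟩
    ∑ (picks (map length L)) (λ (b , R) → fromℕ b * cutJoin (λ L → D L h) b R)
      ≡⟨ ∑-cutJoin h h′ (map length L) {{subst ℕ.NonZero (sym (sum-cycleType c)) it}} (λ z → trans (rel z) (cong (λ n → fromℕ n * z * _) (sym (sum-cycleType c)))) ⟩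
    D (map length L) h′
      ≡⟨ D-↭ (cycleType-↭ c) h′ ⟨
    D (cycleType σ) h′ ∎
    where
    open ≡-Reasoning

    L = proj₁ (cycles-exist σ)
    c = proj₂ (cycles-exist σ)

-- Products of a permutation with full cycles: the recursion and its solution.

module FullCycles where

  open import Data.List using (map)
  open import Data.Nat.ListAction using (sum)
  open import Data.List.Relation.Unary.All using (All)
  open import Data.Rational using (_+_; _*_; _-_; -_)
  open import Data.Rational.Properties
  open Sums
  open Differences
  open CutAndJoin
  open CycleLists
  open PermutationSums

  open Cycles

  private
    variable
      d : ℕ

  numCycles-≡ : ∀ {π : Permutation′ d} {L} → Cycles π L → numCycles π ≡ length L
  numCycles-≡ {L = L} c = trans (↭-length (cycleType-↭ c)) (List.length-map length L)

  numCycles-cong : ∀ {π ρ : Permutation′ d} → π ≈ₚ ρ → numCycles π ≡ numCycles ρ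
  numCycles-cong {π = π} {ρ} eq = cong length (cycleType-cong {π = π} {ρ} eq)

  numCycles-lift : ∀ (π : Permutation′ d) → numCycles (lift₀ π) ≡ suc (numCycles π)
  numCycles-lift π = let L , c = cycles-exist π in
    trans (numCycles-≡ (Cycles-lift c)) (cong suc (trans (List.length-map (map suc) L) (sym (numCycles-≡ c))))

  numCycles-insert : ∀ (π : Permutation′ d) i → numCycles (transpose zero (suc i) ∘ₚ lift₀ π) ≡ numCycles π
  numCycles-insert π i = let L , c = cycles-exist π ; xs , R , c′ = Cycles-focus c i in
    trans (numCycles-≡ (Cycles-insert c′)) (trans (cong suc (List.length-map (map suc) R)) (sym (numCycles-≡ c′)))

  ⟨$⟩ʳ-injective : ∀ (π : Permutation′ d) {i j} → π ⟨$⟩ʳ i ≡ π ⟨$⟩ʳ j → i ≡ j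
  ⟨$⟩ʳ-injective π eq = trans (sym (inverseˡ π)) (trans (cong (π ⟨$⟩ˡ_) eq) (inverseˡ π))

  transpose-zero-other : ∀ (i k : Fin d) → k ≢ i → transpose zero (suc i) ⟨$⟩ʳ suc k ≡ suc k
  transpose-zero-other i k k≢i = transpose-other {i = zero} {suc i} {suc k} (λ ()) (k≢i ∘ Fin.suc-injective)

  -- Conjugation carries the transposition to the other side, so inserting 0 on the right preserves
  -- the number of cycles just as inserting it on the left does.
  lift₀-transpose-comm : ∀ (π : Permutation′ d) i →
    transpose zero (suc i) ∘ₚ lift₀ π ≈ₚ lift₀ π ∘ₚ transpose zero (suc (π ⟨$⟩ʳ i))
  lift₀-transpose-comm π i k = go k (k Fin.≟ suc i)
    where
    go : ∀ k → Dec (k ≡ suc i) → (transpose zero (suc i) ∘ₚ lift₀ π) ⟨$⟩ʳ k ≡ (lift₀ π ∘ₚ transpose zero (suc (π ⟨$⟩ʳ i))) ⟨$⟩ʳ k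
    go zero    _          = trans (cong (lift₀ π ⟨$⟩ʳ_) (transpose-fst zero (suc i))) (sym (transpose-fst zero (suc (π ⟨$⟩ʳ i))))
    go (suc k) (yes refl) = trans (cong (lift₀ π ⟨$⟩ʳ_) (transpose-snd zero (suc i))) (sym (transpose-snd zero (suc (π ⟨$⟩ʳ i))))
    go (suc k) (no k≢i)   = trans (cong (lift₀ π ⟨$⟩ʳ_) (transpose-zero-other i k (k≢i ∘ cong suc)))
      (sym (transpose-zero-other (π ⟨$⟩ʳ i) (π ⟨$⟩ʳ k) (k≢i ∘ cong suc ∘ ⟨$⟩ʳ-injective π)))

  numCycles-insertʳ : ∀ (π : Permutation′ d) j → numCycles (lift₀ π ∘ₚ transpose zero (suc j)) ≡ numCycles π
  numCycles-insertʳ π j = trans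
    (numCycles-cong {π = lift₀ π ∘ₚ transpose zero (suc j)} {transpose zero (suc (π ⟨$⟩ˡ j)) ∘ₚ lift₀ π}
      (λ k → sym (trans (lift₀-transpose-comm π (π ⟨$⟩ˡ j) k) (cong (λ x → transpose zero (suc x) ⟨$⟩ʳ (lift₀ π ⟨$⟩ʳ k)) (inverseʳ π)))))
    (numCycles-insert π (π ⟨$⟩ˡ j))

  numCycles-positive : ∀ .{{_ : ℕ.NonZero d}} (π : Permutation′ d) → ∃ λ k → numCycles π ≡ suc k
  numCycles-positive {d} π with cycles-exist π
  ... | []    , c = ⊥-elim (ℕ.≢-nonZero⁻¹ d (sym (sum-cycleType c)))
  ... | C ∷ L , c = length L , numCycles-≡ c

  numCycles-≤ : ∀ (π : Permutation′ d) → numCycles π ℕ.≤ d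
  numCycles-≤ {d} π = let L , c = cycles-exist π in begin
    numCycles π            ≡⟨ numCycles-≡ c ⟩
    length L               ≤⟨ go L (cycles c) ⟩
    sum (map length L)     ≡⟨ sum-cycleType c ⟩
    d                      ∎
    where
    open ℕ.≤-Reasoning
    go : ∀ L → All (IsCycle (π ⟨$⟩ʳ_)) L → length L ℕ.≤ sum (map length L)
    go []             []       = ℕ.z≤n
    go ((x ∷ xs) ∷ L) (_ ∷ cs) = ℕ.+-mono-≤ (ℕ.s≤s (ℕ.z≤n {length xs})) (go L cs)

  full⇒1 : ∀ {π : Permutation′ d} → cycleType π ≡ [ d ] → numCycles π ≡ 1
  full⇒1 = cong length

  1⇒full : ∀ {π : Permutation′ d} → numCycles π ≡ 1 → cycleType π ≡ [ d ]
  1⇒full {π = π} one with cycles-exist π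
  ... | L , c with trans (sym (numCycles-≡ c)) one
  1⇒full {π = π} one | (C ∷ []) , c | _ =
    trans (cycleType-≡ c) (cong [_] (trans (sym (ℕ.+-identityʳ (length C))) (sum-cycleType c)))

  -- The number of full cycles c such that c ∘ₚ σ has suc d - r cycles.

  full? : (c : Permutation′ d) → Dec (cycleType c ≡ [ d ])
  full? {d} c = List.≡-dec ℕ._≟_ (cycleType c) [ d ]

  defect? : ∀ r (π : Permutation′ d) → Dec (numCycles π ℕ.+ r ≡ suc d)
  defect? {d} r π = numCycles π ℕ.+ r ℕ.≟ suc d

  Q : ∀ d → ℕ → Permutation′ d → ℚ
  Q d r σ = ∑ (allPermutations d) (λ c → ind (full? c) * ind (defect? r (c ∘ₚ σ)))

  full-cong : ∀ {π : Permutation′ d} {n} {ρ : Permutation′ n} → numCycles π ≡ numCycles ρ → ind (full? π) ≡ ind (full? ρ)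
  full-cong {π = π} {ρ = ρ} eq = ind-cong (full? π) (full? ρ)
    (λ f → 1⇒full {π = ρ} (trans (sym eq) (full⇒1 {π = π} f)))
    (λ f → 1⇒full {π = π} (trans eq (full⇒1 {π = ρ} f)))

  Q-summand-cong : ∀ r (σ : Permutation′ d) → Respects≈ (λ c → ind (full? c) * ind (defect? r (c ∘ₚ σ)))
  Q-summand-cong r σ {π} {ρ} eq = cong₂ _*_ (full-cong {π = π} {ρ = ρ} (numCycles-cong {π = π} {ρ} eq))
    (cong (λ n → ind (n ℕ.+ r ℕ.≟ suc _)) (numCycles-cong {π = π ∘ₚ σ} {ρ ∘ₚ σ} (λ k → cong (σ ⟨$⟩ʳ_) (eq k))))

  Q-cong : ∀ r {σ ρ : Permutation′ d} → σ ≈ₚ ρ → Q d r σ ≡ Q d r ρ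
  Q-cong {d} r {σ} {ρ} eq = ∑-cong (allPermutations d) (λ c → cong (ind (full? c) *_)
    (cong (λ n → ind (n ℕ.+ r ℕ.≟ suc _)) (numCycles-cong {π = c ∘ₚ σ} {c ∘ₚ ρ} (λ k → eq (c ⟨$⟩ʳ k)))))

  Q-0 : ∀ (σ : Permutation′ d) → Q d 0 σ ≡ 0ℚ
  Q-0 {d} σ = trans (∑-cong (allPermutations d) (λ c → trans (cong (ind (full? c) *_) (ind-no (defect? 0 (c ∘ₚ σ))
    (λ eq → ℕ.<-irrefl refl (ℕ.≤-trans (ℕ.≤-reflexive (trans (sym eq) (ℕ.+-identityʳ _))) (numCycles-≤ (c ∘ₚ σ)))))) (*-zeroʳ (ind (full? c)))))
    (∑-0 (allPermutations d))

  module _ {d : ℕ} .{{_ : ℕ.NonZero d}} (r : ℕ) where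

    -- Every permutation is some `lift₀ c` followed by the transposition of 0 and `j`. For `j = 0`
    -- it fixes 0 and, as `d` is positive, is not a full cycle; for the other `j` it is full exactly
    -- if `c` is.
    Q-expand : ∀ (σ : Permutation′ (suc d)) → Q (suc d) (suc r) σ
      ≡ ∑ (allFin d) (λ j → ∑ (allPermutations d) (λ c → ind (full? c) * ind (defect? (suc r) (lift₀ c ∘ₚ transpose zero (suc j) ∘ₚ σ))))
    Q-expand σ = begin
      Q (suc d) (suc r) σ
        ≡⟨ ∑-insertʳ (λ {π} {ρ} → Q-summand-cong (suc r) σ {π} {ρ}) ⟩
      ∑ (allFin (suc d)) φ
        ≡⟨ ∑-allFin-suc φ ⟩
      φ zero + ∑ (allFin d) (φ ∘ suc)
        ≡⟨ cong₂ _+_ (trans (∑-cong (allPermutations d) not-full-0) (∑-0 (allPermutations d)))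
           (∑-cong (allFin d) (λ j → ∑-cong (allPermutations d) (λ c → cong (_* ind (defect? (suc r) (lift₀ c ∘ₚ transpose zero (suc j) ∘ₚ σ)))
             (full-cong {π = lift₀ c ∘ₚ transpose zero (suc j)} {ρ = c} (numCycles-insertʳ c j))))) ⟩
      0ℚ + ∑ (allFin d) (λ j → ∑ (allPermutations d) (λ c → ind (full? c) * ind (defect? (suc r) (lift₀ c ∘ₚ transpose zero (suc j) ∘ₚ σ))))
        ≡⟨ +-identityˡ _ ⟩
      ∑ (allFin d) (λ j → ∑ (allPermutations d) (λ c → ind (full? c) * ind (defect? (suc r) (lift₀ c ∘ₚ transpose zero (suc j) ∘ₚ σ)))) ∎
      where
      open ≡-Reasoning
      φ : Fin (suc d) → ℚ
      φ j = ∑ (allPermutations d) (λ c → ind (full? (lift₀ c ∘ₚ transpose zero j)) * ind (defect? (suc r) ((lift₀ c ∘ₚ transpose zero j) ∘ₚ σ)))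
      not-full-0 : ∀ c → ind (full? (lift₀ c ∘ₚ transpose zero zero)) * ind (defect? (suc r) ((lift₀ c ∘ₚ transpose zero zero) ∘ₚ σ)) ≡ 0ℚ
      not-full : ∀ c → ¬ cycleType (lift₀ c ∘ₚ transpose zero zero) ≡ [ suc d ]
      not-full c full with numCycles-positive c
      ... | k , eq = ℕ.1+n≢0 (ℕ.suc-injective (begin
        suc (suc k)                                     ≡⟨ cong suc eq ⟨
        suc (numCycles c)                               ≡⟨ numCycles-lift c ⟨
        numCycles (lift₀ c)                             ≡⟨ numCycles-cong {π = lift₀ c ∘ₚ transpose zero zero} {lift₀ c} (λ k → transpose-id zero (lift₀ c ⟨$⟩ʳ k)) ⟨
        numCycles (lift₀ c ∘ₚ transpose zero zero)      ≡⟨ full⇒1 {π = lift₀ c ∘ₚ transpose zero zero} full ⟩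
        1                                               ∎))
      not-full-0 c = trans
        (cong (_* ind (defect? (suc r) ((lift₀ c ∘ₚ transpose zero zero) ∘ₚ σ))) (ind-no (full? (lift₀ c ∘ₚ transpose zero zero)) (not-full c)))
        (*-zeroˡ (ind (defect? (suc r) ((lift₀ c ∘ₚ transpose zero zero) ∘ₚ σ))))

    defect-insert : ∀ {π : Permutation′ (suc d)} {ρ : Permutation′ d} → numCycles π ≡ numCycles ρ →
                    ind (defect? (suc r) π) ≡ ind (defect? r ρ)
    defect-insert {π} {ρ} eq = ind-cong (defect? (suc r) π) (defect? r ρ)
      (λ p → trans (cong (ℕ._+ r) (sym eq)) (ℕ.suc-injective (trans (sym (ℕ.+-suc (numCycles π) r)) p)))
      (λ p → trans (cong (ℕ._+ suc r) eq) (trans (ℕ.+-suc (numCycles ρ) r) (cong suc p)))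

    defect-lift : ∀ {π : Permutation′ (suc d)} {ρ : Permutation′ d} → numCycles π ≡ suc (numCycles ρ) →
                  ind (defect? (suc r) π) ≡ ind (defect? (suc r) ρ)
    defect-lift {π} {ρ} eq = ind-cong (defect? (suc r) π) (defect? (suc r) ρ)
      (λ p → ℕ.suc-injective (trans (cong (ℕ._+ suc r) (sym eq)) p))
      (λ p → trans (cong (ℕ._+ suc r) eq) (cong suc p))

    -- Moved past `lift₀ σ`, the transposition inserts 0 into a cycle of `c ∘ₚ σ`. The number of
    -- cycles stays the same while the number of points grows, so the defect index falls by one, and
    -- this holds for each of the `d` choices of `j`.
    Q-lift : ∀ (σ : Permutation′ d) → Q (suc d) (suc r) (lift₀ σ) ≡ fromℕ d * Q d r σ
    Q-lift σ = begin
      Q (suc d) (suc r) (lift₀ σ)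
        ≡⟨ Q-expand (lift₀ σ) ⟩
      ∑ (allFin d) (λ j → ∑ (allPermutations d) (λ c → ind (full? c) * ind (defect? (suc r) (lift₀ c ∘ₚ transpose zero (suc j) ∘ₚ lift₀ σ))))
        ≡⟨ ∑-cong (allFin d) (λ j → ∑-cong (allPermutations d) (λ c → cong (ind (full? c) *_)
             (defect-insert {lift₀ c ∘ₚ transpose zero (suc j) ∘ₚ lift₀ σ} {c ∘ₚ σ} (trans
               (numCycles-cong {π = lift₀ c ∘ₚ transpose zero (suc j) ∘ₚ lift₀ σ} {lift₀ (c ∘ₚ σ) ∘ₚ transpose zero (suc (σ ⟨$⟩ʳ j))}
                 (λ k → trans (lift₀-transpose-comm σ j (lift₀ c ⟨$⟩ʳ k)) (cong (transpose zero (suc (σ ⟨$⟩ʳ j)) ⟨$⟩ʳ_) (lift₀-∘ c k))))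
               (numCycles-insertʳ (c ∘ₚ σ) (σ ⟨$⟩ʳ j)))))) ⟩
      ∑ (allFin d) (λ j → Q d r σ)
        ≡⟨ ∑-const (allFin d) (Q d r σ) ⟩
      fromℕ (length (allFin d)) * Q d r σ
        ≡⟨ cong (λ m → fromℕ m * Q d r σ) (List.length-tabulate {n = d} id) ⟩
      fromℕ d * Q d r σ ∎
      where
      open ≡-Reasoning
      lift₀-∘ : ∀ c k → lift₀ σ ⟨$⟩ʳ (lift₀ c ⟨$⟩ʳ k) ≡ lift₀ (c ∘ₚ σ) ⟨$⟩ʳ k
      lift₀-∘ c zero    = refl
      lift₀-∘ c (suc k) = refl

    -- For `j = i` the two transpositions cancel: 0 becomes a cycle of its own and the defect index
    -- is unchanged. For `j ≢ i` they merge into a 3-cycle, which amounts to inserting 0 into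
    -- `c ∘ₚ transpose i j ∘ₚ σ`.
    Q-insert : ∀ (σ : Permutation′ d) i → Q (suc d) (suc r) (transpose zero (suc i) ∘ₚ lift₀ σ)
      ≡ Q d (suc r) σ + ∑ (allFin d) (λ j → ind (¬? (i Fin.≟ j)) * Q d r (transpose i j ∘ₚ σ))
    Q-insert σ i = begin
      Q (suc d) (suc r) (transpose zero (suc i) ∘ₚ lift₀ σ)
        ≡⟨ Q-expand (transpose zero (suc i) ∘ₚ lift₀ σ) ⟩
      ∑ (allFin d) (λ j → ∑ (allPermutations d) (λ c → ind (full? c) * ind (defect? (suc r) (π c j))))
        ≡⟨ ∑-cong (allFin d) (λ j → by-case j (i Fin.≟ j)) ⟩
      ∑ (allFin d) (λ j → ind (i Fin.≟ j) * Q d (suc r) σ + ind (¬? (i Fin.≟ j)) * Q d r (transpose i j ∘ₚ σ))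
        ≡⟨ ∑-+ (allFin d) (λ j → ind (i Fin.≟ j) * Q d (suc r) σ) (λ j → ind (¬? (i Fin.≟ j)) * Q d r (transpose i j ∘ₚ σ)) ⟩
      ∑ (allFin d) (λ j → ind (i Fin.≟ j) * Q d (suc r) σ) + ∑ (allFin d) (λ j → ind (¬? (i Fin.≟ j)) * Q d r (transpose i j ∘ₚ σ))
        ≡⟨ cong (_+ ∑ (allFin d) (λ j → ind (¬? (i Fin.≟ j)) * Q d r (transpose i j ∘ₚ σ))) (∑-pick (λ j → i Fin.≟ j) (allFin d) (∑-allFin-≟ i) (λ _ → refl)) ⟩
      Q d (suc r) σ + ∑ (allFin d) (λ j → ind (¬? (i Fin.≟ j)) * Q d r (transpose i j ∘ₚ σ)) ∎
      where
      open ≡-Reasoning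
      π : Permutation′ d → Fin d → Permutation′ (suc d)
      π c j = lift₀ c ∘ₚ transpose zero (suc j) ∘ₚ transpose zero (suc i) ∘ₚ lift₀ σ
      lift₀-∘ : ∀ c k → lift₀ σ ⟨$⟩ʳ (lift₀ c ⟨$⟩ʳ k) ≡ lift₀ (c ∘ₚ σ) ⟨$⟩ʳ k
      lift₀-∘ c zero    = refl
      lift₀-∘ c (suc k) = refl
      π-≡ : ∀ c → π c i ≈ₚ lift₀ (c ∘ₚ σ)
      π-≡ c k = trans (cong (lift₀ σ ⟨$⟩ʳ_) (transpose-involutive zero (suc i) (lift₀ c ⟨$⟩ʳ k))) (lift₀-∘ c k)
      -- Composed from left to right, (0 j)(0 i) equals (i j)(0 j), and moving (0 j) past σ turns it
      -- into (0 σj).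
      π-≢ : ∀ {j} → i ≢ j → ∀ c → π c j ≈ₚ lift₀ (c ∘ₚ transpose i j ∘ₚ σ) ∘ₚ transpose zero (suc (σ ⟨$⟩ʳ j))
      π-≢ {j} i≢j c zero = begin
        lift₀ σ ⟨$⟩ʳ (transpose zero (suc i) ⟨$⟩ʳ (transpose zero (suc j) ⟨$⟩ʳ zero))
          ≡⟨ cong (λ k → lift₀ σ ⟨$⟩ʳ (transpose zero (suc i) ⟨$⟩ʳ k)) (transpose-fst zero (suc j)) ⟩
        lift₀ σ ⟨$⟩ʳ (transpose zero (suc i) ⟨$⟩ʳ suc j)
          ≡⟨ cong (lift₀ σ ⟨$⟩ʳ_) (transpose-zero-other i j (i≢j ∘ sym)) ⟩
        suc (σ ⟨$⟩ʳ j)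
          ≡⟨ transpose-fst zero (suc (σ ⟨$⟩ʳ j)) ⟨
        transpose zero (suc (σ ⟨$⟩ʳ j)) ⟨$⟩ʳ zero ∎
      π-≢ {j} i≢j c (suc k) = go (c ⟨$⟩ʳ k) (c ⟨$⟩ʳ k Fin.≟ j) (c ⟨$⟩ʳ k Fin.≟ i)
        where
        go : ∀ x → Dec (x ≡ j) → Dec (x ≡ i) →
          lift₀ σ ⟨$⟩ʳ (transpose zero (suc i) ⟨$⟩ʳ (transpose zero (suc j) ⟨$⟩ʳ suc x))
          ≡ transpose zero (suc (σ ⟨$⟩ʳ j)) ⟨$⟩ʳ suc (σ ⟨$⟩ʳ (transpose i j ⟨$⟩ʳ x))
        go x (yes refl) _ = begin
          lift₀ σ ⟨$⟩ʳ (transpose zero (suc i) ⟨$⟩ʳ (transpose zero (suc j) ⟨$⟩ʳ suc j))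
            ≡⟨ cong (λ k → lift₀ σ ⟨$⟩ʳ (transpose zero (suc i) ⟨$⟩ʳ k)) (transpose-snd zero (suc j)) ⟩
          lift₀ σ ⟨$⟩ʳ (transpose zero (suc i) ⟨$⟩ʳ zero)
            ≡⟨ cong (lift₀ σ ⟨$⟩ʳ_) (transpose-fst zero (suc i)) ⟩
          suc (σ ⟨$⟩ʳ i)
            ≡⟨ transpose-zero-other (σ ⟨$⟩ʳ j) (σ ⟨$⟩ʳ i) (i≢j ∘ ⟨$⟩ʳ-injective σ) ⟨
          transpose zero (suc (σ ⟨$⟩ʳ j)) ⟨$⟩ʳ suc (σ ⟨$⟩ʳ i)
            ≡⟨ cong (λ k → transpose zero (suc (σ ⟨$⟩ʳ j)) ⟨$⟩ʳ suc (σ ⟨$⟩ʳ k)) (transpose-snd i j) ⟨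
          transpose zero (suc (σ ⟨$⟩ʳ j)) ⟨$⟩ʳ suc (σ ⟨$⟩ʳ (transpose i j ⟨$⟩ʳ j)) ∎
        go x (no x≢j) (yes refl) = begin
          lift₀ σ ⟨$⟩ʳ (transpose zero (suc i) ⟨$⟩ʳ (transpose zero (suc j) ⟨$⟩ʳ suc i))
            ≡⟨ cong (λ k → lift₀ σ ⟨$⟩ʳ (transpose zero (suc i) ⟨$⟩ʳ k)) (transpose-zero-other j x x≢j) ⟩
          lift₀ σ ⟨$⟩ʳ (transpose zero (suc i) ⟨$⟩ʳ suc i)
            ≡⟨ cong (lift₀ σ ⟨$⟩ʳ_) (transpose-snd zero (suc i)) ⟩
          zero
            ≡⟨ transpose-snd zero (suc (σ ⟨$⟩ʳ j)) ⟨
          transpose zero (suc (σ ⟨$⟩ʳ j)) ⟨$⟩ʳ suc (σ ⟨$⟩ʳ j)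
            ≡⟨ cong (λ k → transpose zero (suc (σ ⟨$⟩ʳ j)) ⟨$⟩ʳ suc (σ ⟨$⟩ʳ k)) (transpose-fst i j) ⟨
          transpose zero (suc (σ ⟨$⟩ʳ j)) ⟨$⟩ʳ suc (σ ⟨$⟩ʳ (transpose i j ⟨$⟩ʳ i)) ∎
        go x (no x≢j) (no x≢i) = begin
          lift₀ σ ⟨$⟩ʳ (transpose zero (suc i) ⟨$⟩ʳ (transpose zero (suc j) ⟨$⟩ʳ suc x))
            ≡⟨ cong (λ k → lift₀ σ ⟨$⟩ʳ (transpose zero (suc i) ⟨$⟩ʳ k)) (transpose-zero-other j x x≢j) ⟩
          lift₀ σ ⟨$⟩ʳ (transpose zero (suc i) ⟨$⟩ʳ suc x)
            ≡⟨ cong (lift₀ σ ⟨$⟩ʳ_) (transpose-zero-other i x x≢i) ⟩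
          suc (σ ⟨$⟩ʳ x)
            ≡⟨ transpose-zero-other (σ ⟨$⟩ʳ j) (σ ⟨$⟩ʳ x) (x≢j ∘ ⟨$⟩ʳ-injective σ) ⟨
          transpose zero (suc (σ ⟨$⟩ʳ j)) ⟨$⟩ʳ suc (σ ⟨$⟩ʳ x)
            ≡⟨ cong (λ k → transpose zero (suc (σ ⟨$⟩ʳ j)) ⟨$⟩ʳ suc (σ ⟨$⟩ʳ k)) (transpose-other x≢i x≢j) ⟨
          transpose zero (suc (σ ⟨$⟩ʳ j)) ⟨$⟩ʳ suc (σ ⟨$⟩ʳ (transpose i j ⟨$⟩ʳ x)) ∎
      by-case : ∀ j (i≟j : Dec (i ≡ j)) →
        ∑ (allPermutations d) (λ c → ind (full? c) * ind (defect? (suc r) (π c j)))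
        ≡ ind i≟j * Q d (suc r) σ + ind (¬? i≟j) * Q d r (transpose i j ∘ₚ σ)
      by-case j (yes refl) = trans
        (∑-cong (allPermutations d) (λ c → cong (ind (full? c) *_) (defect-lift {π c i} {c ∘ₚ σ}
          (trans (numCycles-cong {π = π c i} {lift₀ (c ∘ₚ σ)} (π-≡ c)) (numCycles-lift (c ∘ₚ σ))))))
        (sym (trans (cong₂ _+_ (*-identityˡ (Q d (suc r) σ)) (*-zeroˡ (Q d r (transpose i i ∘ₚ σ)))) (+-identityʳ _)))
      by-case j (no i≢j) = trans
        (∑-cong (allPermutations d) (λ c → cong (ind (full? c) *_) (defect-insert {π c j} {c ∘ₚ transpose i j ∘ₚ σ}
          (trans (numCycles-cong {π = π c j} {lift₀ (c ∘ₚ transpose i j ∘ₚ σ) ∘ₚ transpose zero (suc (σ ⟨$⟩ʳ j))} (π-≢ i≢j c))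
                 (numCycles-insertʳ (c ∘ₚ transpose i j ∘ₚ σ) (σ ⟨$⟩ʳ j))))))
        (sym (trans (cong₂ _+_ (*-zeroˡ (Q d (suc r) σ)) (*-identityˡ (Q d r (transpose i j ∘ₚ σ)))) (+-identityˡ _)))

  2^_ : ℕ → ℚ
  2^ zero  = 1ℚ
  2^ suc r = 2ℚ * 2^ r

  -- For `r = q + 1`, the factor `d` clears the 1/d of the hook expansion, `2^ q` the doubling of
  -- the contents, and the remaining `2 (d + 1)` is the constant of `E-tele`.
  scale : ℕ → ℕ → ℚ
  scale d r = 2^ r * (fromℕ d * (fromℕ d + 1ℚ))

  Q-one-cycle : (∀ (π : Permutation′ d) → numCycles π ≡ 1) → ∀ r (σ : Permutation′ d) →
    Q d r σ ≡ fromℕ (length (allPermutations d)) * ind (1 ℕ.+ r ℕ.≟ suc d)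
  Q-one-cycle {d} single r σ = trans
    (∑-cong (allPermutations d) (λ c → trans
      (cong₂ _*_ (ind-yes (full? c) (1⇒full {π = c} (single c))) (cong (λ n → ind (n ℕ.+ r ℕ.≟ suc d)) (single (c ∘ₚ σ))))
      (*-identityˡ (ind (1 ℕ.+ r ℕ.≟ suc d)))))
    (∑-const (allPermutations d) (ind (1 ℕ.+ r ℕ.≟ suc d)))

  -- The induction starts at 1 because the recursion excludes `d = 0`, where the lift of the empty
  -- permutation is itself a full cycle.
  Q-D-base : ∀ r (σ : Permutation′ 1) → scale 1 (suc r) * Q 1 (suc r) σ ≡ D (cycleType σ) (E 1 (suc r))
  Q-D-base r σ = trans
    (cong (scale 1 (suc r) *_) (trans (Q-one-cycle single (suc r) σ) (*-identityˡ (ind (1 ℕ.+ suc r ℕ.≟ 2)))))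
    (trans (value r) (cong (λ L → D L (E 1 (suc r))) (sym (1⇒full {π = σ} (single σ)))))
    where
    single : ∀ (π : Permutation′ 1) → numCycles π ≡ 1
    single π = ℕ.≤-antisym (numCycles-≤ π) (ℕ.≤-trans (ℕ.s≤s ℕ.z≤n) (ℕ.≤-reflexive (sym (proj₂ (numCycles-positive π)))))
    value : ∀ r → scale 1 (suc r) * ind (1 ℕ.+ suc r ℕ.≟ 2) ≡ D [ 1 ] (E 1 (suc r))
    value zero          = refl
    value (suc zero)    = refl
    value (suc (suc r)) = *-zeroʳ (scale 1 (suc (suc (suc r))))

  module _ (d : ℕ) .{{_ : ℕ.NonZero d}}
    (ih : ∀ r (σ : Permutation′ d) → scale d r * Q d r σ ≡ D (cycleType σ) (E d r)) (r : ℕ) where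

    private
      open ≡-Reasoning
      goal : Permutation′ (suc d) → Set
      goal σ = scale (suc d) (suc r) * Q (suc d) (suc r) σ ≡ D (cycleType σ) (E (suc d) (suc r))
      resp-≈ : ∀ {σ ρ} → σ ≈ₚ ρ → goal σ → goal ρ
      resp-≈ {σ} {ρ} eq = subst₂ (λ q L → scale (suc d) (suc r) * q ≡ D L (E (suc d) (suc r))) (Q-cong (suc r) {σ} {ρ} eq) (cycleType-cong {π = σ} {ρ} eq)
      lift-case : ∀ ρ → goal (lift₀ ρ)
      lift-case ρ = begin
        scale (suc d) (suc r) * Q (suc d) (suc r) (lift₀ ρ)
          ≡⟨ cong₂ (λ m q → 2ℚ * 2^ r * (m * (m + 1ℚ)) * q) (fromℕ-suc d) (Q-lift r ρ) ⟩
        2ℚ * 2^ r * ((1ℚ + fromℕ d) * (1ℚ + fromℕ d + 1ℚ)) * (fromℕ d * Q d r ρ)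
          ≡⟨ shuffle (2^ r) (fromℕ d) (Q d r ρ) ⟩
        2ℚ * (fromℕ d + 2ℚ) * (scale d r * Q d r ρ)
          ≡⟨ cong (2ℚ * (fromℕ d + 2ℚ) *_) (ih r ρ) ⟩
        2ℚ * (fromℕ d + 2ℚ) * D (cycleType ρ) (E d r)
          ≡⟨ D-fixed d r (cycleType ρ) ⟨
        D (1 ∷ cycleType ρ) (E (suc d) (suc r))
          ≡⟨ D-↭ type (E (suc d) (suc r)) ⟨
        D (cycleType (lift₀ ρ)) (E (suc d) (suc r)) ∎
        where
        shuffle : ∀ p m q → (1ℚ + 1ℚ) * p * ((1ℚ + m) * (1ℚ + m + 1ℚ)) * (m * q) ≡ (1ℚ + 1ℚ) * (m + (1ℚ + 1ℚ)) * (p * (m * (m + 1ℚ)) * q)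
        shuffle = solve-∀ ℚ-ring
        type : cycleType (lift₀ ρ) ↭ 1 ∷ cycleType ρ
        type = let L , c = cycles-exist ρ in ↭-trans (cycleType-lift c) (Perm.prep 1 (↭-sym (cycleType-↭ c)))
      insert-case : ∀ i ρ → goal (transpose zero (suc i) ∘ₚ lift₀ ρ)
      insert-case i ρ with Cycles-focus (proj₂ (cycles-exist ρ)) i
      -- `D-insert` determines the difference only up to the factor `2 d`, so both sides are
      -- multiplied by it and it is cancelled.
      ... | xs , R , c = cancel-fromℕ 2 (cancel-fromℕ d (begin
        fromℕ d * (2ℚ * (scale (suc d) (suc r) * Q (suc d) (suc r) (transpose zero (suc i) ∘ₚ lift₀ ρ)))
          ≡⟨ cong₂ (λ m q → fromℕ d * (2ℚ * (2ℚ * 2^ r * (m * (m + 1ℚ)) * q))) (fromℕ-suc d) (Q-insert r ρ i) ⟩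
        fromℕ d * (2ℚ * (2ℚ * 2^ r * ((1ℚ + fromℕ d) * (1ℚ + fromℕ d + 1ℚ)) * (Q d (suc r) ρ + S)))
          ≡⟨ shuffle (2^ r) (fromℕ d) (Q d (suc r) ρ) S ⟩
        2ℚ * ((fromℕ d + 2ℚ) * (scale d (suc r) * Q d (suc r) ρ) + 2ℚ * (fromℕ d + 2ℚ) * (scale d r * S))
          ≡⟨ cong₂ (λ x y → 2ℚ * ((fromℕ d + 2ℚ) * x + 2ℚ * (fromℕ d + 2ℚ) * y))
               (trans (ih (suc r) ρ) (D-↭ (cycleType-↭ c) (E d (suc r)))) scaled ⟩
        2ℚ * ((fromℕ d + 2ℚ) * D (suc q ∷ K) (E d (suc r)) + 2ℚ * (fromℕ d + 2ℚ) * cutJoin (λ L → D L (E d r)) (suc q) K)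
          ≡⟨ subst (λ m → 2ℚ * (fromℕ m * D (suc (suc q) ∷ K) (E (suc m) (suc r))) ≡ 2ℚ * ((fromℕ m + 2ℚ) * D (suc q ∷ K) (E m (suc r)) + 2ℚ * (fromℕ m + 2ℚ) * cutJoin (λ L → D L (E m r)) (suc q) K))
               (sum-cycleType c) (D-insert q K r) ⟨
        2ℚ * (fromℕ d * D (suc (suc q) ∷ K) (E (suc d) (suc r)))
          ≡⟨ swap (fromℕ d) (D (suc (suc q) ∷ K) (E (suc d) (suc r))) ⟩
        fromℕ d * (2ℚ * D (suc (suc q) ∷ K) (E (suc d) (suc r)))
          ≡⟨ cong (λ x → fromℕ d * (2ℚ * x)) (D-↭ (cycleType-insert c) (E (suc d) (suc r))) ⟨
        fromℕ d * (2ℚ * D (cycleType (transpose zero (suc i) ∘ₚ lift₀ ρ)) (E (suc d) (suc r))) ∎))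
        where
        q : ℕ
        q = length xs
        K : List ℕ
        K = map length R
        S : ℚ
        S = ∑ (allFin d) (λ j → ind (¬? (i Fin.≟ j)) * Q d r (transpose i j ∘ₚ ρ))
        shuffle : ∀ p m q s → m * ((1ℚ + 1ℚ) * ((1ℚ + 1ℚ) * p * ((1ℚ + m) * (1ℚ + m + 1ℚ)) * (q + s)))
          ≡ (1ℚ + 1ℚ) * ((m + (1ℚ + 1ℚ)) * ((1ℚ + 1ℚ) * p * (m * (m + 1ℚ)) * q) + (1ℚ + 1ℚ) * (m + (1ℚ + 1ℚ)) * (p * (m * (m + 1ℚ)) * s))
        shuffle = solve-∀ ℚ-ring
        swap : ∀ m x → (1ℚ + 1ℚ) * (m * x) ≡ m * ((1ℚ + 1ℚ) * x)
        swap = solve-∀ ℚ-ring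
        pull : ∀ s w q → s * (w * q) ≡ w * (s * q)
        pull = solve-∀ ℚ-ring
        scaled : scale d r * S ≡ cutJoin (λ L → D L (E d r)) (suc q) K
        scaled = trans (*-∑ (scale d r) (allFin d) _) (trans
          (∑-cong (allFin d) (λ j → trans (pull (scale d r) (ind (¬? (i Fin.≟ j))) (Q d r (transpose i j ∘ₚ ρ)))
            (cong (ind (¬? (i Fin.≟ j)) *_) (ih r (transpose i j ∘ₚ ρ)))))
          (∑-transpose (λ L → D L (E d r)) (λ p → D-↭ p (E d r)) c))

    -- The two sides obey the same recursion: `Q-lift` matches `D-fixed` when 0 is fixed, and
    -- `Q-insert` matches `D-insert` otherwise.
    Q-D-step : ∀ σ → goal σ
    Q-D-step σ with unlift σ
    ... | zero , ρ , eq  = resp-≈ {lift₀ ρ} {σ} (λ k → trans (sym (cong (lift₀ ρ ⟨$⟩ʳ_) (transpose-id zero k))) (eq k)) (lift-case ρ)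
    ... | suc i , ρ , eq = resp-≈ {transpose zero (suc i) ∘ₚ lift₀ ρ} {σ} eq (insert-case i ρ)

  Q-D : ∀ n r (σ : Permutation′ (suc n)) → scale (suc n) r * Q (suc n) r σ ≡ D (cycleType σ) (E (suc n) r)
  -- Both sides vanish: `d + 1` cycles are impossible, and the symmetric polynomial of degree 0 is
  -- constant while the cycle type is not empty.
  Q-D n zero σ = trans (trans (cong (scale (suc n) zero *_) (Q-0 σ)) (*-zeroʳ (scale (suc n) zero))) (sym (D-const (cycleType σ) (proj₂ (numCycles-positive σ))))
    where
    D-const : ∀ L {k} → length L ≡ suc k → D L (λ _ → 1ℚ) ≡ 0ℚ
    D-const (b ∷ L) _ = D-0 L
  Q-D zero    (suc r) σ = Q-D-base r σ
  Q-D (suc n) (suc r) σ = Q-D-step (suc n) (Q-D n) r σ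

-- The size of a conjugacy class, by counting labelled cycle types.

module ClassSize where

  open import Data.List using (map)
  open import Data.Nat.ListAction using (sum)
  open import Data.List.Relation.Unary.All using (All)
  open import Data.Rational using (_+_; _*_)
  open import Data.Rational.Properties
  open Sums
  open Differences
  open CycleLists
  open PermutationSums

  open Cycles

  -- Labelled cycle types: lab X M counts the bijections between the entries of X
  -- and those of M that preserve the values.

  _↭?_ : (X M : List ℕ) → Dec (sort X ≡ sort M)
  X ↭? M = List.≡-dec ℕ._≟_ (sort X) (sort M)

  mult : ℕ → List ℕ → ℚ
  mult x M = ∑ M (λ y → ind (x ℕ.≟ y))

  -- The product of the factorials of the multiplicities, built entry by entry so that it can be
  -- handled by recursion on the list.
  autL : List ℕ → ℚ
  autL []      = 1ℚ
  autL (x ∷ M) = (1ℚ + mult x M) * autL M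

  mult-self : ∀ x M → mult x (x ∷ M) ≡ 1ℚ + mult x M
  mult-self x M = cong (_+ mult x M) (ind-yes (x ℕ.≟ x) refl)

  mult-other : ∀ {x y} M → x ≢ y → mult x (y ∷ M) ≡ mult x M
  mult-other {x} {y} M x≢y = trans (cong (_+ mult x M) (ind-no (x ℕ.≟ y) x≢y)) (+-identityˡ _)

  autL-↭ : ∀ {X M} → X ↭ M → autL X ≡ autL M
  autL-↭ Perm.refl         = refl
  autL-↭ (Perm.prep x p)   = cong₂ (λ m a → (1ℚ + m) * a) (∑-↭ p _) (autL-↭ p)
  autL-↭ (Perm.swap {X} {M} x y p) = trans
    (cong₂ (λ m a → (1ℚ + m) * a) (∑-↭ (Perm.prep y p) (λ z → ind (x ℕ.≟ z)))
      (cong₂ (λ m a → (1ℚ + m) * a) (∑-↭ p _) (autL-↭ p)))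
    (exchange (x ℕ.≟ y))
    where
    swap : ∀ a b c → a * (b * c) ≡ b * (a * c)
    swap = solve-∀ ℚ-ring
    exchange : Dec (x ≡ y) → (1ℚ + mult x (y ∷ M)) * ((1ℚ + mult y M) * autL M)
                           ≡ (1ℚ + mult y (x ∷ M)) * ((1ℚ + mult x M) * autL M)
    exchange (yes refl) = refl
    exchange (no x≢y)   = trans (cong (λ m → (1ℚ + m) * ((1ℚ + mult y M) * autL M)) (mult-other M x≢y))
      (trans (swap (1ℚ + mult x M) (1ℚ + mult y M) (autL M))
             (cong (λ m → (1ℚ + m) * ((1ℚ + mult x M) * autL M)) (sym (mult-other M (x≢y ∘ sym)))))
  autL-↭ (Perm.trans p q)  = trans (autL-↭ p) (autL-↭ q)

  lab : List ℕ → List ℕ → ℚ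
  lab X M = ind (X ↭? M) * autL M

  lab-↭ : ∀ {X X′} M → X ↭ X′ → lab X M ≡ lab X′ M
  lab-↭ {X} {X′} M p = cong (_* autL M) (ind-cong (X ↭? M) (X′ ↭? M) (trans (sym (sort-≡ p))) (trans (sort-≡ p)))

  private
    rotate₃ : ∀ a b c → a * (b * c) ≡ b * (a * c)
    rotate₃ = solve-∀ ℚ-ring

  -- In terms of bijections: `x` is matched with some equal entry of `M` and the rest is matched
  -- with the rest. `lab-column` does the same from the side of `M`.
  lab-row : ∀ x X M → lab (x ∷ X) M ≡ ∑ (picks M) (λ (y , R) → ind (x ℕ.≟ y) * lab X R)
  lab-row x X M = sym (begin
    ∑ (picks M) (λ (y , R) → ind (x ℕ.≟ y) * lab X R)
      ≡⟨ ∑-cong∈ (picks M) (λ {(y , R)} p → ind-guard (x ℕ.≟ y) (λ { refl → term (picks-↭ p) })) ⟩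
    ∑ (picks M) (λ (y , R) → ind (x ℕ.≟ y) * (ind ((x ∷ X) ↭? M) * autL X))
      ≡⟨ trans (sym (∑-* (picks M) (λ (y , R) → ind (x ℕ.≟ y)) _)) (cong (_* (ind ((x ∷ X) ↭? M) * autL X)) (∑-picks-proj₁ M (λ y → ind (x ℕ.≟ y)))) ⟩
    mult x M * (ind ((x ∷ X) ↭? M) * autL X)
      ≡⟨ rotate₃ (mult x M) (ind ((x ∷ X) ↭? M)) (autL X) ⟩
    ind ((x ∷ X) ↭? M) * (mult x M * autL X)
      ≡⟨ ind-guard ((x ∷ X) ↭? M) (λ eq → trans
           (cong (_* autL X) (trans (sym (∑-↭ (sort-≡⁻ {x ∷ X} {M} eq) (λ y → ind (x ℕ.≟ y)))) (mult-self x X)))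
           (autL-↭ (sort-≡⁻ {x ∷ X} {M} eq))) ⟩
    ind ((x ∷ X) ↭? M) * autL M ∎)
    where
    open ≡-Reasoning
    term : ∀ {R} → x ∷ R ↭ M → lab X R ≡ ind ((x ∷ X) ↭? M) * autL X
    term {R} p = trans (ind-guard (X ↭? R) (λ eq → sym (autL-↭ (sort-≡⁻ {X} {R} eq))))
      (cong (_* autL X) (ind-cong (X ↭? R) ((x ∷ X) ↭? M)
        (λ eq → sort-≡ (↭-trans (Perm.prep x (sort-≡⁻ {X} {R} eq)) p))
        (λ eq → sort-≡ (drop-∷ (↭-trans (sort-≡⁻ {x ∷ X} {M} eq) (↭-sym p))))))

  lab-column : ∀ X m M → lab X (m ∷ M) ≡ ∑ (picks X) (λ (x , R) → ind (m ℕ.≟ x) * lab R M)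
  lab-column X m M = sym (begin
    ∑ (picks X) (λ (x , R) → ind (m ℕ.≟ x) * lab R M)
      ≡⟨ ∑-cong∈ (picks X) (λ {(x , R)} p → ind-guard (m ℕ.≟ x) (λ { refl → term (picks-↭ p) })) ⟩
    ∑ (picks X) (λ (x , R) → ind (m ℕ.≟ x) * (ind (X ↭? (m ∷ M)) * autL M))
      ≡⟨ trans (sym (∑-* (picks X) (λ (x , R) → ind (m ℕ.≟ x)) _)) (cong (_* (ind (X ↭? (m ∷ M)) * autL M)) (∑-picks-proj₁ X (λ y → ind (m ℕ.≟ y)))) ⟩
    mult m X * (ind (X ↭? (m ∷ M)) * autL M)
      ≡⟨ rotate₃ (mult m X) (ind (X ↭? (m ∷ M))) (autL M) ⟩
    ind (X ↭? (m ∷ M)) * (mult m X * autL M)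
      ≡⟨ ind-guard (X ↭? (m ∷ M)) (λ eq → cong (_* autL M) (trans (∑-↭ (sort-≡⁻ {X} {m ∷ M} eq) (λ y → ind (m ℕ.≟ y))) (mult-self m M))) ⟩
    ind (X ↭? (m ∷ M)) * autL (m ∷ M) ∎)
    where
    open ≡-Reasoning
    term : ∀ {R} → m ∷ R ↭ X → lab R M ≡ ind (X ↭? (m ∷ M)) * autL M
    term {R} p = cong (_* autL M) (ind-cong (R ↭? M) (X ↭? (m ∷ M))
      (λ eq → sort-≡ (↭-trans (↭-sym p) (Perm.prep m (sort-≡⁻ {R} {M} eq))))
      (λ eq → sort-≡ (drop-∷ (↭-trans p (sort-≡⁻ {X} {m ∷ M} eq)))))

  -- Double counting. On the left 0 is made a fixed point or put at one of the `b` places of a cycle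
  -- of length `b`, and the result is matched with `M`. On the right the entry `y` matched with the
  -- cycle of 0 is chosen first: removing 0 deletes it if `y = 1` and otherwise shortens it to
  -- `pred y`, with `pred y` places for 0.
  lab-insert : ∀ K M →
    lab (1 ∷ K) M + ∑ (picks K) (λ (b , R) → fromℕ b * lab (suc b ∷ R) M)
    ≡ ∑ (picks M) (λ (y , S) → ind (1 ℕ.≟ y) * lab K S + fromℕ (ℕ.pred y) * lab K (ℕ.pred y ∷ S))
  lab-insert K M = begin
    lab (1 ∷ K) M + ∑ (picks K) (λ (b , R) → fromℕ b * lab (suc b ∷ R) M)
      ≡⟨ cong₂ _+_ (lab-row 1 K M) (trans (∑-cong (picks K) (λ (b , R) →
           trans (cong (fromℕ b *_) (lab-row (suc b) R M)) (*-∑ (fromℕ b) (picks M) (λ (y , S) → ind (suc b ℕ.≟ y) * lab R S))))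
           (∑-swap (picks K) (picks M) (λ (b , R) (y , S) → fromℕ b * (ind (suc b ℕ.≟ y) * lab R S)))) ⟩
    ∑ (picks M) (λ (y , S) → ind (1 ℕ.≟ y) * lab K S) + ∑ (picks M) (λ (y , S) → ∑ (picks K) (λ (b , R) → fromℕ b * (ind (suc b ℕ.≟ y) * lab R S)))
      ≡⟨ ∑-+ (picks M) (λ (y , S) → ind (1 ℕ.≟ y) * lab K S) (λ (y , S) → ∑ (picks K) (λ (b , R) → fromℕ b * (ind (suc b ℕ.≟ y) * lab R S))) ⟨
    ∑ (picks M) (λ (y , S) → ind (1 ℕ.≟ y) * lab K S + ∑ (picks K) (λ (b , R) → fromℕ b * (ind (suc b ℕ.≟ y) * lab R S)))
      ≡⟨ ∑-cong (picks M) (λ (y , S) → cong (ind (1 ℕ.≟ y) * lab K S +_)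
           (trans (∑-cong (picks K) (λ (b , R) → move y b (lab R S)))
           (trans (sym (*-∑ (fromℕ (ℕ.pred y)) (picks K) (λ (b , R) → ind (ℕ.pred y ℕ.≟ b) * lab R S)))
                  (cong (fromℕ (ℕ.pred y) *_) (sym (lab-column K (ℕ.pred y) S)))))) ⟩
    ∑ (picks M) (λ (y , S) → ind (1 ℕ.≟ y) * lab K S + fromℕ (ℕ.pred y) * lab K (ℕ.pred y ∷ S)) ∎
    where
    open ≡-Reasoning
    move : ∀ y b l → fromℕ b * (ind (suc b ℕ.≟ y) * l) ≡ fromℕ (ℕ.pred y) * (ind (ℕ.pred y ℕ.≟ b) * l)
    move zero    b l = trans (cong (fromℕ b *_) (*-zeroˡ l)) (trans (*-zeroʳ (fromℕ b)) (sym (*-zeroˡ (ind (0 ℕ.≟ b) * l))))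
    move (suc y) b l = begin
      fromℕ b * (ind (suc b ℕ.≟ suc y) * l)
        ≡⟨ rotate₃ (fromℕ b) (ind (suc b ℕ.≟ suc y)) l ⟩
      ind (suc b ℕ.≟ suc y) * (fromℕ b * l)
        ≡⟨ ind-guard (suc b ℕ.≟ suc y) (λ { refl → refl }) ⟩
      ind (suc b ℕ.≟ suc y) * (fromℕ y * l)
        ≡⟨ cong (_* (fromℕ y * l)) (ind-cong (suc b ℕ.≟ suc y) (y ℕ.≟ b) (λ { refl → refl }) (λ { refl → refl })) ⟩
      ind (y ℕ.≟ b) * (fromℕ y * l)
        ≡⟨ rotate₃ (ind (y ℕ.≟ b)) (fromℕ y) l ⟩
      fromℕ y * (ind (y ℕ.≟ b) * l) ∎

  labelled : ℕ → List ℕ → ℚ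
  labelled d M = ∑ (allPermutations d) (λ σ → lab (cycleType σ) M)

  module _ {d : ℕ} where

    labelled-suc : ∀ M → labelled (suc d) M
      ≡ ∑ (picks M) (λ (y , S) → ind (1 ℕ.≟ y) * labelled d S + fromℕ (ℕ.pred y) * labelled d (ℕ.pred y ∷ S))
    labelled-suc M = begin
      labelled (suc d) M
        ≡⟨ ∑-insertˡ {d} {φ = λ σ → lab (cycleType σ) M} (λ {π} {ρ} eq → cong (λ X → lab X M) (cycleType-cong {π = π} {ρ} eq)) ⟩
      ∑ (allFin (suc d)) (λ j → ∑ (allPermutations d) (λ ρ → lab (cycleType (transpose zero j ∘ₚ lift₀ ρ)) M))
        ≡⟨ ∑-swap (allFin (suc d)) (allPermutations d) (λ j ρ → lab (cycleType (transpose zero j ∘ₚ lift₀ ρ)) M) ⟩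
      ∑ (allPermutations d) (λ ρ → ∑ (allFin (suc d)) (λ j → lab (cycleType (transpose zero j ∘ₚ lift₀ ρ)) M))
        ≡⟨ ∑-cong (allPermutations d) inserted ⟩
      ∑ (allPermutations d) (λ ρ → ∑ (picks M) (λ (y , S) → ind (1 ℕ.≟ y) * lab (cycleType ρ) S + fromℕ (ℕ.pred y) * lab (cycleType ρ) (ℕ.pred y ∷ S)))
        ≡⟨ ∑-swap (allPermutations d) (picks M) _ ⟩
      ∑ (picks M) (λ (y , S) → ∑ (allPermutations d) (λ ρ → ind (1 ℕ.≟ y) * lab (cycleType ρ) S + fromℕ (ℕ.pred y) * lab (cycleType ρ) (ℕ.pred y ∷ S)))
        ≡⟨ ∑-cong (picks M) (λ (y , S) → trans (∑-+ (allPermutations d) (λ ρ → ind (1 ℕ.≟ y) * lab (cycleType ρ) S) (λ ρ → fromℕ (ℕ.pred y) * lab (cycleType ρ) (ℕ.pred y ∷ S)))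
             (cong₂ _+_ (sym (*-∑ (ind (1 ℕ.≟ y)) (allPermutations d) (λ ρ → lab (cycleType ρ) S)))
                        (sym (*-∑ (fromℕ (ℕ.pred y)) (allPermutations d) (λ ρ → lab (cycleType ρ) (ℕ.pred y ∷ S)))))) ⟩
      ∑ (picks M) (λ (y , S) → ind (1 ℕ.≟ y) * labelled d S + fromℕ (ℕ.pred y) * labelled d (ℕ.pred y ∷ S)) ∎
      where
      open ≡-Reasoning
      inserted : ∀ ρ → ∑ (allFin (suc d)) (λ j → lab (cycleType (transpose zero j ∘ₚ lift₀ ρ)) M)
        ≡ ∑ (picks M) (λ (y , S) → ind (1 ℕ.≟ y) * lab (cycleType ρ) S + fromℕ (ℕ.pred y) * lab (cycleType ρ) (ℕ.pred y ∷ S))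
      inserted ρ = begin
        ∑ (allFin (suc d)) (λ j → lab (cycleType (transpose zero j ∘ₚ lift₀ ρ)) M)
          ≡⟨ ∑-allFin-suc (λ j → lab (cycleType (transpose zero j ∘ₚ lift₀ ρ)) M) ⟩
        lab (cycleType (transpose zero zero ∘ₚ lift₀ ρ)) M + ∑ (allFin d) (λ i → lab (cycleType (transpose zero (suc i) ∘ₚ lift₀ ρ)) M)
          ≡⟨ cong₂ _+_ (trans (cong (λ X → lab X M) (cycleType-cong {π = transpose zero zero ∘ₚ lift₀ ρ} {lift₀ ρ} (λ k → cong (lift₀ ρ ⟨$⟩ʳ_) (transpose-id zero k))))
                              (lab-↭ M (cycleType-lift c)))
               (∑-cycles c _ (λ b R → lab (suc b ∷ R) M) (λ c′ → lab-↭ M (cycleType-insert c′))) ⟩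
        lab (1 ∷ map length L) M + ∑ (picks (map length L)) (λ (b , R) → fromℕ b * lab (suc b ∷ R) M)
          ≡⟨ lab-insert (map length L) M ⟩
        ∑ (picks M) (λ (y , S) → ind (1 ℕ.≟ y) * lab (map length L) S + fromℕ (ℕ.pred y) * lab (map length L) (ℕ.pred y ∷ S))
          ≡⟨ ∑-cong (picks M) (λ (y , S) → cong₂ (λ u v → ind (1 ℕ.≟ y) * u + fromℕ (ℕ.pred y) * v) (lab-↭ S (↭-sym (cycleType-↭ c))) (lab-↭ (ℕ.pred y ∷ S) (↭-sym (cycleType-↭ c)))) ⟩
        ∑ (picks M) (λ (y , S) → ind (1 ℕ.≟ y) * lab (cycleType ρ) S + fromℕ (ℕ.pred y) * lab (cycleType ρ) (ℕ.pred y ∷ S)) ∎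
        where
        L = proj₁ (cycles-exist ρ)
        c = proj₂ (cycles-exist ρ)

  -- After multiplication of the recursion by the product of the parts, the term of `y` is `y * d!`
  -- by induction: the factor `pred y` supplies the shortened part and `y` is left over. The parts
  -- add up to `suc d`.
  labelled-! : ∀ d M → All (0 <_) M → sum M ≡ d → labelled d M * fromℕ (product M) ≡ fromℕ (d !)
  labelled-! zero []            _             _  = refl
  labelled-! zero (zero ∷ M)    (() ∷ _)      _
  labelled-! (suc d) M pos eq = begin
    labelled (suc d) M * fromℕ (product M)
      ≡⟨ trans (cong (_* fromℕ (product M)) (labelled-suc {d} M)) (∑-* (picks M) (λ (y , S) → ind (1 ℕ.≟ y) * labelled d S + fromℕ (ℕ.pred y) * labelled d (ℕ.pred y ∷ S)) (fromℕ (product M))) ⟩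
    ∑ (picks M) (λ (y , S) → (ind (1 ℕ.≟ y) * labelled d S + fromℕ (ℕ.pred y) * labelled d (ℕ.pred y ∷ S)) * fromℕ (product M))
      ≡⟨ ∑-cong∈ (picks M) (λ {(y , S)} p → term y S (picks-↭ p)) ⟩
    ∑ (picks M) (λ (y , S) → fromℕ y * fromℕ (d !))
      ≡⟨ trans (sym (∑-* (picks M) (fromℕ ∘ proj₁) (fromℕ (d !)))) (cong (_* fromℕ (d !)) (trans (∑-picks-sum M) (cong fromℕ eq))) ⟩
    fromℕ (suc d) * fromℕ (d !)
      ≡⟨ fromℕ-* (suc d) (d !) ⟨
    fromℕ (suc d !) ∎
    where
    open ≡-Reasoning
    one : ∀ l z p → (1ℚ * l + 0ℚ * z) * p ≡ l * p
    one = solve-∀ ℚ-ring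
    more : ∀ x y l l′ p → (0ℚ * l + x * l′) * (y * p) ≡ y * (l′ * (x * p))
    more = solve-∀ ℚ-ring
    term : ∀ y S → y ∷ S ↭ M →
      (ind (1 ℕ.≟ y) * labelled d S + fromℕ (ℕ.pred y) * labelled d (ℕ.pred y ∷ S)) * fromℕ (product M) ≡ fromℕ y * fromℕ (d !)
    term y S perm with All-resp-↭ (↭-sym perm) pos | trans (sum-↭ perm) eq
    term (suc zero) S perm | _ ∷ posS | eq′ = begin
      (1ℚ * labelled d S + 0ℚ * labelled d (0 ∷ S)) * fromℕ (product M)
        ≡⟨ one (labelled d S) (labelled d (0 ∷ S)) (fromℕ (product M)) ⟩
      labelled d S * fromℕ (product M)
        ≡⟨ cong (λ n → labelled d S * fromℕ n) (trans (sym (product-↭ perm)) (ℕ.*-identityˡ (product S))) ⟩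
      labelled d S * fromℕ (product S)
        ≡⟨ labelled-! d S posS (ℕ.suc-injective eq′) ⟩
      fromℕ (d !)
        ≡⟨ *-identityˡ (fromℕ (d !)) ⟨
      1ℚ * fromℕ (d !) ∎
    term y@(suc x@(suc _)) S perm | _ ∷ posS | eq′ = begin
      (0ℚ * labelled d S + fromℕ x * labelled d (x ∷ S)) * fromℕ (product M)
        ≡⟨ cong ((0ℚ * labelled d S + fromℕ x * labelled d (x ∷ S)) *_) (trans (cong fromℕ (sym (product-↭ perm))) (fromℕ-* y (product S))) ⟩
      (0ℚ * labelled d S + fromℕ x * labelled d (x ∷ S)) * (fromℕ y * fromℕ (product S))
        ≡⟨ more (fromℕ x) (fromℕ y) (labelled d S) (labelled d (x ∷ S)) (fromℕ (product S)) ⟩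
      fromℕ y * (labelled d (x ∷ S) * (fromℕ x * fromℕ (product S)))
        ≡⟨ cong (λ z → fromℕ y * (labelled d (x ∷ S) * z)) (fromℕ-* x (product S)) ⟨
      fromℕ y * (labelled d (x ∷ S) * fromℕ (product (x ∷ S)))
        ≡⟨ cong (fromℕ y *_) (labelled-! d (x ∷ S) (ℕ.s≤s ℕ.z≤n ∷ posS) (ℕ.suc-injective eq′)) ⟩
      fromℕ y * fromℕ (d !) ∎

  product-update : ∀ N (f g : ℕ → ℕ) k c → k < N → f k ≡ c ℕ.* g k → (∀ i → i ≢ k → f i ≡ g i) →
    product (applyUpTo f N) ≡ c ℕ.* product (applyUpTo g N)
  product-update (suc N) f g zero    c _ eq eqs = trans
    (cong₂ ℕ._*_ eq (same N (f ∘ suc) (g ∘ suc) (λ i → eqs (suc i) (λ ()))))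
    (ℕ.*-assoc c (g 0) _)
    where
    same : ∀ N (f g : ℕ → ℕ) → (∀ i → f i ≡ g i) → product (applyUpTo f N) ≡ product (applyUpTo g N)
    same zero    f g eq = refl
    same (suc N) f g eq = cong₂ ℕ._*_ (eq 0) (same N (f ∘ suc) (g ∘ suc) (eq ∘ suc))
  product-update (suc N) f g (suc k) c (ℕ.s≤s k<N) eq eqs = begin
    f 0 ℕ.* product (applyUpTo (f ∘ suc) N)
      ≡⟨ cong₂ ℕ._*_ (eqs 0 (λ ())) (product-update N (f ∘ suc) (g ∘ suc) k c k<N eq (λ i i≢k → eqs (suc i) (i≢k ∘ ℕ.suc-injective))) ⟩
    g 0 ℕ.* (c ℕ.* product (applyUpTo (g ∘ suc) N))
      ≡⟨ trans (sym (ℕ.*-assoc (g 0) c p)) (trans (cong (ℕ._* p) (ℕ.*-comm (g 0) c)) (ℕ.*-assoc c (g 0) p)) ⟩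
    c ℕ.* (g 0 ℕ.* product (applyUpTo (g ∘ suc) N)) ∎
    where
    open ≡-Reasoning
    p = product (applyUpTo (g ∘ suc) N)

  count-self : ∀ {n} x (β : Vec ℕ n) → Vec.count (ℕ._≟ x) (x ∷ β) ≡ suc (Vec.count (ℕ._≟ x) β)
  count-self x β = cong (λ b → (if b then suc else id) (Vec.count (ℕ._≟ x) β)) (dec-true (x ℕ.≟ x) refl)

  count-other : ∀ {n} {x y} (β : Vec ℕ n) → y ≢ x → Vec.count (ℕ._≟ x) (y ∷ β) ≡ Vec.count (ℕ._≟ x) β
  count-other {x = x} {y} β y≢x = cong (λ b → (if b then suc else id) (Vec.count (ℕ._≟ x) β)) (dec-false (y ℕ.≟ x) y≢x)

  mult-count : ∀ {n} x (β : Vec ℕ n) → mult x (toList β) ≡ fromℕ (Vec.count (ℕ._≟ x) β)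
  mult-count x []      = refl
  mult-count x (y ∷ β) with x ℕ.≟ y
  ... | yes refl = trans (mult-self x (toList β)) (trans (cong (1ℚ +_) (mult-count x β))
    (trans (sym (fromℕ-suc (Vec.count (ℕ._≟ x) β))) (cong fromℕ (sym (count-self x β)))))
  ... | no x≢y   = trans (mult-other (toList β) x≢y) (trans (mult-count x β) (cong fromℕ (sym (count-other β (x≢y ∘ sym)))))

  -- The range `N` is independent of `β`, so it stays fixed while the induction removes parts;
  -- multiplicity 0 contributes the factor 1.
  aut-upTo : ∀ {n} N (β : Vec ℕ n) → VecAll.All (λ b → 0 < b × b ≤ N) β →
    fromℕ (product (applyUpTo (λ i → Vec.count (ℕ._≟ suc i) β !) N)) ≡ autL (toList β)
  aut-upTo N [] _ = cong fromℕ (ones N)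
    where
    ones : ∀ N → product (applyUpTo (λ _ → 1) N) ≡ 1
    ones zero    = refl
    ones (suc N) = trans (ℕ.+-identityʳ _) (ones N)
  aut-upTo N (suc b ∷ β) ((_ , b<N) VecAll.∷ bounds) = begin
    fromℕ (product (applyUpTo (λ i → Vec.count (ℕ._≟ suc i) (suc b ∷ β) !) N))
      ≡⟨ cong fromℕ (product-update N (λ i → Vec.count (ℕ._≟ suc i) (suc b ∷ β) !) (λ i → Vec.count (ℕ._≟ suc i) β !) b (suc (Vec.count (ℕ._≟ suc b) β)) b<N
           (cong _! (count-self (suc b) β)) (λ i i≢b → cong _! (count-other β (i≢b ∘ sym ∘ ℕ.suc-injective)))) ⟩
    fromℕ (suc (Vec.count (ℕ._≟ suc b) β) ℕ.* product (applyUpTo (λ i → Vec.count (ℕ._≟ suc i) β !) N))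
      ≡⟨ fromℕ-* (suc (Vec.count (ℕ._≟ suc b) β)) (product (applyUpTo (λ i → Vec.count (ℕ._≟ suc i) β !) N)) ⟩
    fromℕ (suc (Vec.count (ℕ._≟ suc b) β)) * fromℕ (product (applyUpTo (λ i → Vec.count (ℕ._≟ suc i) β !) N))
      ≡⟨ cong₂ _*_ (trans (fromℕ-suc (Vec.count (ℕ._≟ suc b) β)) (cong (1ℚ +_) (sym (mult-count (suc b) β)))) (aut-upTo N β bounds) ⟩
    autL (suc b ∷ toList β) ∎
    where
    open ≡-Reasoning

  aut-≡ : ∀ {n} (β : Vec ℕ n) → VecAll.All (0 <_) β → fromℕ (aut β) ≡ autL (toList β)
  aut-≡ β pos = trans (cong (fromℕ ∘ product) (List.map-upTo (λ i → Vec.count (ℕ._≟ suc i) β !) (Vec.sum β))) (aut-upTo (Vec.sum β) β (bounds β pos ℕ.≤-refl))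
    where
    bounds : ∀ {n} (β : Vec ℕ n) {N} → VecAll.All (0 <_) β → Vec.sum β ≤ N → VecAll.All (λ b → 0 < b × b ≤ N) β
    bounds []      VecAll.[]        _  = VecAll.[]
    bounds (b ∷ β) (p VecAll.∷ pos) le = (p , ℕ.≤-trans (ℕ.m≤m+n b (Vec.sum β)) le) VecAll.∷ bounds β pos (ℕ.≤-trans (ℕ.m≤n+m (Vec.sum β) b) le)

  class? : ∀ {d n} (β : Vec ℕ n) (σ : Permutation′ d) → Dec (cycleType σ ≡ partition β)
  class? β σ = List.≡-dec ℕ._≟_ (cycleType σ) (partition β)

  classSize : ∀ {n} (β : Vec ℕ n) → VecAll.All (0 <_) β →
    ∑ (allPermutations (Vec.sum β)) (λ σ → ind (class? β σ)) * fromℕ (aut β) * fromℕ (product (toList β)) ≡ fromℕ (Vec.sum β !)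
  classSize β pos = trans (cong (_* fromℕ (product (toList β))) (trans (∑-* (allPermutations (Vec.sum β)) (λ σ → ind (class? β σ)) (fromℕ (aut β)))
      (∑-cong (allPermutations (Vec.sum β)) (λ σ → cong₂ _*_ (ind-cong (class? β σ) (cycleType σ ↭? toList β) (trans (sorted σ)) (trans (sym (sorted σ)))) (aut-≡ β pos)))))
    (labelled-! (Vec.sum β) (toList β) (positive β pos) (sum-toList β))
    where
    sorted : ∀ {d} (σ : Permutation′ d) → sort (cycleType σ) ≡ cycleType σ
    sorted σ = let L , c = cycles-exist σ in trans (sort-≡ (cycleType-↭ c)) (sym (cycleType-≡ c))
    positive : ∀ {n} (β : Vec ℕ n) → VecAll.All (0 <_) β → All (0 <_) (toList β)
    positive []      VecAll.[]        = []
    positive (b ∷ β) (p VecAll.∷ pos) = p ∷ positive β pos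
    sum-toList : ∀ {n} (β : Vec ℕ n) → sum (toList β) ≡ Vec.sum β
    sum-toList []      = refl
    sum-toList (b ∷ β) = cong (b ℕ.+_) (sum-toList β)

-- Polynomial functions of two variables: difference equations with control of the degree.

module PolynomialFunctions where

  open import Data.Rational using (_+_; _*_; _-_; -_)
  open import Data.Rational.Properties
  open Sums
  open CutAndJoin using (G)

  open ≡-Reasoning

  abstract

    inv : (n : ℕ) .{{_ : ℕ.NonZero n}} → ℚ
    inv n = ℤ.+ 1 / n

    inv-* : ∀ n .{{_ : ℕ.NonZero n}} → inv n * fromℕ n ≡ 1ℚ
    inv-* n = /-*-fromℕ 1 n

    inv-positive : ∀ n .{{_ : ℕ.NonZero n}} → ℚ.Positive (inv n)
    inv-positive n = normalize-pos 1 n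

  ^-+ : ∀ x m n → x ^ (m ℕ.+ n) ≡ x ^ m * x ^ n
  ^-+ x zero    n = sym (*-identityˡ (x ^ n))
  ^-+ x (suc m) n = trans (cong (x *_) (^-+ x m n)) (sym (*-assoc x (x ^ m) (x ^ n)))

  ^-* : ∀ x y n → (x * y) ^ n ≡ x ^ n * y ^ n
  ^-* x y zero    = refl
  ^-* x y (suc n) = trans (cong (x * y *_) (^-* x y n)) (lemma x y (x ^ n) (y ^ n))
    where
    lemma : ∀ x y p q → x * y * (p * q) ≡ x * p * (y * q)
    lemma = solve-∀ ℚ-ring

  -- W D holds of the polynomial functions of total degree below D.

  data W : ℕ → (ℚ → ℚ → ℚ) → Set where
    mono : ∀ {D} c a b → a ℕ.+ b < D → W D (λ d y → c * (d ^ a * y ^ b))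
    none : ∀ {D} → W D (λ _ _ → 0ℚ)
    plus : ∀ {D f g} → W D f → W D g → W D (λ d y → f d y + g d y)
    ext  : ∀ {D f g} → W D f → (∀ d y → f d y ≡ g d y) → W D g

  private
    variable
      D D′ k : ℕ
      f g : ℚ → ℚ → ℚ

  W-≤ : D ≤ D′ → W D f → W D′ f
  W-≤ le (mono c a b lt) = mono c a b (ℕ.≤-trans lt le)
  W-≤ le none            = none
  W-≤ le (plus p q)      = plus (W-≤ le p) (W-≤ le q)
  W-≤ le (ext p eq)      = ext (W-≤ le p) eq

  W-* : W (suc D) f → W D′ g → W (D ℕ.+ D′) (λ d y → f d y * g d y)
  W-* {D} {D′ = D′} (mono c a b lt) q = go q
    where
    combine : ∀ c d p q r s → c * d * (p * r * (q * s)) ≡ c * (p * q) * (d * (r * s))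
    combine = solve-∀ ℚ-ring
    rearrange : ∀ a b a′ b′ → a ℕ.+ a′ ℕ.+ (b ℕ.+ b′) ≡ a ℕ.+ b ℕ.+ (a′ ℕ.+ b′)
    rearrange = ℕ-Solver.solve-∀
    go : ∀ {g} → W D′ g → W (D ℕ.+ D′) (λ d y → c * (d ^ a * y ^ b) * g d y)
    go (mono c′ a′ b′ lt′) = ext
      (mono (c * c′) (a ℕ.+ a′) (b ℕ.+ b′) (ℕ.≤-trans (ℕ.≤-reflexive (cong suc (rearrange a b a′ b′))) (ℕ.+-mono-≤-< (ℕ.s≤s⁻¹ lt) lt′)))
      (λ d y → trans (cong₂ (λ u v → c * c′ * (u * v)) (^-+ d a a′) (^-+ y b b′)) (combine c c′ (d ^ a) (y ^ b) (d ^ a′) (y ^ b′)))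
    go none                = ext none (λ d y → sym (*-zeroʳ (c * (d ^ a * y ^ b))))
    go (plus {f = f} {g} p q) = ext (plus (go p) (go q)) (λ d y → sym (*-distribˡ-+ (c * (d ^ a * y ^ b)) (f d y) (g d y)))
    go (ext p eq)          = ext (go p) (λ d y → cong (c * (d ^ a * y ^ b) *_) (eq d y))
  W-* {g = g} none                    q = ext none (λ d y → sym (*-zeroˡ (g d y)))
  W-* {g = g} (plus {f = f₁} {f₂} p₁ p₂) q = ext (plus (W-* p₁ q) (W-* p₂ q)) (λ d y → sym (*-distribʳ-+ (g d y) (f₁ d y) (f₂ d y)))
  W-* {g = g} (ext p eq)              q = ext (W-* p q) (λ d y → cong (_* g d y) (eq d y))

  W-const : ∀ c → W (suc D) (λ _ _ → c)
  W-const c = ext (mono c 0 0 (ℕ.s≤s ℕ.z≤n)) (λ _ _ → *-identityʳ c)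

  W-scale : ∀ c → W D f → W D (λ d y → c * f d y)
  W-scale c p = W-* {0} (W-const c) p

  W-minus : W D f → W D g → W D (λ d y → f d y - g d y)
  W-minus {f = f} {g = g} p q = ext (plus p (W-scale (- 1ℚ) q)) (λ d y → lemma (f d y) (g d y))
    where
    lemma : ∀ a b → a + - 1ℚ * b ≡ a - b
    lemma = solve-∀ ℚ-ring

  W-d^ : ∀ a → W (suc a) (λ d y → d ^ a)
  W-d^ a = ext (mono 1ℚ a 0 (ℕ.s≤s (ℕ.≤-reflexive (ℕ.+-identityʳ a)))) (λ d y → trans (*-identityˡ _) (*-identityʳ (d ^ a)))

  W-y^ : ∀ b → W (suc b) (λ d y → y ^ b)
  W-y^ b = ext (mono 1ℚ 0 b ℕ.≤-refl) (λ d y → trans (*-identityˡ _) (*-identityˡ (y ^ b)))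

  W-d : W 2 (λ d y → d)
  W-d = ext (W-d^ 1) (λ d y → *-identityʳ d)

  W-y : W 2 (λ d y → y)
  W-y = ext (W-y^ 1) (λ d y → *-identityʳ y)

  W-^ : ∀ {k} → W (suc k) f → ∀ m → W (suc (m ℕ.* k)) (λ d y → f d y ^ m)
  W-^ p zero            = W-const 1ℚ
  W-^ {k = k} p (suc m) = W-≤ (ℕ.≤-reflexive (ℕ.+-suc k (m ℕ.* k))) (W-* p (W-^ p m))

  W-shift : W D f → W D (λ d y → f d (y - d + 1ℚ))
  W-shift (mono c a b lt) = W-≤ (ℕ.≤-trans (ℕ.≤-reflexive (lemma a b)) lt) (W-scale c (W-* (W-d^ a) (W-^ W-arg b)))
    where
    lemma : ∀ a b → a ℕ.+ suc (b ℕ.* 1) ≡ suc (a ℕ.+ b)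
    lemma = ℕ-Solver.solve-∀
    W-arg : W 2 (λ d y → y - d + 1ℚ)
    W-arg = plus (W-minus W-y W-d) (W-const 1ℚ)
  W-shift none       = none
  W-shift (plus p q) = plus (W-shift p) (W-shift q)
  W-shift (ext p eq) = ext (W-shift p) (λ d y → eq d (y - d + 1ℚ))

  -- The binomial expansion to second order. `B` has degree one less than the bound for `A`, so
  -- everything after the linear term lies at least two degrees below the bound for the leading
  -- power.
  W-binomial : ∀ {a A B} → W (suc (suc a)) A → W (suc a) B → ∀ m → ∃ λ r → W (m ℕ.+ suc m ℕ.* a) r ×
    ∀ d y → (A d y + B d y) ^ suc m ≡ A d y ^ suc m + fromℕ (suc m) * (A d y ^ m * B d y) + r d y
  W-binomial {A = A} {B} pA pB zero = (λ _ _ → 0ℚ) , none , λ d y → lemma (A d y) (B d y)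
    where
    lemma : ∀ a b → (a + b) * 1ℚ ≡ a * 1ℚ + 1ℚ * (1ℚ * b) + 0ℚ
    lemma = solve-∀ ℚ-ring
  W-binomial {a} {A} {B} pA pB (suc m) with W-binomial pA pB m
  ... | r , pr , eq = (λ d y → fromℕ (suc m) * (A d y ^ m * (B d y * B d y)) + (A d y + B d y) * r d y)
    , plus (W-≤ (ℕ.≤-reflexive (degree₁ m a)) (W-scale (fromℕ (suc m)) (W-* (W-^ pA m) (W-* pB pB))))
           (W-≤ (ℕ.≤-reflexive (degree₂ m a)) (W-* (plus pA (W-≤ (ℕ.n≤1+n (suc a)) pB)) pr))
    , λ d y → begin
      (A d y + B d y) * (A d y + B d y) ^ suc m
        ≡⟨ cong ((A d y + B d y) *_) (eq d y) ⟩
      (A d y + B d y) * (A d y * A d y ^ m + fromℕ (suc m) * (A d y ^ m * B d y) + r d y)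
        ≡⟨ lemma (A d y) (B d y) (A d y ^ m) (fromℕ (suc m)) (r d y) ⟩
      A d y * (A d y * A d y ^ m) + (1ℚ + fromℕ (suc m)) * (A d y * A d y ^ m * B d y)
        + (fromℕ (suc m) * (A d y ^ m * (B d y * B d y)) + (A d y + B d y) * r d y)
        ≡⟨ cong (λ n → A d y * (A d y * A d y ^ m) + n * (A d y * A d y ^ m * B d y)
                       + (fromℕ (suc m) * (A d y ^ m * (B d y * B d y)) + (A d y + B d y) * r d y)) (fromℕ-suc (suc m)) ⟨
      A d y * (A d y * A d y ^ m) + fromℕ (suc (suc m)) * (A d y * A d y ^ m * B d y)
        + (fromℕ (suc m) * (A d y ^ m * (B d y * B d y)) + (A d y + B d y) * r d y) ∎
    where
    degree₁ : ∀ m a → m ℕ.* suc a ℕ.+ (a ℕ.+ suc a) ≡ suc m ℕ.+ suc (suc m) ℕ.* a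
    degree₁ = ℕ-Solver.solve-∀
    degree₂ : ∀ m a → suc a ℕ.+ (m ℕ.+ suc m ℕ.* a) ≡ suc m ℕ.+ suc (suc m) ℕ.* a
    degree₂ = ℕ-Solver.solve-∀
    lemma : ∀ a b p n r → (a + b) * (a * p + n * (p * b) + r)
      ≡ a * (a * p) + (1ℚ + n) * (a * p * b) + (n * (p * (b * b)) + (a + b) * r)
    lemma = solve-∀ ℚ-ring

  -- The unknown is written as `d F`, so that a sum vanishing at `d = 0` comes with its factor `d`
  -- already split off. A monomial is matched to leading order; the error has smaller degree and is
  -- treated by recursion on the bound.
  antidifference-d : ∀ D {f} → W D f → ∃ λ F → W D F × ∀ d y → (d + 1ℚ) * F (d + 1ℚ) y - d * F d y ≡ f d y
  antidifference-d (suc D) (mono c a b lt) with W-binomial {0} W-d (W-const 1ℚ) a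
  ... | r , pr , eq with antidifference-d D (W-scale (c * inv (suc a)) (W-≤ degree (W-* (W-y^ b) pr)))
    where
    degree : b ℕ.+ (a ℕ.+ suc a ℕ.* 0) ≤ D
    degree = ℕ.≤-trans (ℕ.≤-reflexive (lemma a b)) (ℕ.s≤s⁻¹ lt)
      where
      lemma : ∀ a b → b ℕ.+ (a ℕ.+ suc a ℕ.* 0) ≡ a ℕ.+ b
      lemma = ℕ-Solver.solve-∀
  ...   | F , pF , eqF = (λ d y → κ * (d ^ a * y ^ b) - F d y)
    , W-minus (mono κ a b lt) (W-≤ (ℕ.n≤1+n D) pF)
    , λ d y → begin
      (d + 1ℚ) * (κ * ((d + 1ℚ) ^ a * y ^ b) - F (d + 1ℚ) y) - d * (κ * (d ^ a * y ^ b) - F d y)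
        ≡⟨ expand d κ ((d + 1ℚ) ^ a) (d ^ a) (y ^ b) (F (d + 1ℚ) y) (F d y) ⟩
      κ * y ^ b * ((d + 1ℚ) * (d + 1ℚ) ^ a - d * d ^ a) - ((d + 1ℚ) * F (d + 1ℚ) y - d * F d y)
        ≡⟨ cong₂ (λ u v → κ * y ^ b * (u - d * d ^ a) - v) (eq d y) (eqF d y) ⟩
      κ * y ^ b * (d * d ^ a + fromℕ (suc a) * (d ^ a * 1ℚ) + r d y - d * d ^ a) - κ * (y ^ b * r d y)
        ≡⟨ collapse d c (inv (suc a)) (fromℕ (suc a)) (d ^ a) (y ^ b) (r d y) ⟩
      c * (d ^ a * y ^ b) * (inv (suc a) * fromℕ (suc a))
        ≡⟨ trans (cong (c * (d ^ a * y ^ b) *_) (inv-* (suc a))) (*-identityʳ _) ⟩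
      c * (d ^ a * y ^ b) ∎
    where
    κ : ℚ
    κ = c * inv (suc a)
    expand : ∀ d k P p z F₁ F₀ → (d + 1ℚ) * (k * (P * z) - F₁) - d * (k * (p * z) - F₀)
      ≡ k * z * ((d + 1ℚ) * P - d * p) - ((d + 1ℚ) * F₁ - d * F₀)
    expand = solve-∀ ℚ-ring
    collapse : ∀ d c i n p z r → c * i * z * (d * p + n * (p * 1ℚ) + r - d * p) - c * i * (z * r) ≡ c * (p * z) * (i * n)
    collapse = solve-∀ ℚ-ring
  antidifference-d D none = (λ _ _ → 0ℚ) , none , λ d y → lemma d
    where
    lemma : ∀ d → (d + 1ℚ) * 0ℚ - d * 0ℚ ≡ 0ℚ
    lemma = solve-∀ ℚ-ring
  antidifference-d D (plus p q) with antidifference-d D p | antidifference-d D q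
  ... | F , pF , eqF | H , pH , eqH = _ , plus pF pH , λ d y →
    trans (lemma d (F (d + 1ℚ) y) (F d y) (H (d + 1ℚ) y) (H d y)) (cong₂ _+_ (eqF d y) (eqH d y))
    where
    lemma : ∀ d a b a′ b′ → (d + 1ℚ) * (a + a′) - d * (b + b′) ≡ (d + 1ℚ) * a - d * b + ((d + 1ℚ) * a′ - d * b′)
    lemma = solve-∀ ℚ-ring
  antidifference-d D (ext p eq) with antidifference-d D p
  ... | F , pF , eqF = F , pF , λ d y → trans (eqF d y) (eq d y)

  central-difference : ∀ b → ∃ λ r → W b r ×
    ∀ d y → (y + 1ℚ) ^ suc b - (y - 1ℚ) ^ suc b ≡ 2ℚ * fromℕ (suc b) * y ^ b + r d y
  central-difference b =
    (λ d y → r₊ d y - r₋ d y) , W-≤ (ℕ.≤-reflexive (degree b)) (W-minus (proj₁ (proj₂ plus-one)) (proj₁ (proj₂ minus-one))) , λ d y →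
    trans (cong₂ _-_ (proj₂ (proj₂ plus-one) d y) (proj₂ (proj₂ minus-one) d y))
          (lemma (y ^ suc b) (fromℕ (suc b)) (y ^ b) (r₊ d y) (r₋ d y))
    where
    plus-one  = W-binomial {0} W-y (W-const 1ℚ) b
    minus-one = W-binomial {0} W-y (W-const (- 1ℚ)) b
    r₊ r₋ : ℚ → ℚ → ℚ
    r₊ = proj₁ plus-one
    r₋ = proj₁ minus-one
    degree : ∀ b → b ℕ.+ suc b ℕ.* 0 ≡ b
    degree = ℕ-Solver.solve-∀
    lemma : ∀ x n z r s → x + n * (z * 1ℚ) + r - (x + n * (z * - 1ℚ) + s) ≡ (1ℚ + 1ℚ) * n * z + (r - s)
    lemma = solve-∀ ℚ-ring

  private
    HasAntidifference : ℕ → (ℚ → ℚ → ℚ) → Set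
    HasAntidifference D f = ∃ λ F → W D F × ∀ d y → F d (y + 1ℚ) - F d (y - 1ℚ) ≡ f d y

    module Monomial {D : ℕ} (c : ℚ) (a b : ℕ) (lt : a ℕ.+ b ≤ D) where

      κ : ℚ
      -- Divides by `2 (b + 1)`, the leading coefficient of the central difference of `y ^ suc b`;
      -- the error is then of lower degree.
      κ = c * inv 2 * inv (suc b)

      r : ℚ → ℚ → ℚ
      r = proj₁ (central-difference b)

      remainder : ℚ → ℚ → ℚ
      remainder d y = κ * (d ^ a * r d y)

      W-remainder : W D remainder
      W-remainder = W-scale κ (W-≤ lt (W-* (W-d^ a) (proj₁ (proj₂ (central-difference b)))))

      antidifference : HasAntidifference (suc D) remainder → HasAntidifference (suc (suc D)) (λ d y → c * (d ^ a * y ^ b))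
      antidifference (F , pF , eqF) = (λ d y → κ * (d ^ a * y ^ suc b) - F d y) , W-F , λ d y → begin
        κ * (d ^ a * (y + 1ℚ) ^ suc b) - F d (y + 1ℚ) - (κ * (d ^ a * (y - 1ℚ) ^ suc b) - F d (y - 1ℚ))
          ≡⟨ expand κ (d ^ a) ((y + 1ℚ) ^ suc b) ((y - 1ℚ) ^ suc b) (F d (y + 1ℚ)) (F d (y - 1ℚ)) ⟩
        κ * (d ^ a * ((y + 1ℚ) ^ suc b - (y - 1ℚ) ^ suc b)) - (F d (y + 1ℚ) - F d (y - 1ℚ))
          ≡⟨ cong₂ (λ u v → κ * (d ^ a * u) - v) (proj₂ (proj₂ (central-difference b)) d y) (eqF d y) ⟩
        κ * (d ^ a * (2ℚ * fromℕ (suc b) * y ^ b + r d y)) - κ * (d ^ a * r d y)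
          ≡⟨ collapse c (inv 2) (inv (suc b)) (d ^ a) (fromℕ (suc b)) (y ^ b) (r d y) ⟩
        c * (d ^ a * y ^ b) * (inv 2 * 2ℚ * (inv (suc b) * fromℕ (suc b)))
          ≡⟨ cong₂ (λ u v → c * (d ^ a * y ^ b) * (u * v)) (inv-* 2) (inv-* (suc b)) ⟩
        c * (d ^ a * y ^ b) * (1ℚ * 1ℚ)
          ≡⟨ *-identityʳ (c * (d ^ a * y ^ b)) ⟩
        c * (d ^ a * y ^ b) ∎
        where
        W-F : W (suc (suc D)) (λ d y → κ * (d ^ a * y ^ suc b) - F d y)
        W-F = W-minus (mono κ a (suc b) (ℕ.≤-trans (ℕ.≤-reflexive (cong suc (ℕ.+-suc a b))) (ℕ.s≤s (ℕ.s≤s lt)))) (W-≤ (ℕ.n≤1+n (suc D)) pF)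
        expand : ∀ k p P Q F₁ F₀ → k * (p * P) - F₁ - (k * (p * Q) - F₀) ≡ k * (p * (P - Q)) - (F₁ - F₀)
        expand = solve-∀ ℚ-ring
        collapse : ∀ c h i p n z r → c * h * i * (p * ((1ℚ + 1ℚ) * n * z + r)) - c * h * i * (p * r)
          ≡ c * (p * z) * (h * (1ℚ + 1ℚ) * (i * n))
        collapse = solve-∀ ℚ-ring

  antidifference-y : ∀ D {f} → W D f → HasAntidifference (suc D) f
  antidifference-y (suc D) (mono c a b lt) = antidifference (antidifference-y D W-remainder)
    where open Monomial {D} c a b (ℕ.s≤s⁻¹ lt)
  antidifference-y D none = (λ _ _ → 0ℚ) , none , λ d y → refl
  antidifference-y D (plus p q) with antidifference-y D p | antidifference-y D q
  ... | F , pF , eqF | H , pH , eqH = _ , plus pF pH , λ d y →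
    trans (lemma (F d (y + 1ℚ)) (F d (y - 1ℚ)) (H d (y + 1ℚ)) (H d (y - 1ℚ))) (cong₂ _+_ (eqF d y) (eqH d y))
    where
    lemma : ∀ a b a′ b′ → a + a′ - (b + b′) ≡ a - b + (a′ - b′)
    lemma = solve-∀ ℚ-ring
  antidifference-y D (ext p eq) with antidifference-y D p
  ... | F , pF , eqF = F , pF , λ d y → trans (eqF d y) (eq d y)

  inv! : ℕ → ℚ
  inv! q = inv (q !) {{q ℕ.!≢0}}

  inv!-0 : inv! 0 ≡ 1ℚ
  inv!-0 = trans (sym (*-identityʳ (inv! 0))) (inv-* 1)

  inv!-suc : ∀ q → inv! (suc q) * fromℕ (suc q) ≡ inv! q
  inv!-suc q = cancel-fromℕ (q !) {{q ℕ.!≢0}} (begin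
    fromℕ (q !) * (inv! (suc q) * fromℕ (suc q))   ≡⟨ lemma (fromℕ (q !)) (inv! (suc q)) (fromℕ (suc q)) ⟩
    inv! (suc q) * (fromℕ (suc q) * fromℕ (q !))   ≡⟨ cong (inv! (suc q) *_) (fromℕ-* (suc q) (q !)) ⟨
    inv! (suc q) * fromℕ (suc q !)                 ≡⟨ inv-* (suc q !) {{suc q ℕ.!≢0}} ⟩
    1ℚ                                             ≡⟨ inv-* (q !) {{q ℕ.!≢0}} ⟨
    inv! q * fromℕ (q !)                           ≡⟨ *-comm (inv! q) (fromℕ (q !)) ⟩
    fromℕ (q !) * inv! q                           ∎)
    where
    lemma : ∀ a b c → a * (b * c) ≡ b * (c * a)
    lemma = solve-∀ ℚ-ring

  -- The numbers c, c + 2, ..., c + 2 (d - 1) have sum `d (c + d - 1)`, of which this is the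
  -- top-degree part. To leading order their q-th elementary symmetric polynomial is the q-th power
  -- of the sum over q!.
  A : ℚ → ℚ → ℚ
  A d c = d * (c + d)

  private
    W-A : W 3 A
    W-A = W-* W-d (plus W-y W-d)

    W-B : W 2 (λ d c → c + 2ℚ * d + 1ℚ)
    W-B = plus (plus W-y (W-scale 2ℚ W-d)) (W-const 1ℚ)

  GPolynomial : ℕ → Set
  GPolynomial q = ∃ λ L → W (q ℕ.+ q) L × ∀ d c → G d q c ≡ inv! q * A (fromℕ d) c ^ q + L (fromℕ d) c

  -- Stated for `suc q`, as `G d 0` is 1 and not divisible by `d`. It follows from `GPolynomial q`
  -- by summation over `d`, and forgetting the factor gives `GPolynomial (suc q)`.
  GDivisible : ℕ → Set
  GDivisible q = ∃ λ L → W (suc (q ℕ.+ q)) L × ∀ d c →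
    G d (suc q) c ≡ fromℕ d * (inv! (suc q) * (fromℕ d ^ q * (c + fromℕ d) ^ suc q) + L (fromℕ d) c)

  private
    suc-*-2 : ∀ q → 1 ℕ.+ q ℕ.* 2 ≡ suc (q ℕ.+ q)
    suc-*-2 = ℕ-Solver.solve-∀

    +-suc-*-1 : ∀ q → q ℕ.+ suc q ℕ.* 1 ≡ suc (q ℕ.+ q)
    +-suc-*-1 = ℕ-Solver.solve-∀

    module GStep (q : ℕ) (L : ℚ → ℚ → ℚ) (pL : W (q ℕ.+ q) L)
      (eqL : ∀ d c → G d q c ≡ inv! q * A (fromℕ d) c ^ q + L (fromℕ d) c) where

      binomial : ∃ λ r → W (q ℕ.+ suc q ℕ.* 1) r ×
        ∀ d c → (A d c + (c + 2ℚ * d + 1ℚ)) ^ suc q ≡ A d c ^ suc q + fromℕ (suc q) * (A d c ^ q * (c + 2ℚ * d + 1ℚ)) + r d c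
      binomial = W-binomial {1} W-A W-B q

      r : ℚ → ℚ → ℚ
      r = proj₁ binomial

      -- From `d` to `d + 1` the trial term `A ^ suc q / (q + 1)!` grows by
      -- `(c + 2 d + 1) A ^ q / q!` and a remainder from `r`, whereas the recursion of `G` asks for
      -- `(c + 2 d) (A ^ q / q! + L)`. This is the discrepancy, which `F` has to supply.
      φ : ℚ → ℚ → ℚ
      φ d c = (c + 2ℚ * d) * L d c - (inv! q * A d c ^ q + inv! (suc q) * r d c)

      W-f : W (suc (q ℕ.+ q)) φ
      W-f = W-minus (W-* (plus W-y (W-scale 2ℚ W-d)) pL)
        (plus (W-scale (inv! q) (W-≤ (ℕ.≤-reflexive (suc-*-2 q)) (W-^ W-A q)))
              (W-scale (inv! (suc q)) (W-≤ (ℕ.≤-reflexive (+-suc-*-1 q)) (proj₁ (proj₂ binomial)))))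

      solution : ∃ λ F → W (suc (q ℕ.+ q)) F × ∀ d c → (d + 1ℚ) * F (d + 1ℚ) c - d * F d c ≡ φ d c
      solution = antidifference-d (suc (q ℕ.+ q)) W-f

      F : ℚ → ℚ → ℚ
      F = proj₁ solution

      X : ℚ → ℚ → ℚ
      X d c = inv! (suc q) * (d ^ q * (c + d) ^ suc q) + F d c

      A-step : ∀ d c → (d + 1ℚ) * (c + (d + 1ℚ)) ≡ d * (c + d) + (c + (1ℚ + 1ℚ) * d + 1ℚ)
      A-step = solve-∀ ℚ-ring
      regroup : ∀ d i p z l → d * (i * (p * z) + l) ≡ i * (d * p * z) + d * l
      regroup = solve-∀ ℚ-ring
      split : ∀ i a′ a l l′ → i * a′ + l′ - (i * a + l) ≡ i * (a′ - a) + (l′ - l)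
      split = solve-∀ ℚ-ring
      collapse : ∀ i n p a d c r l → i * (a + n * (p * (c + (1ℚ + 1ℚ) * d + 1ℚ)) + r - a) + ((c + (1ℚ + 1ℚ) * d) * l - (i * n * p + i * r))
        ≡ (c + (1ℚ + 1ℚ) * d) * (i * n * p + l)
      collapse = solve-∀ ℚ-ring

      X-A : ∀ d c → d * X d c ≡ inv! (suc q) * A d c ^ suc q + d * F d c
      X-A d c = trans (regroup d (inv! (suc q)) (d ^ q) ((c + d) ^ suc q) (F d c))
        (cong (λ z → inv! (suc q) * z + d * F d c) (sym (^-* d (c + d) (suc q))))

      step : ∀ d c → (d + 1ℚ) * X (d + 1ℚ) c - d * X d c ≡ (c + 2ℚ * d) * (inv! q * A d c ^ q + L d c)
      step d c = begin
        (d + 1ℚ) * X (d + 1ℚ) c - d * X d c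
          ≡⟨ cong₂ _-_ (X-A (d + 1ℚ) c) (X-A d c) ⟩
        inv! (suc q) * A (d + 1ℚ) c ^ suc q + (d + 1ℚ) * F (d + 1ℚ) c - (inv! (suc q) * A d c ^ suc q + d * F d c)
          ≡⟨ split (inv! (suc q)) (A (d + 1ℚ) c ^ suc q) (A d c ^ suc q) (d * F d c) ((d + 1ℚ) * F (d + 1ℚ) c) ⟩
        inv! (suc q) * (A (d + 1ℚ) c ^ suc q - A d c ^ suc q) + ((d + 1ℚ) * F (d + 1ℚ) c - d * F d c)
          ≡⟨ cong₂ (λ u v → inv! (suc q) * (u - A d c ^ suc q) + v) (trans (cong (_^ suc q) (A-step d c)) (proj₂ (proj₂ binomial) d c)) (proj₂ (proj₂ solution) d c) ⟩
        inv! (suc q) * (A d c ^ suc q + fromℕ (suc q) * (A d c ^ q * (c + 2ℚ * d + 1ℚ)) + r d c - A d c ^ suc q)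
          + ((c + 2ℚ * d) * L d c - (inv! q * A d c ^ q + inv! (suc q) * r d c))
          ≡⟨ cong (λ i → inv! (suc q) * (A d c ^ suc q + fromℕ (suc q) * (A d c ^ q * (c + 2ℚ * d + 1ℚ)) + r d c - A d c ^ suc q)
               + ((c + 2ℚ * d) * L d c - (i * A d c ^ q + inv! (suc q) * r d c))) (inv!-suc q) ⟨
        inv! (suc q) * (A d c ^ suc q + fromℕ (suc q) * (A d c ^ q * (c + 2ℚ * d + 1ℚ)) + r d c - A d c ^ suc q)
          + ((c + 2ℚ * d) * L d c - (inv! (suc q) * fromℕ (suc q) * A d c ^ q + inv! (suc q) * r d c))
          ≡⟨ collapse (inv! (suc q)) (fromℕ (suc q)) (A d c ^ q) (A d c ^ suc q) d c (r d c) (L d c) ⟩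
        (c + 2ℚ * d) * (inv! (suc q) * fromℕ (suc q) * A d c ^ q + L d c)
          ≡⟨ cong (λ i → (c + 2ℚ * d) * (i * A d c ^ q + L d c)) (inv!-suc q) ⟩
        (c + 2ℚ * d) * (inv! q * A d c ^ q + L d c) ∎

      main : ∀ d c → G d (suc q) c ≡ fromℕ d * X (fromℕ d) c
      main zero    c = sym (*-zeroˡ (X 0ℚ c))
      main (suc d) c = begin
        G d (suc q) c + (c + 2ℚ * fromℕ d) * G d q c
          ≡⟨ cong₂ (λ u v → u + (c + 2ℚ * fromℕ d) * v) (main d c) (eqL d c) ⟩
        fromℕ d * X (fromℕ d) c + (c + 2ℚ * fromℕ d) * (inv! q * A (fromℕ d) c ^ q + L (fromℕ d) c)
          ≡⟨ cong (fromℕ d * X (fromℕ d) c +_) (step (fromℕ d) c) ⟨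
        fromℕ d * X (fromℕ d) c + ((fromℕ d + 1ℚ) * X (fromℕ d + 1ℚ) c - fromℕ d * X (fromℕ d) c)
          ≡⟨ add-back (fromℕ d * X (fromℕ d) c) ((fromℕ d + 1ℚ) * X (fromℕ d + 1ℚ) c) ⟩
        (fromℕ d + 1ℚ) * X (fromℕ d + 1ℚ) c
          ≡⟨ cong (λ n → n * X n c) (trans (+-comm (fromℕ d) 1ℚ) (sym (fromℕ-suc d))) ⟩
        fromℕ (suc d) * X (fromℕ (suc d)) c ∎
        where
        add-back : ∀ a b → a + (b - a) ≡ b
        add-back = solve-∀ ℚ-ring

      divisible : GDivisible q
      divisible = F , proj₁ (proj₂ solution) , main

  G-polynomial : ∀ q → GPolynomial q
  G-divisible : ∀ q → GDivisible q

  G-polynomial zero    = (λ _ _ → 0ℚ) , none , λ d c → sym (cong (λ i → i * 1ℚ + 0ℚ) inv!-0)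
  G-polynomial (suc q) = let L , pL , eq = G-divisible q in
    (λ d c → d * L d c) , W-≤ (ℕ.≤-reflexive (cong suc (sym (ℕ.+-suc q q)))) (W-* W-d pL) , λ d c →
    trans (eq d c) (trans (lemma (fromℕ d) (inv! (suc q)) (fromℕ d ^ q) ((c + fromℕ d) ^ suc q) (L (fromℕ d) c))
      (cong (λ z → inv! (suc q) * z + fromℕ d * L (fromℕ d) c) (sym (^-* (fromℕ d) (c + fromℕ d) (suc q)))))
    where
    lemma : ∀ d i p z l → d * (i * (p * z) + l) ≡ i * (d * p * z) + d * l
    lemma = solve-∀ ℚ-ring

  G-divisible q = let L , pL , eqL = G-polynomial q in GStep.divisible q L pL eqL

  -- With s = 1 unless q = 0, G d q (y - d + 1) is d^s (d^u y^q / q! + terms of lower degree).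

  record Centred (q : ℕ) : Set where
    field
      s u     : ℕ
      s+u≡q   : s ℕ.+ u ≡ q
      s-value : (q ≡ 0 × s ≡ 0) ⊎ (0 < q × s ≡ 1)
      low     : ℚ → ℚ → ℚ
      W-low   : W (u ℕ.+ q) low
      G-≡     : ∀ d y → G d q (y - fromℕ d + 1ℚ) ≡ fromℕ d ^ s * (inv! q * (fromℕ d ^ u * y ^ q) + low (fromℕ d) y)

  power-shift : ∀ q → ∃ λ r → W q r × ∀ d y → (y + 1ℚ) ^ q ≡ y ^ q + r d y
  power-shift zero    = (λ _ _ → 0ℚ) , none , λ d y → refl
  power-shift (suc q) = let r , pr , eq = power-shift q in
    (λ d y → y ^ q + (y + 1ℚ) * r d y) , plus (W-y^ q) (W-* (plus W-y (W-const 1ℚ)) pr) , λ d y →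
    trans (cong ((y + 1ℚ) *_) (eq d y)) (lemma y (y ^ q) (r d y))
    where
    lemma : ∀ y p r → (y + 1ℚ) * (p + r) ≡ y * p + (p + (y + 1ℚ) * r)
    lemma = solve-∀ ℚ-ring

  centred : ∀ q → Centred q
  centred zero = record
    { s = 0 ; u = 0 ; s+u≡q = refl ; s-value = inj₁ (refl , refl) ; low = λ _ _ → 0ℚ ; W-low = none
    ; G-≡ = λ d y → sym (cong (λ i → 1ℚ * (i * (1ℚ * 1ℚ) + 0ℚ)) inv!-0) }
  centred (suc q) = record
    { s = 1 ; u = q ; s+u≡q = refl ; s-value = inj₂ (ℕ.s≤s ℕ.z≤n , refl)
    ; low = low
    ; W-low = plus (W-scale (inv! (suc q)) (W-* (W-d^ q) (proj₁ (proj₂ shifted))))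
                   (W-≤ (ℕ.≤-reflexive (sym (ℕ.+-suc q q))) (W-shift (proj₁ (proj₂ divisible))))
    ; G-≡ = λ d y → trans (proj₂ (proj₂ divisible) d (y - fromℕ d + 1ℚ))
        (trans (cong (λ z → fromℕ d * (inv! (suc q) * (fromℕ d ^ q * z) + L (fromℕ d) (y - fromℕ d + 1ℚ)))
                     (trans (cong (_^ suc q) (arg y (fromℕ d))) (proj₂ (proj₂ shifted) (fromℕ d) y)))
               (lemma (fromℕ d) (inv! (suc q)) (fromℕ d ^ q) (y ^ suc q) (r (fromℕ d) y) (L (fromℕ d) (y - fromℕ d + 1ℚ)))) }
    where
    divisible : GDivisible q
    divisible = G-divisible q
    shifted : ∃ λ r → W (suc q) r × ∀ d y → (y + 1ℚ) ^ suc q ≡ y ^ suc q + r d y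
    shifted = power-shift (suc q)
    L r low : ℚ → ℚ → ℚ
    L = proj₁ divisible
    r = proj₁ shifted
    low d y = inv! (suc q) * (d ^ q * r d y) + L d (y - d + 1ℚ)
    arg : ∀ y d → y - d + 1ℚ + d ≡ y + 1ℚ
    arg = solve-∀ ℚ-ring
    lemma : ∀ d i p z r l → d * (i * (p * (z + r)) + l) ≡ d * 1ℚ * (i * (p * z) + (i * (p * r) + l))
    lemma = solve-∀ ℚ-ring

  -- Keeps the leading monomial and its positive coefficient apart from the terms of lower total
  -- degree, for the highest degree. The power `d ^ s` stays outside for the lowest degree.
  record Summed (q t : ℕ) (C : Centred q) : Set where
    open Centred C
    field
      κ       : ℚ
      κ>0     : ℚ.Positive κ
      rest    : ℚ → ℚ → ℚ
      W-rest  : W (suc (u ℕ.+ (q ℕ.+ t))) rest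

    H : ℚ → ℚ → ℚ
    H d y = d ^ s * (κ * (d ^ u * y ^ suc (q ℕ.+ t)) + rest d y)

    field
      H-Δ : ∀ d y → H (fromℕ d) (y + 1ℚ) - H (fromℕ d) (y - 1ℚ) ≡ y ^ t * G d q (y - fromℕ d + 1ℚ)

  summed : ∀ q t C → Summed q t C
  summed q t C = record { κ = κ ; κ>0 = κ>0 ; rest = N ; W-rest = proj₁ (proj₂ solution) ; H-Δ = H-Δ }
    where
    open Centred C
    m : ℕ
    m = q ℕ.+ t
    κ : ℚ
    -- The factor 1/q! belongs to the symmetric polynomial, and `2 (m + 1)` is the leading
    -- coefficient of the central difference of `y ^ suc m`.
    κ = inv! q * (inv 2 * inv (suc m))
    κ>0 : ℚ.Positive κ
    κ>0 = pos*pos⇒pos (inv! q) {{inv-positive (q !) {{q ℕ.!≢0}}}} (inv 2 * inv (suc m))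
      {{pos*pos⇒pos (inv 2) {{inv-positive 2}} (inv (suc m)) {{inv-positive (suc m)}}}}
    central : ∃ λ r → W m r × ∀ d y → (y + 1ℚ) ^ suc m - (y - 1ℚ) ^ suc m ≡ 2ℚ * fromℕ (suc m) * y ^ m + r d y
    central = central-difference m
    r φ : ℚ → ℚ → ℚ
    r = proj₁ central
    φ d y = y ^ t * low d y - κ * (d ^ u * r d y)
    W-f : W (u ℕ.+ m) φ
    W-f = W-minus (W-≤ (ℕ.≤-reflexive (degree t u q)) (W-* (W-y^ t) W-low))
                  (W-scale κ (W-* (W-d^ u) (proj₁ (proj₂ central))))
      where
      degree : ∀ t u q → t ℕ.+ (u ℕ.+ q) ≡ u ℕ.+ (q ℕ.+ t)
      degree = ℕ-Solver.solve-∀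
    solution : HasAntidifference (suc (u ℕ.+ m)) φ
    solution = antidifference-y (u ℕ.+ m) W-f
    N : ℚ → ℚ → ℚ
    N = proj₁ solution
    expand : ∀ e k p P Q N₁ N₀ → e * (k * (p * P) + N₁) - e * (k * (p * Q) + N₀) ≡ e * (k * (p * (P - Q)) + (N₁ - N₀))
    expand = solve-∀ ℚ-ring
    collapse : ∀ e i h j p n z w r x l → e * (i * (h * j) * (p * ((1ℚ + 1ℚ) * n * (z * w) + r)) + (w * l - i * (h * j) * (p * r)))
      ≡ e * (i * (p * (z * w)) * (h * (1ℚ + 1ℚ) * (j * n)) + w * l)
    collapse = solve-∀ ℚ-ring
    regroup : ∀ e i p z w l → e * (i * (p * (z * w)) * (1ℚ * 1ℚ) + w * l) ≡ w * (e * (i * (p * z) + l))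
    regroup = solve-∀ ℚ-ring
    H-Δ : ∀ d y → fromℕ d ^ s * (κ * (fromℕ d ^ u * (y + 1ℚ) ^ suc m) + N (fromℕ d) (y + 1ℚ))
                - fromℕ d ^ s * (κ * (fromℕ d ^ u * (y - 1ℚ) ^ suc m) + N (fromℕ d) (y - 1ℚ))
                ≡ y ^ t * G d q (y - fromℕ d + 1ℚ)
    H-Δ d y = begin
      e * (κ * (p * (y + 1ℚ) ^ suc m) + N x (y + 1ℚ)) - e * (κ * (p * (y - 1ℚ) ^ suc m) + N x (y - 1ℚ))
        ≡⟨ expand e κ p ((y + 1ℚ) ^ suc m) ((y - 1ℚ) ^ suc m) (N x (y + 1ℚ)) (N x (y - 1ℚ)) ⟩
      e * (κ * (p * ((y + 1ℚ) ^ suc m - (y - 1ℚ) ^ suc m)) + (N x (y + 1ℚ) - N x (y - 1ℚ)))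
        ≡⟨ cong₂ (λ v w → e * (κ * (p * v) + w)) (trans (proj₂ (proj₂ central) x y) (cong (λ z → 2ℚ * fromℕ (suc m) * z + r x y) (^-+ y q t))) (proj₂ (proj₂ solution) x y) ⟩
      e * (κ * (p * (2ℚ * fromℕ (suc m) * (y ^ q * y ^ t) + r x y)) + (y ^ t * low x y - κ * (p * r x y)))
        ≡⟨ collapse e (inv! q) (inv 2) (inv (suc m)) p (fromℕ (suc m)) (y ^ q) (y ^ t) (r x y) x (low x y) ⟩
      e * (inv! q * (p * (y ^ q * y ^ t)) * (inv 2 * 2ℚ * (inv (suc m) * fromℕ (suc m))) + y ^ t * low x y)
        ≡⟨ cong₂ (λ v w → e * (inv! q * (p * (y ^ q * y ^ t)) * (v * w) + y ^ t * low x y)) (inv-* 2) (inv-* (suc m)) ⟩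
      e * (inv! q * (p * (y ^ q * y ^ t)) * (1ℚ * 1ℚ) + y ^ t * low x y)
        ≡⟨ regroup e (inv! q) p (y ^ q) (y ^ t) (low x y) ⟩
      y ^ t * (e * (inv! q * (p * y ^ q) + low x y))
        ≡⟨ cong (y ^ t *_) (G-≡ d y) ⟨
      y ^ t * G d q (y - fromℕ d + 1ℚ) ∎
      where
      x e p : ℚ
      x = fromℕ d
      e = x ^ s
      p = x ^ u

-- Formal polynomials: differences of powers, degrees and positivity.

module Polynomials where

  open import Data.List using (map)
  open import Data.Nat.ListAction using (sum)
  open import Data.List.Relation.Unary.All using (All)
  open import Data.Rational using (_+_; _*_; _-_; -_)
  open import Data.Rational.Properties
  open Sums
  open Differences
  open PolynomialFunctions using (W; mono; none; plus; ext)

  private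
    variable
      n : ℕ

  Term : ℕ → Set
  Term n = ℚ × Vec ℕ n

  degree : Term n → ℕ
  degree = Vec.sum ∘ proj₂

  PositiveTerm : Term n → Set
  PositiveTerm = ℚ.Positive ∘ proj₁

  value : Vec ℚ n → Term n → ℚ
  value x (c , e) = c * monomial e x

  eval-∑ : ∀ (P : Polynomial n) x → eval P x ≡ ∑ P (value x)
  eval-∑ []      x = refl
  eval-∑ (t ∷ P) x = cong (value x t +_) (eval-∑ P x)

  eval-++ : ∀ (P Q : Polynomial n) x → eval (P ++ Q) x ≡ eval P x + eval Q x
  eval-++ P Q x = trans (eval-∑ (P ++ Q) x) (trans (∑-++ P Q (value x)) (cong₂ _+_ (sym (eval-∑ P x)) (sym (eval-∑ Q x))))

  eval-map : ∀ {m} (f : Term m → Term n) (P : Polynomial m) c x x′ →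
             (∀ t → value x′ (f t) ≡ c * value x t) → eval (map f P) x′ ≡ c * eval P x
  eval-map f P c x x′ eq = begin
    eval (map f P) x′               ≡⟨ trans (eval-∑ (map f P) x′) (∑-map f P (value x′)) ⟩
    ∑ P (λ t → value x′ (f t))      ≡⟨ ∑-cong P eq ⟩
    ∑ P (λ t → c * value x t)       ≡⟨ *-∑ c P (value x) ⟨
    c * ∑ P (value x)               ≡⟨ cong (c *_) (eval-∑ P x) ⟨
    c * eval P x                    ∎
    where open ≡-Reasoning

  private
    rotate₃ : ∀ a b c → a * (b * c) ≡ b * (a * c)
    rotate₃ = solve-∀ ℚ-ring

  scaleBy : ℚ → Polynomial n → Polynomial n
  scaleBy c = map (map₁ (c *_))

  eval-scaleBy : ∀ c (P : Polynomial n) x → eval (scaleBy c P) x ≡ c * eval P x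
  eval-scaleBy c P x = eval-map (map₁ (c *_)) P c x x (λ (k , e) → *-assoc c k (monomial e x))

  mulVar : Fin n → Polynomial n → Polynomial n
  mulVar i = map (map₂ (λ e → updateAt e i suc))

  -- Realises powers of `d = |β|` as polynomials in the parts. It raises every degree by exactly one
  -- and preserves positivity term by term.
  mulSum : Polynomial n → Polynomial n
  mulSum {n} P = concat (map (λ i → mulVar i P) (allFin n))

  mulSum^ : ℕ → Polynomial n → Polynomial n
  mulSum^ zero    P = P
  mulSum^ (suc k) P = mulSum (mulSum^ k P)

  monomial-updateAt : ∀ (e : Vec ℕ n) i x → monomial (updateAt e i suc) x ≡ lookup x i * monomial e x
  monomial-updateAt (k ∷ e) zero    (z ∷ x) = *-assoc z (z ^ k) (monomial e x)
  monomial-updateAt (k ∷ e) (suc i) (z ∷ x) = trans (cong (z ^ k *_) (monomial-updateAt e i x)) (rotate₃ (z ^ k) (lookup x i) (monomial e x))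

  sum-updateAt : ∀ (e : Vec ℕ n) i → Vec.sum (updateAt e i suc) ≡ suc (Vec.sum e)
  sum-updateAt (k ∷ e) zero    = refl
  sum-updateAt (k ∷ e) (suc i) = trans (cong (k ℕ.+_) (sum-updateAt e i)) (ℕ.+-suc k (Vec.sum e))

  eval-concat : ∀ (Ps : List (Polynomial n)) x → eval (concat Ps) x ≡ ∑ Ps (λ P → eval P x)
  eval-concat []       x = refl
  eval-concat (P ∷ Ps) x = trans (eval-++ P (concat Ps) x) (cong (eval P x +_) (eval-concat Ps x))

  eval-mulSum : ∀ (P : Polynomial n) x → eval (mulSum P) x ≡ ∑ (allFin n) (lookup x) * eval P x
  eval-mulSum {n} P x = begin
    eval (mulSum P) x
      ≡⟨ trans (eval-concat (map (λ i → mulVar i P) (allFin n)) x) (∑-map (λ i → mulVar i P) (allFin n) (λ P → eval P x)) ⟩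
    ∑ (allFin n) (λ i → eval (mulVar i P) x)
      ≡⟨ ∑-cong (allFin n) (λ i → eval-map (map₂ (λ e → updateAt e i suc)) P (lookup x i) x x
           (λ (c , e) → trans (cong (c *_) (monomial-updateAt e i x)) (rotate₃ c (lookup x i) (monomial e x)))) ⟩
    ∑ (allFin n) (λ i → lookup x i * eval P x)
      ≡⟨ ∑-* (allFin n) (lookup x) (eval P x) ⟨
    ∑ (allFin n) (lookup x) * eval P x ∎
    where open ≡-Reasoning

  point : Vec ℕ n → Vec ℚ n
  point = Vec.map fromℕ

  ∑-point : ∀ (β : Vec ℕ n) → ∑ (allFin n) (lookup (point β)) ≡ fromℕ (Vec.sum β)
  ∑-point []              = refl
  ∑-point {suc n} (b ∷ β) = trans (∑-allFin-suc (lookup (point (b ∷ β)))) (trans (cong (fromℕ b +_) (∑-point β)) (sym (fromℕ-+ b (Vec.sum β))))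

  eval-mulSum^ : ∀ k (P : Polynomial n) β → eval (mulSum^ k P) (point β) ≡ fromℕ (Vec.sum β) ^ k * eval P (point β)
  eval-mulSum^ zero    P β = sym (*-identityˡ (eval P (point β)))
  eval-mulSum^ (suc k) P β = trans (eval-mulSum (mulSum^ k P) (point β))
    (trans (cong₂ _*_ (∑-point β) (eval-mulSum^ k P β)) (sym (*-assoc (fromℕ (Vec.sum β)) _ (eval P (point β)))))

  All-mulSum : ∀ {X Y : Term n → Set} → (∀ {c e} i → X (c , e) → Y (c , updateAt e i suc)) → ∀ {P} → All X P → All Y (mulSum P)
  All-mulSum {n} f ps = All.concat⁺ (All.map⁺ (All.universal (λ i → All.map⁺ (All.map (f i) ps)) (allFin n)))

  All-mulSum^-degree : ∀ {X : ℕ → Set} k {P : Polynomial n} → All (λ t → X (k ℕ.+ degree t)) P → All (X ∘ degree) (mulSum^ k P)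
  All-mulSum^-degree         zero    ps = ps
  All-mulSum^-degree {X = X} (suc k) {P} ps = All-mulSum
    (λ {c} {e} i → subst X (sym (sum-updateAt e i)))
    (All-mulSum^-degree {X = X ∘ suc} k ps)

  All-mulSum^-positive : ∀ k {P : Polynomial n} → All PositiveTerm P → All PositiveTerm (mulSum^ k P)
  All-mulSum^-positive zero    ps = ps
  All-mulSum^-positive (suc k) ps = All-mulSum (λ i p → p) (All-mulSum^-positive k ps)

  Nonempty : Polynomial n → Set
  Nonempty P = ∃ (_∈ P)

  Nonempty-map : ∀ {m} (f : Term m → Term n) {P} → Nonempty P → Nonempty (map f P)
  Nonempty-map f (t , t∈) = f t , ∈-map⁺ f t∈

  Nonempty-scaleBy : ∀ c {P : Polynomial n} → Nonempty P → Nonempty (scaleBy c P)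
  Nonempty-scaleBy c = Nonempty-map (map₁ (c *_))

  Nonempty-mulSum^ : 0 < n → ∀ k {P : Polynomial n} → Nonempty P → Nonempty (mulSum^ k P)
  Nonempty-mulSum^         0<n zero    ne = ne
  Nonempty-mulSum^ {suc n} 0<n (suc k) ne =
    let t , t∈ = Nonempty-map (map₂ (λ e → updateAt e zero suc)) (Nonempty-mulSum^ 0<n k ne)
    in t , ∈-concat⁺′ t∈ (∈-map⁺ (λ i → mulVar i _) (∈-allFin {n = suc n} zero))

  -- The even part and, divided by b, the odd part in b of (y + b)^M.

  even odd : ℕ → ℚ → ℚ → ℚ
  even zero    b y = 1ℚ
  even (suc M) b y = y * even M b y + b * (b * odd M b y)
  odd  zero    b y = 0ℚ
  odd  (suc M) b y = y * odd M b y + even M b y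

  ^-even-odd⁺ : ∀ M b y → (y + b) ^ M ≡ even M b y + b * odd M b y
  ^-even-odd⁺ zero    b y = sym (trans (cong (1ℚ +_) (*-zeroʳ b)) (+-identityʳ 1ℚ))
  ^-even-odd⁺ (suc M) b y = trans (cong ((y + b) *_) (^-even-odd⁺ M b y)) (lemma y b (even M b y) (odd M b y))
    where
    lemma : ∀ y b e o → (y + b) * (e + b * o) ≡ y * e + b * (b * o) + b * (y * o + e)
    lemma = solve-∀ ℚ-ring

  ^-even-odd⁻ : ∀ M b y → (y - b) ^ M ≡ even M b y - b * odd M b y
  ^-even-odd⁻ zero    b y = sym (trans (cong (λ z → 1ℚ - z) (*-zeroʳ b)) (+-identityʳ 1ℚ))
  ^-even-odd⁻ (suc M) b y = trans (cong ((y - b) *_) (^-even-odd⁻ M b y)) (lemma y b (even M b y) (odd M b y))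
    where
    lemma : ∀ y b e o → (y - b) * (e - b * o) ≡ y * e + b * (b * o) - b * (y * o + e)
    lemma = solve-∀ ℚ-ring

  lift : Polynomial n → Polynomial (suc n)
  lift = map (map₂ (0 ∷_))

  mulHead : Polynomial (suc n) → Polynomial (suc n)
  mulHead = mulVar zero

  -- The factors `y` produced by unfolding `even` and `odd` are collected in `j`. At the end `φ j`
  -- stands for the difference of `y ^ j` over the other parts, divided by their product, and the
  -- head variable is the step `b`.
  evenP oddP : (ℕ → Polynomial n) → ℕ → ℕ → Polynomial (suc n)
  evenP φ zero    j = lift (φ j)
  evenP φ (suc M) j = evenP φ M (suc j) ++ mulHead (mulHead (oddP φ M j))
  oddP  φ zero    j = []
  oddP  φ (suc M) j = oddP φ M (suc j) ++ evenP φ M j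

  -- S n M is D β (λ y → y ^ M) divided by the product of the parts of β.

  S : ∀ n → ℕ → Polynomial n
  S zero    zero    = [ 1ℚ , [] ]
  S zero    (suc M) = []
  S (suc n) M       = scaleBy 2ℚ (oddP (S n) M 0)

  parts : Vec ℕ n → ℚ
  parts β = fromℕ (product (toList β))

  module _ (φ : ℕ → Polynomial n) (β : Vec ℕ n)
    (φ-eval : ∀ j → eval (φ j) (point β) * parts β ≡ D (toList β) (λ y → y ^ j)) (b : ℕ) where

    private
      x : Vec ℚ (suc n)
      x = point (b ∷ β)
      B : ℚ
      B = fromℕ b
      L : List ℕ
      L = toList β

    eval-lift : ∀ P → eval (lift P) x ≡ eval P (point β)
    eval-lift P = trans (eval-map (map₂ (0 ∷_)) P 1ℚ (point β) x
      (λ (c , e) → trans (cong (c *_) (*-identityˡ (monomial e (point β)))) (sym (*-identityˡ _)))) (*-identityˡ (eval P (point β)))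

    eval-mulHead : ∀ P → eval (mulHead P) x ≡ B * eval P x
    eval-mulHead P = eval-map (map₂ (λ e → updateAt e zero suc)) P B x x
      (λ (c , e) → trans (cong (c *_) (monomial-updateAt e zero x)) (rotate₃ c B (monomial e x)))

    evenP-eval : ∀ M j → eval (evenP φ M j) x * parts β ≡ D L (λ y → y ^ j * even M B y)
    oddP-eval  : ∀ M j → eval (oddP φ M j) x * parts β ≡ D L (λ y → y ^ j * odd M B y)

    evenP-eval zero j = trans (cong (_* parts β) (eval-lift (φ j))) (trans (φ-eval j) (D-cong L (λ y → sym (*-identityʳ (y ^ j)))))
    evenP-eval (suc M) j = begin
      eval (evenP φ M (suc j) ++ mulHead (mulHead (oddP φ M j))) x * parts β
        ≡⟨ cong (_* parts β) (trans (eval-++ (evenP φ M (suc j)) (mulHead (mulHead (oddP φ M j))) x)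
             (cong (eval (evenP φ M (suc j)) x +_) (trans (eval-mulHead (mulHead (oddP φ M j))) (cong (B *_) (eval-mulHead (oddP φ M j)))))) ⟩
      (eval (evenP φ M (suc j)) x + B * (B * eval (oddP φ M j) x)) * parts β
        ≡⟨ distrib (eval (evenP φ M (suc j)) x) B (eval (oddP φ M j) x) (parts β) ⟩
      eval (evenP φ M (suc j)) x * parts β + B * B * (eval (oddP φ M j) x * parts β)
        ≡⟨ cong₂ (λ u v → u + B * B * v) (evenP-eval M (suc j)) (oddP-eval M j) ⟩
      D L (λ y → y ^ suc j * even M B y) + B * B * D L (λ y → y ^ j * odd M B y)
        ≡⟨ cong (D L (λ y → y ^ suc j * even M B y) +_) (D-* L (B * B) (λ y → y ^ j * odd M B y)) ⟨
      D L (λ y → y ^ suc j * even M B y) + D L (λ y → B * B * (y ^ j * odd M B y))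
        ≡⟨ D-+ L _ _ ⟨
      D L (λ y → y ^ suc j * even M B y + B * B * (y ^ j * odd M B y))
        ≡⟨ D-cong L (λ y → regroup y (y ^ j) (even M B y) (odd M B y) B) ⟩
      D L (λ y → y ^ j * even (suc M) B y) ∎
      where
      open ≡-Reasoning
      distrib : ∀ u b v p → (u + b * (b * v)) * p ≡ u * p + b * b * (v * p)
      distrib = solve-∀ ℚ-ring
      regroup : ∀ y p e o b → y * p * e + b * b * (p * o) ≡ p * (y * e + b * (b * o))
      regroup = solve-∀ ℚ-ring
    oddP-eval zero j = trans (*-zeroˡ (parts β)) (sym (trans (D-cong L (λ y → *-zeroʳ (y ^ j))) (D-0 L)))
    oddP-eval (suc M) j = begin
      eval (oddP φ M (suc j) ++ evenP φ M j) x * parts β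
        ≡⟨ trans (cong (_* parts β) (eval-++ (oddP φ M (suc j)) (evenP φ M j) x)) (*-distribʳ-+ (parts β) (eval (oddP φ M (suc j)) x) (eval (evenP φ M j) x)) ⟩
      eval (oddP φ M (suc j)) x * parts β + eval (evenP φ M j) x * parts β
        ≡⟨ cong₂ _+_ (oddP-eval M (suc j)) (evenP-eval M j) ⟩
      D L (λ y → y ^ suc j * odd M B y) + D L (λ y → y ^ j * even M B y)
        ≡⟨ D-+ L _ _ ⟨
      D L (λ y → y ^ suc j * odd M B y + y ^ j * even M B y)
        ≡⟨ D-cong L (λ y → regroup y (y ^ j) (even M B y) (odd M B y)) ⟩
      D L (λ y → y ^ j * odd (suc M) B y) ∎
      where
      open ≡-Reasoning
      regroup : ∀ y p e o → y * p * o + p * e ≡ p * (y * o + e)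
      regroup = solve-∀ ℚ-ring

  -- The difference of `(y + b) ^ M` and `(y - b) ^ M` is `2 b` times the odd part; its factor `b`
  -- is the one that `parts` gains.
  S-eval : ∀ n M (β : Vec ℕ n) → eval (S n M) (point β) * parts β ≡ D (toList β) (λ y → y ^ M)
  S-eval zero    zero    []      = refl
  S-eval zero    (suc M) []      = trans (*-zeroˡ 1ℚ) (sym (*-zeroˡ (0ℚ ^ M)))
  S-eval (suc n) M       (b ∷ β) = begin
    eval (scaleBy 2ℚ (oddP (S n) M 0)) (point (b ∷ β)) * parts (b ∷ β)
      ≡⟨ cong₂ _*_ (eval-scaleBy 2ℚ (oddP (S n) M 0) (point (b ∷ β))) (fromℕ-* b (product L)) ⟩
    2ℚ * eval (oddP (S n) M 0) (point (b ∷ β)) * (fromℕ b * parts β)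
      ≡⟨ shuffle (eval (oddP (S n) M 0) (point (b ∷ β))) (fromℕ b) (parts β) ⟩
    2ℚ * fromℕ b * (eval (oddP (S n) M 0) (point (b ∷ β)) * parts β)
      ≡⟨ cong (2ℚ * fromℕ b *_) (oddP-eval (S n) β (λ j → S-eval n j β) b M 0) ⟩
    2ℚ * fromℕ b * D L (λ y → 1ℚ * odd M (fromℕ b) y)
      ≡⟨ D-* L (2ℚ * fromℕ b) _ ⟨
    D L (λ y → 2ℚ * fromℕ b * (1ℚ * odd M (fromℕ b) y))
      ≡⟨ D-cong L (λ y → trans (regroup (fromℕ b) (even M (fromℕ b) y) (odd M (fromℕ b) y))
           (sym (cong₂ _-_ (^-even-odd⁺ M (fromℕ b) y) (^-even-odd⁻ M (fromℕ b) y)))) ⟩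
    D L (Δ b (λ y → y ^ M)) ∎
    where
    open ≡-Reasoning
    L : List ℕ
    L = toList β
    shuffle : ∀ e b p → (1ℚ + 1ℚ) * e * (b * p) ≡ (1ℚ + 1ℚ) * b * (e * p)
    shuffle = solve-∀ ℚ-ring
    regroup : ∀ b e o → (1ℚ + 1ℚ) * b * (1ℚ * o) ≡ e + b * o - (e - b * o)
    regroup = solve-∀ ℚ-ring

  module _ {φ : ℕ → Polynomial n} (φ-degree : ∀ j → All (λ t → degree t ℕ.+ n ≡ j) (φ j)) where

    evenP-degree : ∀ M j → All (λ t → degree t ℕ.+ n ≡ M ℕ.+ j) (evenP φ M j)
    oddP-degree  : ∀ M j → All (λ t → degree t ℕ.+ suc n ≡ M ℕ.+ j) (oddP φ M j)

    evenP-degree zero    j = All.map⁺ (φ-degree j)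
    evenP-degree (suc M) j = All.++⁺
      (All.map (λ eq → trans eq (ℕ.+-suc M j)) (evenP-degree M (suc j)))
      (All.map⁺ (All.map⁺ (All.map (λ {t} → bump t) (oddP-degree M j))))
      where
      bump : ∀ t → degree t ℕ.+ suc n ≡ M ℕ.+ j →
             Vec.sum (updateAt (updateAt (proj₂ t) zero suc) zero suc) ℕ.+ n ≡ suc M ℕ.+ j
      bump (c , k ∷ e) eq = cong suc (trans (sym (ℕ.+-suc _ n)) eq)
    oddP-degree zero    j = []
    oddP-degree (suc M) j = All.++⁺
      (All.map (λ eq → trans eq (ℕ.+-suc M j)) (oddP-degree M (suc j)))
      (All.map (λ {t} eq → trans (ℕ.+-suc (degree t) n) (cong suc eq)) (evenP-degree M j))

  -- Homogeneous of degree `M - n`, because one factor is divided out for each part; the additive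
  -- form avoids truncated subtraction.
  S-degree : ∀ n M → All (λ t → degree t ℕ.+ n ≡ M) (S n M)
  S-degree zero    zero    = refl ∷ []
  S-degree zero    (suc M) = []
  S-degree (suc n) M       = All.map⁺ (All.map (λ eq → trans eq (ℕ.+-identityʳ M)) (oddP-degree (S-degree n) M 0))

  module _ {φ : ℕ → Polynomial n} (φ-positive : ∀ j → All PositiveTerm (φ j)) where

    evenP-positive : ∀ M j → All PositiveTerm (evenP φ M j)
    oddP-positive  : ∀ M j → All PositiveTerm (oddP φ M j)
    evenP-positive zero    j = All.map⁺ (φ-positive j)
    evenP-positive (suc M) j = All.++⁺ (evenP-positive M (suc j)) (All.map⁺ (All.map⁺ (oddP-positive M j)))
    oddP-positive  zero    j = []
    oddP-positive  (suc M) j = All.++⁺ (oddP-positive M (suc j)) (evenP-positive M j)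

  scaleBy-positive : ∀ c .{{_ : ℚ.Positive c}} {P : Polynomial n} → All PositiveTerm P → All PositiveTerm (scaleBy c P)
  scaleBy-positive c ps = All.map⁺ (All.map (λ {(k , _)} p → pos*pos⇒pos c k {{p}}) ps)

  S-positive : ∀ n M → All PositiveTerm (S n M)
  S-positive zero    zero    = _ ∷ []
  S-positive zero    (suc M) = []
  S-positive (suc n) M       = scaleBy-positive 2ℚ (oddP-positive (S-positive n) M 0)

  Nonempty-++ˡ : ∀ {P Q : Polynomial n} → Nonempty P → Nonempty (P ++ Q)
  Nonempty-++ˡ (t , t∈) = t , ∈-++⁺ˡ t∈

  Nonempty-++ʳ : ∀ (P : Polynomial n) {Q} → Nonempty Q → Nonempty (P ++ Q)
  Nonempty-++ʳ P (t , t∈) = t , ∈-++⁺ʳ P t∈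

  evenP-nonempty : ∀ (φ : ℕ → Polynomial n) M j → Nonempty (φ (M ℕ.+ j)) → Nonempty (evenP φ M j)
  evenP-nonempty φ zero    j ne = Nonempty-map (map₂ (0 ∷_)) ne
  evenP-nonempty φ (suc M) j ne = Nonempty-++ˡ (evenP-nonempty φ M (suc j) (subst (Nonempty ∘ φ) (sym (ℕ.+-suc M j)) ne))

  -- Two steps from even through odd back to even multiply by the square of the head variable, so
  -- the even surplus can be put there entirely.
  evenP-nonempty-+2 : ∀ (φ : ℕ → Polynomial n) g m → Nonempty (φ m) → Nonempty (evenP φ (g ℕ.* 2 ℕ.+ m) 0)
  evenP-nonempty-+2 φ zero    m ne = evenP-nonempty φ m 0 (subst (Nonempty ∘ φ) (sym (ℕ.+-identityʳ m)) ne)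
  evenP-nonempty-+2 φ (suc g) m ne = Nonempty-++ʳ (evenP φ (suc (g ℕ.* 2 ℕ.+ m)) 1)
    (Nonempty-map _ (Nonempty-map _ (Nonempty-++ʳ (oddP φ (g ℕ.* 2 ℕ.+ m) 1) (evenP-nonempty-+2 φ g m ne))))

  S-nonempty-suc : ∀ n g m → Nonempty (S n m) → Nonempty (S (suc n) (suc (g ℕ.* 2 ℕ.+ m)))
  S-nonempty-suc n g m ne = Nonempty-map _ (Nonempty-++ʳ (oddP (S n) (g ℕ.* 2 ℕ.+ m) 1) (evenP-nonempty-+2 (S n) g m ne))

  -- The highest degree is attained only if the leading part has a term. The difference of `y ^ M`
  -- vanishes if `M - n` is odd or negative; here it is `2 g`.
  S-nonempty : ∀ n g → Nonempty (S (suc n) (g ℕ.* 2 ℕ.+ suc n))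
  S-nonempty n g = subst (Nonempty ∘ S (suc n)) (sym (ℕ.+-suc (g ℕ.* 2) n)) (S-nonempty-suc n g n (diagonal n))
    where
    diagonal : ∀ n → Nonempty (S n n)
    diagonal zero    = _ , here refl
    diagonal (suc n) = S-nonempty-suc n 0 n (diagonal n)

  -- `W` is an inductive presentation, so a formal polynomial can be read off from it. The degree
  -- bound falls by `n`, as for `S`.
  toPolynomial : ∀ {k f} → W k f → ∃ λ (P : Polynomial n) →
    (∀ β → eval P (point β) * parts β ≡ D (toList β) (f (fromℕ (Vec.sum β)))) × All (λ t → degree t ℕ.+ n < k) P
  toPolynomial {n} {k} (mono c a b lt) = scaleBy c (mulSum^ a (S n b)) , evaluate ,
    All.map⁺ (All-mulSum^-degree {X = λ m → m ℕ.+ n < k} a (All.map (λ {t} eq →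
      subst (_< k) (sym (trans (ℕ.+-assoc a (degree t) n) (cong (a ℕ.+_) eq))) lt) (S-degree n b)))
    where
    open ≡-Reasoning
    shuffle : ∀ c p e z → c * (p * e) * z ≡ c * p * (e * z)
    shuffle = solve-∀ ℚ-ring
    evaluate : ∀ β → eval (scaleBy c (mulSum^ a (S n b))) (point β) * parts β ≡ D (toList β) (λ y → c * (fromℕ (Vec.sum β) ^ a * y ^ b))
    evaluate β = begin
      eval (scaleBy c (mulSum^ a (S n b))) (point β) * parts β
        ≡⟨ cong (_* parts β) (trans (eval-scaleBy c (mulSum^ a (S n b)) (point β)) (cong (c *_) (eval-mulSum^ a (S n b) β))) ⟩
      c * (fromℕ (Vec.sum β) ^ a * eval (S n b) (point β)) * parts β
        ≡⟨ shuffle c (fromℕ (Vec.sum β) ^ a) (eval (S n b) (point β)) (parts β) ⟩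
      c * fromℕ (Vec.sum β) ^ a * (eval (S n b) (point β) * parts β)
        ≡⟨ cong (c * fromℕ (Vec.sum β) ^ a *_) (S-eval n b β) ⟩
      c * fromℕ (Vec.sum β) ^ a * D (toList β) (λ y → y ^ b)
        ≡⟨ D-* (toList β) (c * fromℕ (Vec.sum β) ^ a) (λ y → y ^ b) ⟨
      D (toList β) (λ y → c * fromℕ (Vec.sum β) ^ a * y ^ b)
        ≡⟨ D-cong (toList β) (λ y → *-assoc c (fromℕ (Vec.sum β) ^ a) (y ^ b)) ⟩
      D (toList β) (λ y → c * (fromℕ (Vec.sum β) ^ a * y ^ b)) ∎
  toPolynomial none = [] , (λ β → trans (*-zeroˡ (parts β)) (sym (D-0 (toList β)))) , []
  toPolynomial (plus {f = f} {g} p q) = let P , evP , dP = toPolynomial p ; Q , evQ , dQ = toPolynomial q in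
    P ++ Q , (λ β → trans (cong (_* parts β) (eval-++ P Q (point β))) (trans (*-distribʳ-+ (parts β) (eval P (point β)) (eval Q (point β)))
      (trans (cong₂ _+_ (evP β) (evQ β)) (sym (D-+ (toList β) (f (fromℕ (Vec.sum β))) (g (fromℕ (Vec.sum β)))))))) , All.++⁺ dP dQ
  toPolynomial (ext p eq) = let P , evP , dP = toPolynomial p in
    P , (λ β → trans (evP β) (D-cong (toList β) (eq (fromℕ (Vec.sum β))))) , dP

  exponent? : ∀ (e : Vec ℕ n) (t : Term n) → Dec (proj₂ t ≡ e)
  exponent? e t = Vec.≡-dec ℕ._≟_ (proj₂ t) e

  coeff-∑ : ∀ (P : Polynomial n) e → coeff P e ≡ ∑ P (λ t → ind (exponent? e t) * proj₁ t)
  coeff-∑ P e = trans (sum-map (List.filter (exponent? e) P)) (∑-filter (exponent? e) P proj₁)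
    where
    sum-map : ∀ (P : Polynomial n) → sumℚ (map proj₁ P) ≡ ∑ P proj₁
    sum-map []      = refl
    sum-map (t ∷ P) = cong (proj₁ t +_) (sum-map P)

  coeff-++ : ∀ (P Q : Polynomial n) e → coeff (P ++ Q) e ≡ coeff P e + coeff Q e
  coeff-++ P Q e = trans (coeff-∑ (P ++ Q) e) (trans (∑-++ P Q _) (cong₂ _+_ (sym (coeff-∑ P e)) (sym (coeff-∑ Q e))))

  coeff-absent : ∀ {P : Polynomial n} {e} → All (λ t → proj₂ t ≢ e) P → coeff P e ≡ 0ℚ
  coeff-absent {P = P} {e} absent = trans (coeff-∑ P e) (trans (∑-cong∈ P (λ {t} t∈ →
    trans (cong (_* proj₁ t) (ind-no (exponent? e t) (All.lookup absent t∈))) (*-zeroˡ (proj₁ t)))) (∑-0 P))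

  coeff-present : ∀ {P : Polynomial n} {e} → coeff P e ≢ 0ℚ → ∃ λ t → t ∈ P × proj₂ t ≡ e
  coeff-present {P = P} {e} ≢0 with Any.any? (exponent? e) P
  ... | yes p = find p
  ... | no ¬p = contradiction (coeff-absent (All.¬Any⇒All¬ P ¬p)) ≢0

  -- An exponent may be listed repeatedly; positivity is what prevents its coefficients from
  -- cancelling.
  coeff-positive : ∀ {P : Polynomial n} {e} → All PositiveTerm P → Any (λ t → proj₂ t ≡ e) P → 0ℚ ℚ.< coeff P e
  coeff-positive {n} {P} {e} ps any = subst (0ℚ ℚ.<_) (sym (coeff-∑ P e)) (positive P ps any)
    where
    term : Term n → ℚ
    term t = ind (exponent? e t) * proj₁ t
    term-≥0 : ∀ t → PositiveTerm t → 0ℚ ℚ.≤ term t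
    term-≥0 t p with exponent? e t
    ... | yes _ = subst (0ℚ ℚ.≤_) (sym (*-identityˡ (proj₁ t))) (<⇒≤ (positive⁻¹ (proj₁ t) {{p}}))
    ... | no _  = ≤-reflexive (sym (*-zeroˡ (proj₁ t)))
    nonNegative : ∀ P → All PositiveTerm P → 0ℚ ℚ.≤ ∑ P term
    nonNegative []      []       = ≤-refl
    nonNegative (t ∷ P) (p ∷ ps) = +-mono-≤ {0ℚ} (term-≥0 t p) (nonNegative P ps)
    positive : ∀ P → All PositiveTerm P → Any (λ t → proj₂ t ≡ e) P → 0ℚ ℚ.< ∑ P term
    positive (t ∷ P) (p ∷ ps) (here eq) = +-mono-<-≤ {0ℚ}
      (subst (0ℚ ℚ.<_) (sym (trans (cong (_* proj₁ t) (ind-yes (exponent? e t) eq)) (*-identityˡ (proj₁ t)))) (positive⁻¹ (proj₁ t) {{p}}))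
      (nonNegative P ps)
    positive (t ∷ P) (p ∷ ps) (there a) = +-mono-≤-< {0ℚ} (term-≥0 t p) (positive P ps a)

  -- At any exponent listed in `top` the coefficient is positive there and receives nothing from
  -- `low`, so a single such exponent is a witness.
  highestDegree : ∀ {top low : Polynomial n} {k} → All PositiveTerm top → Nonempty top →
    All (λ t → degree t ≡ k) top → All (λ t → degree t < k) low → IsHighestDegree (top ++ low) k
  highestDegree {n} {top} {low} {k} pos ((c , e) , t∈) top-degree low-degree =
    (e , leading , All.lookup top-degree t∈) , bound
    where
    leading : coeff (top ++ low) e ≢ 0ℚ
    leading eq = <-irrefl refl (subst (0ℚ ℚ.<_) (trans (sym (+-identityʳ (coeff top e)))
      (trans (cong (coeff top e +_) (sym (coeff-absent (All.map (λ {t} lt eq → ℕ.<-irrefl (trans (cong Vec.sum eq) (All.lookup top-degree t∈)) lt) low-degree))))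
      (trans (sym (coeff-++ top low e)) eq))) (coeff-positive pos (Any.map (λ eq → cong proj₂ (sym eq)) t∈)))
    bound : ∀ e → coeff (top ++ low) e ≢ 0ℚ → Vec.sum e ≤ k
    bound e ≢0 with coeff-present {P = top ++ low} ≢0
    ... | t , t∈ , refl = All.lookup (All.++⁺ (All.map ℕ.≤-reflexive top-degree) (All.map ℕ.<⇒≤ low-degree)) t∈

  -- A descent bounded by the degree of the current exponent. Only listed exponents have to be
  -- searched, since a nonzero coefficient belongs to one of them.
  lowestDegree : ∀ (P : Polynomial n) e → coeff P e ≢ 0ℚ → ∃ (IsLowestDegree P)
  lowestDegree {n} P e ≢0 = search (Vec.sum e) e ≢0 ℕ.≤-refl
    where
    search : ∀ k e → coeff P e ≢ 0ℚ → Vec.sum e ≤ k → ∃ (IsLowestDegree P)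
    search k e ≢0 le with Any.any? (λ t → ¬? (coeff P (proj₂ t) ≟ 0ℚ) ×-dec (degree t ℕ.<? Vec.sum e)) P
    ... | no ¬p = Vec.sum e , (e , ≢0 , refl) , λ e′ ≢0′ → ℕ.≮⇒≥ (λ lt →
      let t , t∈ , eq = coeff-present {P = P} ≢0′ in
      All.lookup (All.¬Any⇒All¬ P ¬p) t∈ (subst (λ e → coeff P e ≢ 0ℚ) (sym eq) ≢0′ , subst (λ e → Vec.sum e < _) (sym eq) lt))
    ... | yes p with find p
    search zero    e ≢0 le | yes p | t , t∈ , ≢0′ , lt = ⊥-elim (ℕ.n≮0 (ℕ.≤-trans lt le))
    search (suc k) e ≢0 le | yes p | t , t∈ , ≢0′ , lt = search k (proj₂ t) ≢0′ (ℕ.s≤s⁻¹ (ℕ.≤-trans lt le))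

  lowestDegree-≥ : ∀ {P : Polynomial n} {k m} → All (λ t → m ≤ degree t) P → IsHighestDegree P k →
                   ∃ λ l → IsLowestDegree P l × m ≤ l
  lowestDegree-≥ {P = P} bound ((e , ≢0 , _) , _) with lowestDegree P e ≢0
  ... | l , lowest@((e′ , ≢0′ , refl) , _) with coeff-present {P = P} ≢0′
  ...   | t , t∈P , refl = l , lowest , All.lookup bound t∈P

-- Counting tuples: full cycle, transpositions and the prescribed class.

module TupleCount where

  open import Data.Nat.ListAction using (sum)
  open import Data.List.Relation.Unary.All using (All)
  open import Data.Rational using (_+_; _*_; _-_; -_)
  open import Data.Rational.Properties
  open Sums
  open Differences
  open CutAndJoin
  open CycleLists
  open PermutationSums
  open FullCycles
  open ClassSize
  open PolynomialFunctions
  open Polynomials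

  private
    variable
      n : ℕ

  T^ : ∀ {d} → ℕ → (Permutation′ d → ℚ) → Permutation′ d → ℚ
  T^ zero    φ = φ
  T^ (suc t) φ = T^ t (T φ)

  transpositions? : ∀ {d t} (τs : Vec (Permutation′ d) t) → Dec (VecAll.All IsTransposition τs)
  transpositions? = VecAll.all? isTransposition?

  ∑-transpositions : ∀ {d} t (φ : Permutation′ d → ℚ) σ →
    ∑ (allVecs (allPermutations d) t) (λ τs → ind (transpositions? τs) * φ (Vec.foldr′ _∘ₚ_ σ τs)) ≡ T^ t φ σ
  ∑-transpositions zero    φ σ = trans (+-identityʳ (1ℚ * φ σ)) (*-identityˡ (φ σ))
  ∑-transpositions {d} (suc t) φ σ = begin
    ∑ (allVecs P (suc t)) (λ τs → ind (transpositions? τs) * φ (Vec.foldr′ _∘ₚ_ σ τs))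
      ≡⟨ ∑-cartesianProductWith _∷_ P (allVecs P t) _ ⟩
    ∑ P (λ τ → ∑ (allVecs P t) (λ τs → ind (transpositions? (τ ∷ τs)) * φ (τ ∘ₚ Vec.foldr′ _∘ₚ_ σ τs)))
      ≡⟨ ∑-cong P (λ τ → ∑-cong (allVecs P t) (λ τs → trans (cong (_* φ (τ ∘ₚ Vec.foldr′ _∘ₚ_ σ τs)) (head-tail τ τs))
           (reorder (ind (isTransposition? τ)) (ind (transpositions? τs)) (φ (τ ∘ₚ Vec.foldr′ _∘ₚ_ σ τs))))) ⟩
    ∑ P (λ τ → ∑ (allVecs P t) (λ τs → ind (transpositions? τs) * (ind (isTransposition? τ) * φ (τ ∘ₚ Vec.foldr′ _∘ₚ_ σ τs))))
      ≡⟨ ∑-swap P (allVecs P t) _ ⟩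
    ∑ (allVecs P t) (λ τs → ∑ P (λ τ → ind (transpositions? τs) * (ind (isTransposition? τ) * φ (τ ∘ₚ Vec.foldr′ _∘ₚ_ σ τs))))
      ≡⟨ ∑-cong (allVecs P t) (λ τs → sym (*-∑ (ind (transpositions? τs)) P (λ τ → ind (isTransposition? τ) * φ (τ ∘ₚ Vec.foldr′ _∘ₚ_ σ τs)))) ⟩
    ∑ (allVecs P t) (λ τs → ind (transpositions? τs) * T φ (Vec.foldr′ _∘ₚ_ σ τs))
      ≡⟨ ∑-transpositions t (T φ) σ ⟩
    T^ t (T φ) σ ∎
    where
    open ≡-Reasoning
    P : List (Permutation′ d)
    P = allPermutations d
    reorder : ∀ a b c → a * b * c ≡ b * (a * c)
    reorder = solve-∀ ℚ-ring
    head-tail : ∀ τ (τs : Vec (Permutation′ d) t) → ind (transpositions? (τ ∷ τs)) ≡ ind (isTransposition? τ) * ind (transpositions? τs)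
    head-tail τ τs = trans (ind-cong (transpositions? (τ ∷ τs)) (isTransposition? τ ×-dec transpositions? τs)
      VecAll.uncons (λ (p , ps) → p VecAll.∷ ps)) (ind-× (isTransposition? τ) (transpositions? τs))

  -- Summing over the full cycle innermost turns the condition on the product into `Q` at the
  -- product of the remaining factors. By `m + q ≡ d`, having `m` cycles is defect `suc q`.
  ∑-tuples : ∀ {d} t q m (β : Vec ℕ n) → m ℕ.+ q ≡ d →
    fromℕ (length (List.filter (isHurwitzTuple? m β) (allTuples d t)))
    ≡ ∑ (allPermutations d) (λ σ → ind (class? β σ) * T^ t (Q d (suc q)) σ)
  ∑-tuples {d = d} t q m β m+q≡d = begin
    fromℕ (length (List.filter (isHurwitzTuple? m β) (allTuples d t)))
      ≡⟨ length-filter-∑ (isHurwitzTuple? m β) (allTuples d t) ⟩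
    ∑ (allTuples d t) (λ x → ind (isHurwitzTuple? m β x))
      ≡⟨ trans (∑-cartesianProductWith _,_ P (List.cartesianProduct (allVecs P t) P) (λ x → ind (isHurwitzTuple? m β x)))
           (∑-cong P (λ c → ∑-cartesianProductWith _,_ (allVecs P t) P (λ (τs , σ) → ind (isHurwitzTuple? m β (c , τs , σ))))) ⟩
    ∑ P (λ c → ∑ (allVecs P t) (λ τs → ∑ P (λ σ → ind (isHurwitzTuple? m β (c , τs , σ)))))
      ≡⟨ ∑-cong P (λ c → ∑-cong (allVecs P t) (λ τs → ∑-cong P (λ σ → factors c τs σ))) ⟩
    ∑ P (λ c → ∑ (allVecs P t) (λ τs → ∑ P (λ σ → weight c τs σ)))
      ≡⟨ ∑-cong P (λ c → ∑-swap (allVecs P t) P (weight c)) ⟩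
    ∑ P (λ c → ∑ P (λ σ → ∑ (allVecs P t) (λ τs → weight c τs σ)))
      ≡⟨ ∑-swap P P (λ c σ → ∑ (allVecs P t) (λ τs → weight c τs σ)) ⟩
    ∑ P (λ σ → ∑ P (λ c → ∑ (allVecs P t) (λ τs → weight c τs σ)))
      ≡⟨ ∑-cong P (λ σ → trans (∑-swap P (allVecs P t) (λ c τs → weight c τs σ)) (trans (∑-cong (allVecs P t) (λ τs → trans
           (sym (*-∑ (ind (class? β σ)) P (λ c → ind (transpositions? τs) * summand c τs σ)))
           (cong (ind (class? β σ) *_) (sym (*-∑ (ind (transpositions? τs)) P (λ c → summand c τs σ))))))
         (sym (*-∑ (ind (class? β σ)) (allVecs P t) (λ τs → ind (transpositions? τs) * Q d (suc q) (Vec.foldr′ _∘ₚ_ σ τs)))))) ⟩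
    ∑ P (λ σ → ind (class? β σ) * ∑ (allVecs P t) (λ τs → ind (transpositions? τs) * Q d (suc q) (Vec.foldr′ _∘ₚ_ σ τs)))
      ≡⟨ ∑-cong P (λ σ → cong (ind (class? β σ) *_) (∑-transpositions t (Q d (suc q)) σ)) ⟩
    ∑ P (λ σ → ind (class? β σ) * T^ t (Q d (suc q)) σ) ∎
    where
    open ≡-Reasoning
    P : List (Permutation′ d)
    P = allPermutations d
    summand : Permutation′ d → Vec (Permutation′ d) t → Permutation′ d → ℚ
    summand c τs σ = ind (full? c) * ind (defect? (suc q) (c ∘ₚ Vec.foldr′ _∘ₚ_ σ τs))
    weight : Permutation′ d → Vec (Permutation′ d) t → Permutation′ d → ℚ
    weight c τs σ = ind (class? β σ) * (ind (transpositions? τs) * summand c τs σ)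
    m+q : m ℕ.+ suc q ≡ suc d
    m+q = trans (ℕ.+-suc m q) (cong suc m+q≡d)
    rearrange : ∀ a b c e → a * (b * (c * e)) ≡ c * (b * (a * e))
    rearrange = solve-∀ ℚ-ring
    cycles? : ∀ π → Dec (numCycles {d} π ≡ m)
    cycles? π = numCycles π ℕ.≟ m
    defect : ∀ π → ind (cycles? π) ≡ ind (defect? (suc q) π)
    defect π = ind-cong (cycles? π) (defect? (suc q) π)
      (λ eq → trans (cong (ℕ._+ suc q) eq) m+q) (λ eq → ℕ.+-cancelʳ-≡ (suc q) (numCycles π) m (trans eq (sym m+q)))
    factors : ∀ c τs σ → ind (isHurwitzTuple? m β (c , τs , σ)) ≡ ind (class? β σ) * (ind (transpositions? τs) * summand c τs σ)
    factors c τs σ = trans (ind-× (full? c) (transpositions? τs ×-dec class? β σ ×-dec cycles? π))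
      (trans (cong (ind (full? c) *_) (trans (ind-× (transpositions? τs) (class? β σ ×-dec cycles? π))
        (cong (ind (transpositions? τs) *_) (trans (ind-× (class? β σ) (cycles? π)) (cong (ind (class? β σ) *_) (defect π))))))
      (rearrange (ind (full? c)) (ind (transpositions? τs)) (ind (class? β σ)) (ind (defect? (suc q) π))))
      where
      π : Permutation′ d
      π = c ∘ₚ Vec.foldr′ _∘ₚ_ σ τs

  numHurwitzTuples-≡ : ∀ t q (β : Vec ℕ n) → q < Vec.sum β →
    fromℕ (numHurwitzTuples t (Vec.sum β ∸ q) β)
    ≡ ∑ (allPermutations (Vec.sum β)) (λ σ → ind (class? β σ) * T^ t (Q (Vec.sum β) (suc q)) σ)
  numHurwitzTuples-≡ t q β q<d = ∑-tuples t q (Vec.sum β ∸ q) β (ℕ.m∸n+n≡m (ℕ.<⇒≤ q<d))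

  module _ (q : ℕ) (C : Centred q) where

    H : ℕ → ℚ → ℚ → ℚ
    H t = Summed.H (summed q t C)

    H-Δ : ∀ t d y → H t (fromℕ d) (y + 1ℚ) - H t (fromℕ d) (y - 1ℚ) ≡ y ^ t * G d q (y - fromℕ d + 1ℚ)
    H-Δ t = Summed.H-Δ (summed q t C)

    -- The unit difference of `H j` contains `z ^ j`, so the eigenvalue `d z / 2` turns `H j` into
    -- `H (suc j)` and moves `d / 2` into the constant.
    T^-D : ∀ {d} .{{_ : ℕ.NonZero d}} t j {k} → j ℕ.+ t ≡ k → ∀ c (φ : Permutation′ d → ℚ) →
           (∀ σ → φ σ ≡ c * D (cycleType σ) (H j (fromℕ d))) →
           ∀ σ → T^ t φ σ ≡ c * (inv 2 * fromℕ d) ^ t * D (cycleType σ) (H k (fromℕ d))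
    T^-D {d} zero    j eqk c φ eq σ = trans (eq σ) (cong₂ (λ c j → c * D (cycleType σ) (H j (fromℕ d))) (sym (*-identityʳ c)) (trans (sym (ℕ.+-identityʳ j)) eqk))
    T^-D {d} (suc t) j {k} eqk c φ eq σ = trans (T^-D t (suc j) (trans (sym (ℕ.+-suc j t)) eqk) (c * (inv 2 * fromℕ d)) (T φ) step σ)
      (cong (λ c → c * D (cycleType σ) (H k (fromℕ d))) (*-assoc c (inv 2 * fromℕ d) ((inv 2 * fromℕ d) ^ t)))
      where
      open ≡-Reasoning
      x : ℚ
      x = fromℕ d
      rel : ∀ c x a b → c * x * a - c * x * b ≡ c * x * (a - b)
      rel = solve-∀ ℚ-ring
      pull : ∀ c x z p g → c * x * (z * p * g) ≡ x * z * (c * (p * g))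
      pull = solve-∀ ℚ-ring
      push : ∀ x z c a b → x * z * (c * (a - b)) ≡ x * z * (c * a - c * b)
      push = solve-∀ ℚ-ring
      double : ∀ σ → 2ℚ * T φ σ ≡ D (cycleType σ) (λ y → c * x * H (suc j) x y)
      double = T-D (λ y → c * H j x y) (λ y → c * x * H (suc j) x y)
        (λ z → begin
          c * x * H (suc j) x (z + 1ℚ) - c * x * H (suc j) x (z - 1ℚ)
            ≡⟨ rel c x (H (suc j) x (z + 1ℚ)) (H (suc j) x (z - 1ℚ)) ⟩
          c * x * (H (suc j) x (z + 1ℚ) - H (suc j) x (z - 1ℚ))
            ≡⟨ cong (c * x *_) (H-Δ (suc j) d z) ⟩
          c * x * (z * z ^ j * G d q (z - x + 1ℚ))
            ≡⟨ pull c x z (z ^ j) (G d q (z - x + 1ℚ)) ⟩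
          x * z * (c * (z ^ j * G d q (z - x + 1ℚ)))
            ≡⟨ cong (λ w → x * z * (c * w)) (H-Δ j d z) ⟨
          x * z * (c * (H j x (z + 1ℚ) - H j x (z - 1ℚ)))
            ≡⟨ push x z c (H j x (z + 1ℚ)) (H j x (z - 1ℚ)) ⟩
          x * z * (c * H j x (z + 1ℚ) - c * H j x (z - 1ℚ)) ∎)
        (λ π → trans (eq π) (sym (D-* (cycleType π) c (H j x))))
      assemble : ∀ i c x h → i * (c * x * h) ≡ c * (i * x) * h
      assemble = solve-∀ ℚ-ring
      step : ∀ σ → T φ σ ≡ c * (inv 2 * x) * D (cycleType σ) (H (suc j) x)
      step σ = begin
        T φ σ                                                    ≡⟨ *-identityˡ (T φ σ) ⟨
        1ℚ * T φ σ                                               ≡⟨ cong (_* T φ σ) (inv-* 2) ⟨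
        inv 2 * 2ℚ * T φ σ                                       ≡⟨ *-assoc (inv 2) 2ℚ (T φ σ) ⟩
        inv 2 * (2ℚ * T φ σ)                                     ≡⟨ cong (inv 2 *_) (trans (double σ) (D-* (cycleType σ) (c * x) (H (suc j) x))) ⟩
        inv 2 * (c * x * D (cycleType σ) (H (suc j) x))          ≡⟨ assemble (inv 2) c x (D (cycleType σ) (H (suc j) x)) ⟩
        c * (inv 2 * x) * D (cycleType σ) (H (suc j) x)          ∎

    inv2^-2^ : ∀ q → inv 2 ^ q * 2^ q ≡ 1ℚ
    inv2^-2^ zero    = refl
    inv2^-2^ (suc q) = trans (lemma (inv 2) (inv 2 ^ q) (2^ q)) (trans (cong₂ _*_ (inv-* 2) (inv2^-2^ q)) (*-identityˡ 1ℚ))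
      where
      lemma : ∀ i p r → i * p * ((1ℚ + 1ℚ) * r) ≡ i * (1ℚ + 1ℚ) * (p * r)
      lemma = solve-∀ ℚ-ring

    -- The unit differences of `E` are `2 (d + 1)` times those of `H 0`, so `D-unit` exchanges the
    -- two on the nonempty cycle type, and that constant cancels against `scale`.
    Q-H : ∀ n i → i * fromℕ (suc n) ≡ 1ℚ → ∀ (σ : Permutation′ (suc n)) →
          Q (suc n) (suc q) σ ≡ inv 2 ^ q * i * D (cycleType σ) (H 0 (fromℕ (suc n)))
    Q-H n i i-inverse σ = begin
      Qσ                                                      ≡⟨ *-identityˡ Qσ ⟨
      1ℚ * 1ℚ * Qσ                                            ≡⟨ cong₂ (λ u v → u * v * Qσ) (inv2^-2^ q) i-inverse ⟨
      inv 2 ^ q * 2^ q * (i * x) * Qσ               ≡⟨ regroup (inv 2 ^ q) (2^ q) (i) x Qσ ⟩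
      inv 2 ^ q * i * (2^ q * x * Qσ)               ≡⟨ cong (inv 2 ^ q * i *_) cancelled ⟩
      inv 2 ^ q * i * D (cycleType σ) (H 0 x)       ∎
      where
      open ≡-Reasoning
      x Qσ : ℚ
      x = fromℕ (suc n)
      Qσ = Q (suc n) (suc q) σ
      regroup : ∀ a b i x y → a * b * (i * x) * y ≡ a * i * (b * x * y)
      regroup = solve-∀ ℚ-ring
      arg : ∀ z m → z - m ≡ z - (1ℚ + m) + 1ℚ
      arg = solve-∀ ℚ-ring
      +1+1 : ∀ m → m + (1ℚ + 1ℚ) ≡ 1ℚ + m + 1ℚ
      +1+1 = solve-∀ ℚ-ring
      double-suc : fromℕ (2 ℕ.* suc (suc n)) ≡ 2ℚ * (x + 1ℚ)
      double-suc = trans (fromℕ-* 2 (suc (suc n))) (cong (2ℚ *_) (trans (fromℕ-suc (suc n)) (+-comm 1ℚ x)))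
      nonempty : ∀ L {k} → length L ≡ suc k → D L (E (suc n) (suc q)) ≡ 2ℚ * (x + 1ℚ) * D L (H 0 x)
      nonempty (b ∷ L) _ = D-unit {E (suc n) (suc q)} {H 0 x} {2ℚ * (x + 1ℚ)} (λ z → begin
        E (suc n) (suc q) (z + 1ℚ) - E (suc n) (suc q) (z - 1ℚ)
          ≡⟨ E-tele n q z ⟩
        2ℚ * (fromℕ n + 2ℚ) * E n q z
          ≡⟨ cong₂ (λ u v → 2ℚ * u * v) (trans (+1+1 (fromℕ n)) (cong (_+ 1ℚ) (sym (fromℕ-suc n))))
               (cong (G (suc n) q) (trans (arg z (fromℕ n)) (cong (λ w → z - w + 1ℚ) (sym (fromℕ-suc n))))) ⟩
        2ℚ * (x + 1ℚ) * G (suc n) q (z - x + 1ℚ)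
          ≡⟨ cong (2ℚ * (x + 1ℚ) *_) (trans (H-Δ 0 (suc n) z) (*-identityˡ (G (suc n) q (z - x + 1ℚ)))) ⟨
        2ℚ * (x + 1ℚ) * (H 0 x (z + 1ℚ) - H 0 x (z - 1ℚ)) ∎) b L
      shuffle : ∀ p x y → (1ℚ + 1ℚ) * (x + 1ℚ) * (p * x * y) ≡ (1ℚ + 1ℚ) * p * (x * (x + 1ℚ)) * y
      shuffle = solve-∀ ℚ-ring
      cancelled : 2^ q * x * Qσ ≡ D (cycleType σ) (H 0 x)
      cancelled = cancel-fromℕ (2 ℕ.* suc (suc n)) (begin
        fromℕ (2 ℕ.* suc (suc n)) * (2^ q * x * Qσ)              ≡⟨ cong (_* (2^ q * x * Qσ)) double-suc ⟩
        2ℚ * (x + 1ℚ) * (2^ q * x * Qσ)                          ≡⟨ shuffle (2^ q) x Qσ ⟩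
        scale (suc n) (suc q) * Qσ                               ≡⟨ Q-D n (suc q) σ ⟩
        D (cycleType σ) (E (suc n) (suc q))                      ≡⟨ nonempty (cycleType σ) (proj₂ (numCycles-positive σ)) ⟩
        2ℚ * (x + 1ℚ) * D (cycleType σ) (H 0 x)                  ≡⟨ cong (_* D (cycleType σ) (H 0 x)) double-suc ⟨
        fromℕ (2 ℕ.* suc (suc n)) * D (cycleType σ) (H 0 x)      ∎)

    T^-Q : ∀ {d} .{{_ : ℕ.NonZero d}} t i → i * fromℕ d ≡ 1ℚ → ∀ (σ : Permutation′ d) →
      T^ t (Q d (suc q)) σ ≡ inv 2 ^ q * i * (inv 2 * fromℕ d) ^ t * D (cycleType σ) (H t (fromℕ d))
    T^-Q {suc n} t i i-inverse = T^-D {suc n} t 0 {t} refl (inv 2 ^ q * i) (Q (suc n) (suc q)) (Q-H n i i-inverse)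

-- The scaled Hurwitz number as an explicit polynomial, and its degrees.

module Assembly where

  open import Data.List using (map)
  open import Data.Nat.ListAction using (sum)
  open import Data.List.Relation.Unary.All using (All)
  open import Data.Rational using (_+_; _*_)
  open import Data.Rational.Properties
  open Sums
  open Differences
  open CutAndJoin using (G)
  open CycleLists
  open PermutationSums
  open FullCycles
  open ClassSize
  open PolynomialFunctions
  open Polynomials
  open TupleCount

  module HurwitzPolynomial (n q w : ℕ) where

    t : ℕ
    -- One division by `d` occurs in `Q-H` and one in the scaling. The power `d ^ t` coming from the
    -- transpositions absorbs both because `t ≥ 2`, and `d ^ w` is left.
    t = 2 ℕ.+ w

    C : Centred q
    C = centred q

    open Centred C using (s; u; s+u≡q; s-value)
    open Summed (summed q t C) using (κ; κ>0; rest; W-rest)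

    M : ℕ
    M = suc (q ℕ.+ t)

    leading remainder : Polynomial n
    leading   = scaleBy κ (mulSum^ u (S n M))
    remainder = proj₁ (toPolynomial W-rest)

    constant : ℚ
    -- A factor 1/2 for each of the `q` doubled contents and for each of the `t` transposition sums.
    constant = inv 2 ^ q * inv 2 ^ t * inv! t

    factor : Polynomial n → Polynomial n
    factor P = scaleBy constant (mulSum^ (w ℕ.+ s) P)

    P : Polynomial n
    P = factor leading ++ factor remainder

    module _ (β : Vec ℕ n) where

      private
        d : ℕ
        d = Vec.sum β
        x Y : ℚ
        x = fromℕ d
        Y = eval leading (point β) + eval remainder (point β)
        L : List ℕ
        L = toList β
      open ≡-Reasoning

      eval-factor : ∀ P → eval (factor P) (point β) ≡ constant * (x ^ (w ℕ.+ s) * eval P (point β))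
      eval-factor P = trans (eval-scaleBy constant (mulSum^ (w ℕ.+ s) P) (point β)) (cong (constant *_) (eval-mulSum^ (w ℕ.+ s) P β))

      eval-P : eval P (point β) ≡ constant * (x ^ (w ℕ.+ s) * Y)
      eval-P = trans (eval-++ (factor leading) (factor remainder) (point β))
        (trans (cong₂ _+_ (eval-factor leading) (eval-factor remainder))
               (collect constant (x ^ (w ℕ.+ s)) (eval leading (point β)) (eval remainder (point β))))
        where
        collect : ∀ c p a b → c * (p * a) + c * (p * b) ≡ c * (p * (a + b))
        collect = solve-∀ ℚ-ring

      D-H : D L (H q C t x) ≡ x ^ s * (Y * parts β)
      D-H = begin
        D L (λ y → x ^ s * (κ * (x ^ u * y ^ M) + rest x y))
          ≡⟨ trans (D-* L (x ^ s) (λ y → κ * (x ^ u * y ^ M) + rest x y)) (cong (x ^ s *_) (D-+ L (λ y → κ * (x ^ u * y ^ M)) (rest x))) ⟩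
        x ^ s * (D L (λ y → κ * (x ^ u * y ^ M)) + D L (rest x))
          ≡⟨ cong₂ (λ a b → x ^ s * (a + b)) lead (sym (proj₁ (proj₂ (toPolynomial W-rest)) β)) ⟩
        x ^ s * (eval leading (point β) * parts β + eval remainder (point β) * parts β)
          ≡⟨ cong (x ^ s *_) (*-distribʳ-+ (parts β) (eval leading (point β)) (eval remainder (point β))) ⟨
        x ^ s * (Y * parts β) ∎
        where
        shuffle : ∀ k p e z → k * (p * (e * z)) ≡ k * (p * e) * z
        shuffle = solve-∀ ℚ-ring
        lead : D L (λ y → κ * (x ^ u * y ^ M)) ≡ eval leading (point β) * parts β
        lead = begin
          D L (λ y → κ * (x ^ u * y ^ M))
            ≡⟨ trans (D-* L κ (λ y → x ^ u * y ^ M)) (cong (κ *_) (D-* L (x ^ u) (λ y → y ^ M))) ⟩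
          κ * (x ^ u * D L (λ y → y ^ M))
            ≡⟨ cong (λ z → κ * (x ^ u * z)) (S-eval n M β) ⟨
          κ * (x ^ u * (eval (S n M) (point β) * parts β))
            ≡⟨ shuffle κ (x ^ u) (eval (S n M) (point β)) (parts β) ⟩
          κ * (x ^ u * eval (S n M) (point β)) * parts β
            ≡⟨ cong (_* parts β) (trans (eval-scaleBy κ (mulSum^ u (S n M)) (point β)) (cong (κ *_) (eval-mulSum^ u (S n M) β))) ⟨
          eval leading (point β) * parts β ∎

      -- `X` and `Z` are the quotients `aut β / d!` and `1 / (t! d)`, given by the equations that
      -- characterise them so that the computation stays within ring identities.
      hurwitz-eval : VecAll.All (0 <_) β → q < d → ∀ X Z → X * fromℕ (d !) ≡ fromℕ (aut β) → Z * fromℕ (t ! ℕ.* d) ≡ 1ℚ →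
        X * fromℕ (numHurwitzTuples t (d ∸ q) β) * Z ≡ eval P (point β)
      hurwitz-eval pos q<d X Z X-eq Z-eq = begin
        X * fromℕ (numHurwitzTuples t (d ∸ q) β) * Z
          ≡⟨ cong₂ (λ a b → X * a * b) count Z-value ⟩
        X * (K * (c * (x ^ s * (Y * Π)))) * (inv! t * i)
          ≡⟨ regroup X K c (x ^ s) Y Π (inv! t) i ⟩
        c * i * (inv! t * (x ^ s * Y)) * (X * K * Π)
          ≡⟨ trans (cong (c * i * (inv! t * (x ^ s * Y)) *_) classes) (*-identityʳ _) ⟩
        inv 2 ^ q * i * (inv 2 * x) ^ t * i * (inv! t * (x ^ s * Y))
          ≡⟨ cong (λ z → inv 2 ^ q * i * z * i * (inv! t * (x ^ s * Y))) (^-* (inv 2) x t) ⟩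
        inv 2 ^ q * i * (inv 2 ^ t * (x * (x * x ^ w))) * i * (inv! t * (x ^ s * Y))
          ≡⟨ regroup′ (inv 2 ^ q) i (inv 2 ^ t) x (x ^ w) (inv! t) (x ^ s) Y ⟩
        constant * (x ^ w * x ^ s * Y) * (i * x * (i * x))
          ≡⟨ trans (cong (λ z → constant * (x ^ w * x ^ s * Y) * (z * z)) i-inverse) (*-identityʳ (constant * (x ^ w * x ^ s * Y))) ⟩
        constant * (x ^ w * x ^ s * Y)
          ≡⟨ cong (λ z → constant * (z * Y)) (^-+ x w s) ⟨
        constant * (x ^ (w ℕ.+ s) * Y)
          ≡⟨ eval-P ⟨
        eval P (point β) ∎
        where
        instance
          d≢0 : ℕ.NonZero d
          d≢0 = ℕ.>-nonZero (ℕ.m<n⇒0<n q<d)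
          d!≢0 : ℕ.NonZero (d !)
          d!≢0 = d ℕ.!≢0
          t!d≢0 : ℕ.NonZero (t ! ℕ.* d)
          t!d≢0 = ℕ.m*n≢0 (t !) d {{t ℕ.!≢0}}
        i c K Π V : ℚ
        i = inv d
        c = inv 2 ^ q * i * (inv 2 * x) ^ t
        K = ∑ (allPermutations d) (λ σ → ind (class? β σ))
        Π = parts β
        V = D L (H q C t x)
        i-inverse : i * x ≡ 1ℚ
        i-inverse = inv-* d
        regroup : ∀ X K c p Y Π a i → X * (K * (c * (p * (Y * Π)))) * (a * i) ≡ c * i * (a * (p * Y)) * (X * K * Π)
        regroup = solve-∀ ℚ-ring
        regroup′ : ∀ b i e x p a r Y → b * i * (e * (x * (x * p))) * i * (a * (r * Y)) ≡ b * e * a * (p * r * Y) * (i * x * (i * x))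
        regroup′ = solve-∀ ℚ-ring
        count : fromℕ (numHurwitzTuples t (d ∸ q) β) ≡ K * (c * (x ^ s * (Y * Π)))
        count = begin
          fromℕ (numHurwitzTuples t (d ∸ q) β)
            ≡⟨ numHurwitzTuples-≡ t q β q<d ⟩
          ∑ (allPermutations d) (λ σ → ind (class? β σ) * T^ t (Q d (suc q)) σ)
            ≡⟨ ∑-cong (allPermutations d) (λ σ → ind-guard (class? β σ) (λ eq → trans (T^-Q q C t i i-inverse σ)
                 (cong (c *_) (D-↭ (↭-trans (↭-reflexive eq) (sort-↭ L)) (H q C t x))))) ⟩
          ∑ (allPermutations d) (λ σ → ind (class? β σ) * (c * V))
            ≡⟨ ∑-* (allPermutations d) (λ σ → ind (class? β σ)) (c * V) ⟨
          K * (c * V)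
            ≡⟨ cong (λ v → K * (c * v)) D-H ⟩
          K * (c * (x ^ s * (Y * Π))) ∎
        classes : X * K * Π ≡ 1ℚ
        classes = cancel-fromℕ (d !) (begin
          fromℕ (d !) * (X * K * Π)          ≡⟨ pull (fromℕ (d !)) X K Π ⟩
          K * (X * fromℕ (d !)) * Π          ≡⟨ cong (λ a → K * a * Π) X-eq ⟩
          K * fromℕ (aut β) * Π              ≡⟨ classSize β pos ⟩
          fromℕ (d !)                        ≡⟨ *-identityʳ (fromℕ (d !)) ⟨
          fromℕ (d !) * 1ℚ                   ∎)
          where
          pull : ∀ f X K Π → f * (X * K * Π) ≡ K * (X * f) * Π
          pull = solve-∀ ℚ-ring
        Z-value : Z ≡ inv! t * i
        Z-value = cancel-fromℕ (t ! ℕ.* d) (begin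
          fromℕ (t ! ℕ.* d) * Z                            ≡⟨ trans (*-comm (fromℕ (t ! ℕ.* d)) Z) Z-eq ⟩
          1ℚ * 1ℚ                                          ≡⟨ cong₂ _*_ (inv-* (t !) {{t ℕ.!≢0}}) i-inverse ⟨
          inv! t * fromℕ (t !) * (i * x)                   ≡⟨ pull (inv! t) (fromℕ (t !)) i x ⟩
          fromℕ (t !) * x * (inv! t * i)                   ≡⟨ cong (_* (inv! t * i)) (fromℕ-* (t !) d) ⟨
          fromℕ (t ! ℕ.* d) * (inv! t * i)                 ∎)
          where
          pull : ∀ a f i x → a * f * (i * x) ≡ f * x * (a * i)
          pull = solve-∀ ℚ-ring

    module _ (g : ℕ) (2g+n : 2 ℕ.* g ℕ.+ n ≡ q ℕ.+ 3 ℕ.+ w) where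

      private
        top : ℕ
        top = 4 ℕ.* g ℕ.+ n ∸ 3

      -- The exponents add up as follows: `w + s` from the outer power of `d`, `u` from the inner
      -- one, and `M - n` from `S`, with `s + u = q`.
      top-degree : top ℕ.+ n ≡ w ℕ.+ s ℕ.+ (u ℕ.+ M)
      top-degree = begin
        4 ℕ.* g ℕ.+ n ∸ 3 ℕ.+ n
          ≡⟨ cong (λ k → k ∸ 3 ℕ.+ n) (trans (split g n) (trans (cong (2 ℕ.* g ℕ.+_) 2g+n) (move g q w))) ⟩
        3 ℕ.+ (2 ℕ.* g ℕ.+ (q ℕ.+ w)) ∸ 3 ℕ.+ n
          ≡⟨ cong (ℕ._+ n) (ℕ.m+n∸m≡n 3 (2 ℕ.* g ℕ.+ (q ℕ.+ w))) ⟩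
        2 ℕ.* g ℕ.+ (q ℕ.+ w) ℕ.+ n
          ≡⟨ trans (swap (2 ℕ.* g) (q ℕ.+ w) n) (cong (ℕ._+ (q ℕ.+ w)) 2g+n) ⟩
        q ℕ.+ 3 ℕ.+ w ℕ.+ (q ℕ.+ w)
          ≡⟨ cong (λ k → q ℕ.+ 3 ℕ.+ w ℕ.+ (k ℕ.+ w)) s+u≡q ⟨
        q ℕ.+ 3 ℕ.+ w ℕ.+ (s ℕ.+ u ℕ.+ w)
          ≡⟨ gather q w s u ⟩
        w ℕ.+ s ℕ.+ (u ℕ.+ suc (q ℕ.+ (2 ℕ.+ w))) ∎
        where
        open ≡-Reasoning
        split : ∀ g n → 4 ℕ.* g ℕ.+ n ≡ 2 ℕ.* g ℕ.+ (2 ℕ.* g ℕ.+ n)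
        split = ℕ-Solver.solve-∀
        move : ∀ g q w → 2 ℕ.* g ℕ.+ (q ℕ.+ 3 ℕ.+ w) ≡ 3 ℕ.+ (2 ℕ.* g ℕ.+ (q ℕ.+ w))
        move = ℕ-Solver.solve-∀
        swap : ∀ a b n → a ℕ.+ b ℕ.+ n ≡ a ℕ.+ n ℕ.+ b
        swap = ℕ-Solver.solve-∀
        gather : ∀ q w s u → q ℕ.+ 3 ℕ.+ w ℕ.+ (s ℕ.+ u ℕ.+ w) ≡ w ℕ.+ s ℕ.+ (u ℕ.+ suc (q ℕ.+ (2 ℕ.+ w)))
        gather = ℕ-Solver.solve-∀

      leading-degree : All (λ m → degree m ≡ top) (factor leading)
      leading-degree = All.map (λ {m} eq → ℕ.+-cancelʳ-≡ n (degree m) top (trans eq (sym top-degree)))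
        (All.map⁺ (All-mulSum^-degree {X = λ k → k ℕ.+ n ≡ w ℕ.+ s ℕ.+ (u ℕ.+ M)} (w ℕ.+ s)
          (All.map (λ {m} eq → trans (ℕ.+-assoc (w ℕ.+ s) (degree m) n) (cong (w ℕ.+ s ℕ.+_) eq))
            (All.map⁺ (All-mulSum^-degree {X = λ k → k ℕ.+ n ≡ u ℕ.+ M} u
              (All.map (λ {m} eq → trans (ℕ.+-assoc u (degree m) n) (cong (u ℕ.+_) eq)) (S-degree n M)))))))

      remainder-degree : All (λ m → degree m < top) (factor remainder)
      remainder-degree = All.map (λ {m} lt → ℕ.+-cancelʳ-< n (degree m) top (subst (degree m ℕ.+ n <_) (sym top-degree) lt))
        (All.map⁺ (All-mulSum^-degree {X = λ k → k ℕ.+ n < w ℕ.+ s ℕ.+ (u ℕ.+ M)} (w ℕ.+ s)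
          (All.map (λ {m} lt → subst₂ _<_ (sym (ℕ.+-assoc (w ℕ.+ s) (degree m) n)) (cong (w ℕ.+ s ℕ.+_) (sym (ℕ.+-suc u (q ℕ.+ t))))
            (ℕ.+-monoʳ-< (w ℕ.+ s) lt)) (proj₂ (proj₂ (toPolynomial W-rest))))))

      -- The whole polynomial is a multiple of `(β₁ + … + βₙ) ^ (w + s)`.
      lower-bound : All (λ m → w ℕ.+ s ≤ degree m) P
      lower-bound = All.++⁺ (bounded leading) (bounded remainder)
        where
        bounded : ∀ R → All (λ m → w ℕ.+ s ≤ degree m) (factor R)
        bounded R = All.map⁺ (All-mulSum^-degree {X = w ℕ.+ s ≤_} (w ℕ.+ s) (All.universal (λ m → ℕ.m≤m+n (w ℕ.+ s) (degree m)) R))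

      -- The left side is `w + 1` for positive `q` and `w` for `q = 0`; the delta reflects that a
      -- factor `d` can be split off exactly for positive `q`, where `s = 1`.
      lowest-bound : 2 ℕ.* g ℕ.+ n ∸ (2 ℕ.+ δ 0 q ℕ.+ q) ≤ w ℕ.+ s
      lowest-bound = subst (λ k → k ∸ (2 ℕ.+ δ 0 q ℕ.+ q) ≤ w ℕ.+ s) (sym 2g+n) (by-cases q s s-value)
        where
        by-cases : ∀ q s → (q ≡ 0 × s ≡ 0) ⊎ (0 < q × s ≡ 1) → q ℕ.+ 3 ℕ.+ w ∸ (2 ℕ.+ δ 0 q ℕ.+ q) ≤ w ℕ.+ s
        by-cases zero    _ (inj₁ (refl , refl)) = ℕ.≤-reflexive (sym (ℕ.+-identityʳ w))
        by-cases (suc p) _ (inj₂ (_ , refl))    = ℕ.≤-reflexive (trans (cong (_∸ (2 ℕ.+ suc p)) (lemma p w)) (ℕ.m+n∸m≡n (2 ℕ.+ suc p) (w ℕ.+ 1)))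
          where
          lemma : ∀ p w → suc p ℕ.+ 3 ℕ.+ w ≡ 2 ℕ.+ suc p ℕ.+ (w ℕ.+ 1)
          lemma = ℕ-Solver.solve-∀

      hurwitz-≡ : ∀ (β : Vec ℕ n) → VecAll.All (0 <_) β → (q<∣β∣ : q < Vec.sum β) →
        hurwitz g (Vec.sum β ∸ q) β * 1/[ (2 ℕ.* g ℕ.+ n ∸ (1 ℕ.+ q)) !* Vec.sum β ] {{ℕ.>-nonZero (ℕ.m<n⇒0<n q<∣β∣)}}
        ≡ eval P (point β)
      hurwitz-≡ β pos q<d = trans
        (cong (λ k → X * fromℕ (numHurwitzTuples k (d ∸ q) β) * Z) length≡t)
        (hurwitz-eval β pos q<d X Z (/-*-fromℕ (aut β) (d !) {{d ℕ.!≢0}})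
          (trans (cong (λ k → Z * fromℕ (k ! ℕ.* d)) (sym index≡t)) (/-*-fromℕ 1 (t′ ! ℕ.* d) {{ℕ.m*n≢0 (t′ !) d {{t′ ℕ.!≢0}} {{d≢0}}}})))
        where
        d t′ : ℕ
        d = Vec.sum β
        t′ = 2 ℕ.* g ℕ.+ n ∸ (1 ℕ.+ q)
        d≢0 : ℕ.NonZero d
        d≢0 = ℕ.>-nonZero (ℕ.m<n⇒0<n q<d)
        X Z : ℚ
        X = _/_ (ℤ.+ aut β) (d !) {{d ℕ.!≢0}}
        Z = 1/[ t′ !* d ] {{d≢0}}
        index≡t : t′ ≡ t
        index≡t = trans (cong (_∸ (1 ℕ.+ q)) (trans 2g+n (lemma q w))) (ℕ.m+n∸m≡n (1 ℕ.+ q) (2 ℕ.+ w))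
          where
          lemma : ∀ q w → q ℕ.+ 3 ℕ.+ w ≡ 1 ℕ.+ q ℕ.+ (2 ℕ.+ w)
          lemma = ℕ-Solver.solve-∀
        -- `hurwitz` computes the number of transpositions from `d ∸ q`; this subtraction is exact
        -- by `q < d`, so the result agrees with the index of the factorial.
        length≡t : 2 ℕ.* g ℕ.+ n ℕ.+ (d ∸ q) ∸ (1 ℕ.+ d) ≡ t
        length≡t = trans (cong (_∸ (1 ℕ.+ d)) (trans (cong (ℕ._+ (d ∸ q)) 2g+n) (trans (lemma q w (d ∸ q)) (cong (λ k → suc k ℕ.+ (2 ℕ.+ w)) (ℕ.m∸n+n≡m (ℕ.<⇒≤ q<d))))))
                         (ℕ.m+n∸m≡n (1 ℕ.+ d) (2 ℕ.+ w))
          where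
          lemma : ∀ q w e → q ℕ.+ 3 ℕ.+ w ℕ.+ e ≡ suc (e ℕ.+ q) ℕ.+ (2 ℕ.+ w)
          lemma = ℕ-Solver.solve-∀

      S-nonempty-M : 0 < n → Nonempty (S n M)
      S-nonempty-M = nonempty n 2g+n
        where
        lemma : ∀ g n → g ℕ.* 2 ℕ.+ n ≡ 2 ℕ.* g ℕ.+ n
        lemma = ℕ-Solver.solve-∀
        lemma′ : ∀ q w → q ℕ.+ 3 ℕ.+ w ≡ suc (q ℕ.+ (2 ℕ.+ w))
        lemma′ = ℕ-Solver.solve-∀
        nonempty : ∀ n → 2 ℕ.* g ℕ.+ n ≡ q ℕ.+ 3 ℕ.+ w → 0 < n → Nonempty (S n M)
        nonempty (suc n) eq _ = subst (Nonempty ∘ S (suc n)) (trans (lemma g (suc n)) (trans eq (lemma′ q w))) (S-nonempty n g)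

      constant>0 : ℚ.Positive constant
      constant>0 = pos*pos⇒pos (inv 2 ^ q * inv 2 ^ t) {{pos*pos⇒pos (inv 2 ^ q) {{power q}} (inv 2 ^ t) {{power t}}}} (inv! t) {{inv-positive (t !) {{t ℕ.!≢0}}}}
        where
        power : ∀ k → ℚ.Positive (inv 2 ^ k)
        power zero    = _
        power (suc k) = pos*pos⇒pos (inv 2) {{inv-positive 2}} (inv 2 ^ k) {{power k}}

      is-highest : 0 < n → IsHighestDegree P top
      is-highest 0<n = highestDegree
        (scaleBy-positive constant {{constant>0}} (All-mulSum^-positive (w ℕ.+ s) (scaleBy-positive κ {{κ>0}} (All-mulSum^-positive u (S-positive n M)))))
        (Nonempty-scaleBy constant (Nonempty-mulSum^ 0<n (w ℕ.+ s) (Nonempty-scaleBy κ (Nonempty-mulSum^ 0<n u (S-nonempty-M 0<n))))) leading-degree remainder-degree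

      is-lowest : 0 < n → ∃ λ k → IsLowestDegree P k × 2 ℕ.* g ℕ.+ n ∸ (2 ℕ.+ δ 0 q ℕ.+ q) ≤ k
      is-lowest 0<n = let l , lowest , ≥ = lowestDegree-≥ lower-bound (is-highest 0<n) in l , lowest , ℕ.≤-trans lowest-bound ≥

open import Data.Nat using (ℕ; _+_; _*_; _∸_; _≤_; _<_; >-nonZero)
open import Data.Nat.Properties using (m<n⇒0<n; m+[n∸m]≡n)
open import Data.Product using (∃; _×_; _,_)
open import Data.Rational using () renaming (_*_ to _*ℚ_)
open import Data.Vec using (Vec; map; sum)
open import Data.Vec.Relation.Unary.All using (All)
open import Relation.Binary.PropositionalEquality using (_≡_; sym)

theorem3p6 : (q n g : ℕ) → 0 < n → q + 3 ≤ 2 * g + n →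
    ∃ λ (P : Polynomial n) →
    ((β : Vec ℕ n) → All (0 <_) β → (q<∣β∣ : q < sum β) →
    hurwitz g (sum β ∸ q) β
    *ℚ 1/[ (2 * g + n ∸ (1 + q)) !* sum β ] {{>-nonZero (m<n⇒0<n q<∣β∣)}}
    ≡ eval P (map fromℕ β))
    × (∃ λ k → IsLowestDegree P k × 2 * g + n ∸ (2 + δ 0 q + q) ≤ k)
    × IsHighestDegree P (4 * g + n ∸ 3)
theorem3p6 q n g 0<n q+3≤2g+n = P , hurwitz-≡ g 2g+n≡ , is-lowest g 2g+n≡ 0<n , is-highest g 2g+n≡ 0<n
  where
  open Assembly.HurwitzPolynomial n q (2 * g + n ∸ (q + 3))
  2g+n≡ : 2 * g + n ≡ q + 3 + (2 * g + n ∸ (q + 3))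
  2g+n≡ = sym (m+[n∸m]≡n q+3≤2g+n)
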